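{- The following two statements are equivalent. (1) (Sensitivity Conjecture) There exists a univariate real polynomial $p$ such that for every $n\ge 1$ and every Boolean function $f:\{0,1\}^n\to\{0,1\}$, $bs(f)\le p(s(f))$. (2) There exists a univariate real polynomial $q$ such that for every $n\ge 1$ and every Boolean function $f:\{0,1\}^n\to\{0,1\}$, $\log \operatorname{rank}[f(x\wedge y)]\le q(s(f))$.
   Context: For $B\subseteq[n]=\{1,\dots,n\}$ let $e_B\in\{0,1\}^n$ be the characteristic vector of $B$, and let $e_i=e_{\{i\}}$. Let $\oplus$ and $\wedge$ denote bitwise XOR and bitwise AND on $\{0,1\}^n$. For $f$ on $\{0,1\}^n$ and $x\in\{0,1\}^n$, the sensitivity $s(f,x)$ is the number of $i\in[n]$ with $f(x\oplus e_i)\ne f(x)$, and $s(f)=\max_x s(f,x)$. A block $B\subseteq[n]$ is sensitive for $f$ on $x$ if $f(x\oplus e_B)\neq f(x)$. The block sensitivity $bs(f,x)$ is the maximum number of pairwise disjoint sensitive blocks of $f$ on $x$, and $bs(f)=\max_x bs(f,x)$. $\operatorname{rank}[f(x\wedge y)]$ denotes the rank over $\mathbb{R}$ of the $2^n\times 2^n$ matrix $M$ with rows and columns indexed by $x,y\in\{0,1\}^n$ and entries $M_{x,y}=f(x\wedge y)$. Logarithms are base 2, with $\log 0=-\infty$ (relevant only for $f\equiv 0$). The polynomials $p$ and $q$ do not depend on $n$ or $f$. -}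

module Defs where

open import Algebra.Bundles using (CommutativeRing)
open import Algebra.Structures using (IsCommutativeRing)
open import Data.Bool.Base as Bool using (Bool; true; false; if_then_else_; _xor_)
import Data.Bool.Properties as Bool
open import Data.Fin.Base using (Fin)
open import Data.Fin.Subset using (Subset; ⁅_⁆; _∩_; Empty)
open import Data.Fin.Subset.Properties using (nonempty?)
import Data.Integer.Base as ℤ
import Data.Integer.Properties as ℤ
open import Data.List.Base using (List; []; _∷_; _++_; map; filter; foldr; length; allFin)
open import Data.List.Extrema.Nat using (max)
open import Data.List.Relation.Unary.AllPairs using (AllPairs; allPairs?)
open import Data.Nat.Base as ℕ using (ℕ; zero; suc; z≤n; s≤s)
open import Data.Nat.Induction using (<-wellFounded)
open import Data.Nat.Logarithm using (⌊log₂_⌋; ⌊log₂⌋-mono-≤; ⌊log₂[2^n]⌋≡n)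
open import Data.Nat.Logarithm.Core using (⌊log2⌋)
import Data.Nat.Properties as ℕ
open import Data.Product.Base using (Σ; ∃; _×_; _,_; proj₁; proj₂)
open import Data.Rational.Base as ℚ using (ℚ; 0ℚ; 1ℚ; ½; mkℚ; *<*; fromℚᵘ; toℚᵘ; Positive; NonNegative)
import Data.Rational.Properties as ℚ
import Data.Rational.Unnormalised.Base as ℚᵘ
import Data.Rational.Unnormalised.Properties as ℚᵘ
open import Data.Rational.Solver using (module +-*-Solver)
open import Data.Integer.Solver using () renaming (module +-*-Solver to ℤ-Solver)
open import Data.Sum.Base using (inj₁; inj₂)
open import Data.Vec.Base as Vec using (Vec; []; _∷_; zipWith)
open import Induction.WellFounded using (Acc; acc)
open import Level using (0ℓ)
open import Relation.Binary.PropositionalEquality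
  using (_≡_; refl; sym; trans; cong; cong₂; subst; subst₂)
open import Relation.Binary.Structures using (IsEquivalence)
open import Relation.Nullary using (¬_; Dec; ¬?)
open import Relation.Nullary.Construct.Add.Infimum using (_₋; ⊥₋; [_])

------------------------------------------------------------------------
-- Real numbers, as Cauchy sequences of rationals

tri : ∀ a b c → ℚ.∣ a ℚ.- c ∣ ℚ.≤ ℚ.∣ a ℚ.- b ∣ ℚ.+ ℚ.∣ b ℚ.- c ∣
tri a b c = subst (ℚ._≤ ℚ.∣ a ℚ.- b ∣ ℚ.+ ℚ.∣ b ℚ.- c ∣) (cong ℚ.∣_∣ (eq a b c)) (ℚ.∣p+q∣≤∣p∣+∣q∣ (a ℚ.- b) (b ℚ.- c))
  where
  eq : ∀ a b c → (a ℚ.- b) ℚ.+ (b ℚ.- c) ≡ a ℚ.- c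
  eq = solve 3 (λ a b c → (a :- b) :+ (b :- c) := a :- c) refl
    where open +-*-Solver

∣-∣-comm : ∀ a b → ℚ.∣ a ℚ.- b ∣ ≡ ℚ.∣ b ℚ.- a ∣
∣-∣-comm a b = trans (cong ℚ.∣_∣ (eq a b)) (ℚ.∣-p∣≡∣p∣ (b ℚ.- a))
  where
  eq : ∀ a b → a ℚ.- b ≡ ℚ.- (b ℚ.- a)
  eq = solve 2 (λ a b → a :- b := :- (b :- a)) refl
    where open +-*-Solver

∣-∣-+ : ∀ a b c d → ℚ.∣ (a ℚ.+ b) ℚ.- (c ℚ.+ d) ∣ ℚ.≤ ℚ.∣ a ℚ.- c ∣ ℚ.+ ℚ.∣ b ℚ.- d ∣
∣-∣-+ a b c d = subst (ℚ._≤ ℚ.∣ a ℚ.- c ∣ ℚ.+ ℚ.∣ b ℚ.- d ∣) (cong ℚ.∣_∣ (eq a b c d))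
  (ℚ.∣p+q∣≤∣p∣+∣q∣ (a ℚ.- c) (b ℚ.- d))
  where
  eq : ∀ a b c d → (a ℚ.- c) ℚ.+ (b ℚ.- d) ≡ (a ℚ.+ b) ℚ.- (c ℚ.+ d)
  eq = solve 4 (λ a b c d → (a :- c) :+ (b :- d) := (a :+ b) :- (c :+ d)) refl
    where open +-*-Solver

∣-∣-neg : ∀ a b → ℚ.∣ (ℚ.- a) ℚ.- (ℚ.- b) ∣ ≡ ℚ.∣ a ℚ.- b ∣
∣-∣-neg a b = trans (cong ℚ.∣_∣ (eq a b)) (ℚ.∣-p∣≡∣p∣ (a ℚ.- b))
  where
  eq : ∀ a b → (ℚ.- a) ℚ.- (ℚ.- b) ≡ ℚ.- (a ℚ.- b)
  eq = solve 2 (λ a b → (:- a) :- (:- b) := :- (a :- b)) refl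
    where open +-*-Solver

∣-∣-* : ∀ a b c d → ℚ.∣ (a ℚ.* b) ℚ.- (c ℚ.* d) ∣ ℚ.≤
        ℚ.∣ b ℚ.- d ∣ ℚ.* ℚ.∣ a ∣ ℚ.+ ℚ.∣ a ℚ.- c ∣ ℚ.* ℚ.∣ d ∣
∣-∣-* a b c d = subst₂ ℚ._≤_ (cong ℚ.∣_∣ (eq a b c d))
  (cong₂ ℚ._+_ (ℚ.∣p*q∣≡∣p∣*∣q∣ (b ℚ.- d) a) (ℚ.∣p*q∣≡∣p∣*∣q∣ (a ℚ.- c) d))
  (ℚ.∣p+q∣≤∣p∣+∣q∣ ((b ℚ.- d) ℚ.* a) ((a ℚ.- c) ℚ.* d))
  where
  eq : ∀ a b c d → ((b ℚ.- d) ℚ.* a) ℚ.+ ((a ℚ.- c) ℚ.* d) ≡ (a ℚ.* b) ℚ.- (c ℚ.* d)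
  eq = solve 4 (λ a b c d → ((b :- d) :* a) :+ ((a :- c) :* d) := (a :* b) :- (c :* d)) refl
    where open +-*-Solver

half : ∀ ε → ½ ℚ.* ε ℚ.+ ½ ℚ.* ε ≡ ε
half ε = trans (sym (ℚ.*-distribʳ-+ ε ½ ½)) (ℚ.*-identityˡ ε)

half-pos : ∀ {ε} → 0ℚ ℚ.< ε → 0ℚ ℚ.< ½ ℚ.* ε
half-pos {ε} ε>0 = subst (ℚ._< ½ ℚ.* ε) (ℚ.*-zeroʳ ½) (ℚ.*-monoʳ-<-pos ½ ε>0)

-- Choose δ so small that δ * K = ε.
divide : ∀ {K ε} → 0ℚ ℚ.< K → 0ℚ ℚ.< ε → ∃ λ δ → 0ℚ ℚ.< δ × δ ℚ.* K ≡ ε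
divide {K} {ε} K>0 ε>0 = δ , δ>0 , δK≡ε
  where
  instance
    K⁺ : Positive K
    K⁺ = ℚ.positive K>0
    K≢0 : ℚ.NonZero K
    K≢0 = ℚ.pos⇒nonZero K
    ε⁺ : Positive ε
    ε⁺ = ℚ.positive ε>0
    K⁻¹⁺ : Positive (ℚ.1/ K)
    K⁻¹⁺ = ℚ.1/pos⇒pos K
  δ : ℚ
  δ = ε ℚ.* (ℚ.1/ K)
  δ>0 : 0ℚ ℚ.< δ
  δ>0 = ℚ.positive⁻¹ δ {{ℚ.pos*pos⇒pos ε (ℚ.1/ K)}}
  δK≡ε : δ ℚ.* K ≡ ε
  δK≡ε = trans (ℚ.*-assoc ε (ℚ.1/ K) K)
    (trans (cong (ε ℚ.*_) (ℚ.*-inverseˡ K)) (ℚ.*-identityʳ ε))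

*-bound : ∀ {p q δ K} → 0ℚ ℚ.< δ → ℚ.∣ p ∣ ℚ.≤ δ → ℚ.∣ q ∣ ℚ.≤ K →
          ℚ.∣ p ∣ ℚ.* ℚ.∣ q ∣ ℚ.≤ δ ℚ.* K
*-bound {p} {q} {δ} {K} δ>0 p≤δ q≤K = ℚ.≤-trans
  (ℚ.*-monoʳ-≤-nonNeg ℚ.∣ q ∣ {{ℚ.∣-∣-nonNeg q}} p≤δ)
  (ℚ.*-monoˡ-≤-nonNeg δ {{ℚ.nonNegative (ℚ.<⇒≤ δ>0)}} q≤K)

IsCauchy : (ℕ → ℚ) → Set
IsCauchy x = ∀ ε → 0ℚ ℚ.< ε →
  ∃ λ N → ∀ m n → N ℕ.≤ m → N ℕ.≤ n → ℚ.∣ x m ℚ.- x n ∣ ℚ.≤ ε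

record ℝ : Set where
  constructor mkℝ
  field
    seq    : ℕ → ℚ
    cauchy : IsCauchy seq

open ℝ public

infix 4 _≈_ _≤_

record _≈_ (x y : ℝ) : Set where
  constructor mk≈
  field
    run≈ : ∀ ε → 0ℚ ℚ.< ε →
      ∃ λ N → ∀ n → N ℕ.≤ n → ℚ.∣ seq x n ℚ.- seq y n ∣ ℚ.≤ ε

record _≤_ (x y : ℝ) : Set where
  constructor mk≤
  field
    run≤ : ∀ ε → 0ℚ ℚ.< ε →
      ∃ λ N → ∀ n → N ℕ.≤ n → seq x n ℚ.≤ seq y n ℚ.+ ε

open _≈_ public
open _≤_ public

fromℚ : ℚ → ℝ
fromℚ q = mkℝ (λ _ → q) λ ε ε>0 → 0 , λ _ _ _ _ →
  subst (ℚ._≤ ε) (sym (cong ℚ.∣_∣ (ℚ.+-inverseʳ q))) (ℚ.<⇒≤ ε>0)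

fromℕ : ℕ → ℝ
fromℕ k = fromℚ (ℤ.+ k ℚ./ 1)

0ℝ 1ℝ : ℝ
0ℝ = fromℚ 0ℚ
1ℝ = fromℚ 1ℚ

bounded : ∀ x → ∃ λ K → 0ℚ ℚ.< K × ∃ λ N → ∀ n → N ℕ.≤ n → ℚ.∣ seq x n ∣ ℚ.≤ K
bounded x = K , K>0 , N , λ n N≤n → ℚ.≤-trans (step n)
    (ℚ.+-monoʳ-≤ ℚ.∣ seq x N ∣ (xN n N ℕ.≤-refl N≤n))
  where
  N  = proj₁ (cauchy x 1ℚ (ℚ.positive⁻¹ 1ℚ))
  xN : ∀ n N′ → N ℕ.≤ N′ → N ℕ.≤ n → ℚ.∣ seq x n ℚ.- seq x N′ ∣ ℚ.≤ 1ℚ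
  xN n N′ p q = proj₂ (cauchy x 1ℚ (ℚ.positive⁻¹ 1ℚ)) n N′ q p
  K = ℚ.∣ seq x N ∣ ℚ.+ 1ℚ
  K>0 : 0ℚ ℚ.< K
  K>0 = ℚ.+-mono-≤-< (ℚ.0≤∣p∣ (seq x N)) (ℚ.positive⁻¹ 1ℚ)
  eq : ∀ a b → b ℚ.+ (a ℚ.- b) ≡ a
  eq = solve 2 (λ a b → b :+ (a :- b) := a) refl
    where open +-*-Solver
  step : ∀ n → ℚ.∣ seq x n ∣ ℚ.≤ ℚ.∣ seq x N ∣ ℚ.+ ℚ.∣ seq x n ℚ.- seq x N ∣
  step n = subst (ℚ._≤ ℚ.∣ seq x N ∣ ℚ.+ ℚ.∣ seq x n ℚ.- seq x N ∣) (cong ℚ.∣_∣ (eq (seq x n) (seq x N)))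
    (ℚ.∣p+q∣≤∣p∣+∣q∣ (seq x N) (seq x n ℚ.- seq x N))

infixl 6 _+_
infixl 7 _*_
infix  8 -_

abstract
  +-cauchy : ∀ x y → IsCauchy (λ n → seq x n ℚ.+ seq y n)
  +-cauchy x y = λ ε ε>0 →
    let M , p = cauchy x (½ ℚ.* ε) (half-pos ε>0)
        N , q = cauchy y (½ ℚ.* ε) (half-pos ε>0)
    in M ℕ.⊔ N , λ m n u v → subst (_ ℚ.≤_) (half ε) (ℚ.≤-trans
         (∣-∣-+ (seq x m) (seq y m) (seq x n) (seq y n))
         (ℚ.+-mono-≤ (p m n (ℕ.m⊔n≤o⇒m≤o M N u) (ℕ.m⊔n≤o⇒m≤o M N v))
                     (q m n (ℕ.m⊔n≤o⇒n≤o M N u) (ℕ.m⊔n≤o⇒n≤o M N v))))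

  neg-cauchy : ∀ x → IsCauchy (λ n → ℚ.- seq x n)
  neg-cauchy x = λ ε ε>0 →
    let N , p = cauchy x ε ε>0
    in N , λ m n u v → subst (ℚ._≤ ε) (sym (∣-∣-neg (seq x m) (seq x n))) (p m n u v)

  *-cauchy : ∀ x y → IsCauchy (λ n → seq x n ℚ.* seq y n)
  *-cauchy x y = λ ε ε>0 →
    let K , K>0 , A , a = bounded x
        L , L>0 , B , b = bounded y
        δ , δ>0 , δK≡ε/2 = divide K>0 (half-pos ε>0)
        η , η>0 , ηL≡ε/2 = divide L>0 (half-pos ε>0)
        M , p = cauchy x η η>0
        N , q = cauchy y δ δ>0
        C = A ℕ.⊔ B
        D = M ℕ.⊔ N
    in C ℕ.⊔ D , λ m n u v →
      let m≥C = ℕ.m⊔n≤o⇒m≤o C D u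
          n≥C = ℕ.m⊔n≤o⇒m≤o C D v
          m≥D = ℕ.m⊔n≤o⇒n≤o C D u
          n≥D = ℕ.m⊔n≤o⇒n≤o C D v
      in subst (_ ℚ.≤_) (trans (cong₂ ℚ._+_ δK≡ε/2 ηL≡ε/2) (half ε)) (ℚ.≤-trans
           (∣-∣-* (seq x m) (seq y m) (seq x n) (seq y n))
           (ℚ.+-mono-≤
             (*-bound {seq y m ℚ.- seq y n} {seq x m} δ>0
               (q m n (ℕ.m⊔n≤o⇒n≤o M N m≥D) (ℕ.m⊔n≤o⇒n≤o M N n≥D))
               (a m (ℕ.m⊔n≤o⇒m≤o A B m≥C)))
             (*-bound {seq x m ℚ.- seq x n} {seq y n} η>0
               (p m n (ℕ.m⊔n≤o⇒m≤o M N m≥D) (ℕ.m⊔n≤o⇒m≤o M N n≥D))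
               (b n (ℕ.m⊔n≤o⇒n≤o A B n≥C)))))

_+_ : ℝ → ℝ → ℝ
x + y = mkℝ (λ n → seq x n ℚ.+ seq y n) (+-cauchy x y)

-_ : ℝ → ℝ
- x = mkℝ (λ n → ℚ.- seq x n) (neg-cauchy x)

_*_ : ℝ → ℝ → ℝ
x * y = mkℝ (λ n → seq x n ℚ.* seq y n) (*-cauchy x y)

pointwise⇒≈ : ∀ {x y} → (∀ n → seq x n ≡ seq y n) → x ≈ y
pointwise⇒≈ {x} {y} eq = mk≈ λ ε ε>0 → 0 , λ n _ →
  subst (ℚ._≤ ε) (sym (cong ℚ.∣_∣ (trans (cong (ℚ._- seq y n) (eq n)) (ℚ.+-inverseʳ (seq y n)))))
    (ℚ.<⇒≤ ε>0)

≈-isEquivalence : IsEquivalence _≈_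
≈-isEquivalence = record
  { refl  = pointwise⇒≈ (λ _ → refl)
  ; sym   = λ {x} {y} x≈y → mk≈ λ ε ε>0 → let N , p = run≈ x≈y ε ε>0 in
      N , λ n u → subst (ℚ._≤ ε) (∣-∣-comm (seq x n) (seq y n)) (p n u)
  ; trans = λ {x} {y} {z} x≈y y≈z → mk≈ λ ε ε>0 →
      let M , p = run≈ x≈y (½ ℚ.* ε) (half-pos ε>0)
          N , q = run≈ y≈z (½ ℚ.* ε) (half-pos ε>0)
      in M ℕ.⊔ N , λ n u → subst (_ ℚ.≤_) (half ε) (ℚ.≤-trans
           (tri (seq x n) (seq y n) (seq z n))
           (ℚ.+-mono-≤ (p n (ℕ.m⊔n≤o⇒m≤o M N u)) (q n (ℕ.m⊔n≤o⇒n≤o M N u))))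
  }

+-cong : ∀ {x x′ y y′} → x ≈ x′ → y ≈ y′ → x + y ≈ x′ + y′
+-cong {x} {x′} {y} {y′} x≈x′ y≈y′ = mk≈ λ ε ε>0 →
  let M , p = run≈ x≈x′ (½ ℚ.* ε) (half-pos ε>0)
      N , q = run≈ y≈y′ (½ ℚ.* ε) (half-pos ε>0)
  in M ℕ.⊔ N , λ n u → subst (_ ℚ.≤_) (half ε) (ℚ.≤-trans
       (∣-∣-+ (seq x n) (seq y n) (seq x′ n) (seq y′ n))
       (ℚ.+-mono-≤ (p n (ℕ.m⊔n≤o⇒m≤o M N u)) (q n (ℕ.m⊔n≤o⇒n≤o M N u))))

-‿cong : ∀ {x y} → x ≈ y → - x ≈ - y
-‿cong {x} {y} x≈y = mk≈ λ ε ε>0 →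
  let N , p = run≈ x≈y ε ε>0
  in N , λ n u → subst (ℚ._≤ ε) (sym (∣-∣-neg (seq x n) (seq y n))) (p n u)

*-cong : ∀ {x x′ y y′} → x ≈ x′ → y ≈ y′ → x * y ≈ x′ * y′
*-cong {x} {x′} {y} {y′} x≈x′ y≈y′ = mk≈ λ ε ε>0 →
  let K , K>0 , A , a = bounded x
      L , L>0 , B , b = bounded y′
      δ , δ>0 , δK≡ε/2 = divide K>0 (half-pos ε>0)
      η , η>0 , ηL≡ε/2 = divide L>0 (half-pos ε>0)
      M , p = run≈ x≈x′ η η>0
      N , q = run≈ y≈y′ δ δ>0
      C = A ℕ.⊔ B
      D = M ℕ.⊔ N
  in C ℕ.⊔ D , λ n u →
    let n≥C = ℕ.m⊔n≤o⇒m≤o C D u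
        n≥D = ℕ.m⊔n≤o⇒n≤o C D u
    in subst (_ ℚ.≤_) (trans (cong₂ ℚ._+_ δK≡ε/2 ηL≡ε/2) (half ε)) (ℚ.≤-trans
         (∣-∣-* (seq x n) (seq y n) (seq x′ n) (seq y′ n))
         (ℚ.+-mono-≤
           (*-bound {seq y n ℚ.- seq y′ n} {seq x n} δ>0
             (q n (ℕ.m⊔n≤o⇒n≤o M N n≥D)) (a n (ℕ.m⊔n≤o⇒m≤o A B n≥C)))
           (*-bound {seq x n ℚ.- seq x′ n} {seq y′ n} η>0
             (p n (ℕ.m⊔n≤o⇒m≤o M N n≥D)) (b n (ℕ.m⊔n≤o⇒n≤o A B n≥C)))))

+-*-isCommutativeRing : IsCommutativeRing _≈_ _+_ _*_ -_ 0ℝ 1ℝ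
+-*-isCommutativeRing = record
  { isRing = record
    { +-isAbelianGroup = record
      { isGroup = record
        { isMonoid = record
          { isSemigroup = record
            { isMagma = record
              { isEquivalence = ≈-isEquivalence
              ; ∙-cong = +-cong
              }
            ; assoc = λ x y z → pointwise⇒≈
                (λ n → ℚ.+-assoc (seq x n) (seq y n) (seq z n))
            }
          ; identity =
              (λ x → pointwise⇒≈ (λ n → ℚ.+-identityˡ (seq x n)))
            , (λ x → pointwise⇒≈ (λ n → ℚ.+-identityʳ (seq x n)))
          }
        ; inverse =
            (λ x → pointwise⇒≈ (λ n → ℚ.+-inverseˡ (seq x n)))
          , (λ x → pointwise⇒≈ (λ n → ℚ.+-inverseʳ (seq x n)))
        ; ⁻¹-cong = -‿cong
        }
      ; comm = λ x y → pointwise⇒≈ (λ n → ℚ.+-comm (seq x n) (seq y n))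
      }
    ; *-cong = *-cong
    ; *-assoc = λ x y z → pointwise⇒≈
        (λ n → ℚ.*-assoc (seq x n) (seq y n) (seq z n))
    ; *-identity =
        (λ x → pointwise⇒≈ (λ n → ℚ.*-identityˡ (seq x n)))
      , (λ x → pointwise⇒≈ (λ n → ℚ.*-identityʳ (seq x n)))
    ; distrib =
        (λ x y z → pointwise⇒≈
          (λ n → ℚ.*-distribˡ-+ (seq x n) (seq y n) (seq z n)))
      , (λ x y z → pointwise⇒≈
          (λ n → ℚ.*-distribʳ-+ (seq x n) (seq y n) (seq z n)))
    }
  ; *-comm = λ x y → pointwise⇒≈ (λ n → ℚ.*-comm (seq x n) (seq y n))
  }

+-*-commutativeRing : CommutativeRing 0ℓ 0ℓ
+-*-commutativeRing = record { isCommutativeRing = +-*-isCommutativeRing }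

------------------------------------------------------------------------
-- Logarithm base 2 of a natural number, with log₂ 0 = −∞

2^⌊log₂n⌋≤n : ∀ n → 1 ℕ.≤ n → 2 ℕ.^ ⌊log₂ n ⌋ ℕ.≤ n
2^⌊log₂n⌋≤n n = go n (<-wellFounded n)
  where
  go : ∀ n (rec : Acc ℕ._<_ n) → 1 ℕ.≤ n → 2 ℕ.^ ⌊log2⌋ n rec ℕ.≤ n
  go 1             _        _ = ℕ.≤-refl
  go (suc (suc n)) (acc rs) _ = ℕ.≤-trans
    (ℕ.*-monoʳ-≤ 2 (go (suc ℕ.⌊ n /2⌋) (rs (ℕ.⌊n/2⌋<n (suc n))) (s≤s z≤n)))
    (ℕ.≤-trans (ℕ.≤-reflexive (ℕ.*-suc 2 ℕ.⌊ n /2⌋)) (s≤s (s≤s (2⌊n/2⌋≤n n))))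
    where
    2⌊n/2⌋≤n : ∀ n → 2 ℕ.* ℕ.⌊ n /2⌋ ℕ.≤ n
    2⌊n/2⌋≤n n = ℕ.≤-trans
      (ℕ.+-monoʳ-≤ ℕ.⌊ n /2⌋ (ℕ.≤-trans (ℕ.≤-reflexive (ℕ.+-identityʳ _)) (ℕ.⌊n/2⌋≤⌈n/2⌉ n)))
      (ℕ.≤-reflexive (ℕ.⌊n/2⌋+⌈n/2⌉≡n n))

n<2^[1+⌊log₂n⌋] : ∀ n → n ℕ.< 2 ℕ.^ suc ⌊log₂ n ⌋
n<2^[1+⌊log₂n⌋] n = ℕ.≰⇒> λ 2^≤n → ℕ.1+n≰n
  (subst (ℕ._≤ ⌊log₂ n ⌋) (⌊log₂[2^n]⌋≡n (suc ⌊log₂ n ⌋)) (⌊log₂⌋-mono-≤ 2^≤n))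

module Log (r : ℕ) (r≥1 : 1 ℕ.≤ r) where

  a : ℕ → ℕ
  a n = ⌊log₂ (r ℕ.^ suc n) ⌋

  approx : ℕ → ℚ
  approx n = ℤ.+ a n ℚ./ suc n

  r^≥1 : ∀ n → 1 ℕ.≤ r ℕ.^ n
  r^≥1 n = ℕ.m^n>0 r {{ℕ.>-nonZero r≥1}} n

  cross : ∀ m n → a n ℕ.* suc m ℕ.≤ suc (a m) ℕ.* suc n
  cross m n = ℕ.≮⇒≥ λ lt → ℕ.<⇒≱ 2^ (ℕ.^-monoʳ-≤ 2 (ℕ.<⇒≤ lt))
    where
    open ℕ.≤-Reasoning
    2^ : 2 ℕ.^ (a n ℕ.* suc m) ℕ.< 2 ℕ.^ (suc (a m) ℕ.* suc n)
    2^ = begin-strict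
      2 ℕ.^ (a n ℕ.* suc m)         ≡⟨ ℕ.^-*-assoc 2 (a n) (suc m) ⟨
      (2 ℕ.^ a n) ℕ.^ suc m         ≤⟨ ℕ.^-monoˡ-≤ (suc m) (2^⌊log₂n⌋≤n _ (r^≥1 (suc n))) ⟩
      (r ℕ.^ suc n) ℕ.^ suc m       ≡⟨ ℕ.^-*-assoc r (suc n) (suc m) ⟩
      r ℕ.^ (suc n ℕ.* suc m)       ≡⟨ cong (r ℕ.^_) (ℕ.*-comm (suc n) (suc m)) ⟩
      r ℕ.^ (suc m ℕ.* suc n)       ≡⟨ ℕ.^-*-assoc r (suc m) (suc n) ⟨
      (r ℕ.^ suc m) ℕ.^ suc n       <⟨ ℕ.^-monoˡ-< (suc n) (n<2^[1+⌊log₂n⌋] (r ℕ.^ suc m)) ⟩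
      (2 ℕ.^ suc (a m)) ℕ.^ suc n   ≡⟨ ℕ.^-*-assoc 2 (suc (a m)) (suc n) ⟩
      2 ℕ.^ (suc (a m) ℕ.* suc n)   ∎

  fromℚᵘ-mono-≤ : ∀ {p q} → p ℚᵘ.≤ q → fromℚᵘ p ℚ.≤ fromℚᵘ q
  fromℚᵘ-mono-≤ {p} {q} p≤q = ℚ.toℚᵘ-cancel-≤
    (ℚᵘ.≤-respˡ-≃ (ℚᵘ.≃-sym (ℚ.toℚᵘ-fromℚᵘ p))
      (ℚᵘ.≤-respʳ-≃ (ℚᵘ.≃-sym (ℚ.toℚᵘ-fromℚᵘ q)) p≤q))

  split : ∀ k m → ℤ.+ suc k ℚ./ suc m ≡ (ℤ.+ k ℚ./ suc m) ℚ.+ (ℤ.+ 1 ℚ./ suc m)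
  split k m = ℚ.toℚᵘ-injective (begin
    toℚᵘ (fromℚᵘ (ℚᵘ.mkℚᵘ (ℤ.+ suc k) m))                     ≈⟨ ℚ.toℚᵘ-fromℚᵘ _ ⟩
    ℚᵘ.mkℚᵘ (ℤ.+ suc k) m                                     ≈⟨ ℚᵘ.*≡* (eq (ℤ.+ k) (ℤ.+ suc m)) ⟩
    ℚᵘ.mkℚᵘ (ℤ.+ k) m ℚᵘ.+ ℚᵘ.mkℚᵘ (ℤ.+ 1) m
      ≈⟨ ℚᵘ.+-cong (ℚ.toℚᵘ-fromℚᵘ (ℚᵘ.mkℚᵘ (ℤ.+ k) m)) (ℚ.toℚᵘ-fromℚᵘ (ℚᵘ.mkℚᵘ (ℤ.+ 1) m)) ⟨
    toℚᵘ (ℤ.+ k ℚ./ suc m) ℚᵘ.+ toℚᵘ (ℤ.+ 1 ℚ./ suc m)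
      ≈⟨ ℚ.toℚᵘ-homo-+ (ℤ.+ k ℚ./ suc m) (ℤ.+ 1 ℚ./ suc m) ⟨
    toℚᵘ ((ℤ.+ k ℚ./ suc m) ℚ.+ (ℤ.+ 1 ℚ./ suc m))            ∎)
    where
    open ℚᵘ.≃-Reasoning
    eq : ∀ k d → (ℤ.+ 1 ℤ.+ k) ℤ.* (d ℤ.* d) ≡ (k ℤ.* d ℤ.+ ℤ.+ 1 ℤ.* d) ℤ.* d
    eq = solve 2 (λ k d → (con (ℤ.+ 1) :+ k) :* (d :* d) := (k :* d :+ con (ℤ.+ 1) :* d) :* d) refl
      where open ℤ-Solver

  approx-≤ : ∀ m n → approx n ℚ.≤ approx m ℚ.+ (ℤ.+ 1 ℚ./ suc m)
  approx-≤ m n = subst (approx n ℚ.≤_) (split (a m) m)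
    (fromℚᵘ-mono-≤ {ℚᵘ.mkℚᵘ (ℤ.+ a n) n} {ℚᵘ.mkℚᵘ (ℤ.+ suc (a m)) m} (ℚᵘ.*≤* (subst₂ ℤ._≤_ (ℤ.pos-* (a n) (suc m)) (ℤ.pos-* (suc (a m)) (suc n))
      (ℤ.+≤+ (cross m n)))))

  small : ∀ ε → 0ℚ ℚ.< ε → ∃ λ N → ∀ m → N ℕ.≤ m → ℤ.+ 1 ℚ./ suc m ℚ.≤ ε
  small (mkℚ (ℤ.+ suc k) d _) _ = d , λ m d≤m → ℚ.toℚᵘ-cancel-≤
    (ℚᵘ.≤-respˡ-≃ (ℚᵘ.≃-sym (ℚ.toℚᵘ-fromℚᵘ (ℚᵘ.mkℚᵘ (ℤ.+ 1) m)))
      (ℚᵘ.*≤* (subst₂ ℤ._≤_ (ℤ.pos-* 1 (suc d)) (ℤ.pos-* (suc k) (suc m))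
        (ℤ.+≤+ (ℕ.*-mono-≤ (s≤s (z≤n {k})) (s≤s d≤m))))))
  small (mkℚ (ℤ.+ 0) d _) (*<* (ℤ.+<+ ()))
  small (mkℚ ℤ.-[1+ _ ] d _) (*<* ())

  ∣-∣-≤ : ∀ {p q ε} → p ℚ.≤ q ℚ.+ ε → q ℚ.≤ p ℚ.+ ε → ℚ.∣ p ℚ.- q ∣ ℚ.≤ ε
  ∣-∣-≤ {p} {q} {ε} u v with ℚ.∣p∣≡p∨∣p∣≡-p (p ℚ.- q)
  ... | inj₁ eq = subst₂ ℚ._≤_ (sym eq) (e q ε) (ℚ.+-monoˡ-≤ (ℚ.- q) u)
    where
    e : ∀ q ε → (q ℚ.+ ε) ℚ.- q ≡ ε
    e = solve 2 (λ q ε → (q :+ ε) :- q := ε) refl where open +-*-Solver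
  ... | inj₂ eq = subst₂ ℚ._≤_ (trans (e₁ p q) (sym eq)) (e₂ p ε) (ℚ.+-monoˡ-≤ (ℚ.- p) v)
    where
    e₁ : ∀ p q → q ℚ.- p ≡ ℚ.- (p ℚ.- q)
    e₁ = solve 2 (λ p q → q :- p := :- (p :- q)) refl where open +-*-Solver
    e₂ : ∀ p ε → (p ℚ.+ ε) ℚ.- p ≡ ε
    e₂ = solve 2 (λ p ε → (p :+ ε) :- p := ε) refl where open +-*-Solver

  abstract
    approx-cauchy : IsCauchy approx
    approx-cauchy ε ε>0 with small ε ε>0
    ... | N , p = N , λ m n N≤m N≤n → ∣-∣-≤ {approx m} {approx n}
      (ℚ.≤-trans (approx-≤ n m) (ℚ.+-monoʳ-≤ (approx n) (p n N≤n)))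
      (ℚ.≤-trans (approx-≤ m n) (ℚ.+-monoʳ-≤ (approx m) (p m N≤m)))

-- For r ≥ 1, log₂ r is the limit of ⌊log₂ rᵏ⌋ / k as k → ∞: since
-- 2^a ≤ rᵏ < 2^(1+a) for a = ⌊log₂ rᵏ⌋, each term is within 1/k of log₂ r.
log₂ : ℕ → ℝ ₋
log₂ zero      = ⊥₋
log₂ r@(suc _) = [ mkℝ (λ n → ℤ.+ ⌊log₂ (r ℕ.^ suc n) ⌋ ℚ./ suc n)
                       (Log.approx-cauchy r (s≤s z≤n)) ]

open import Relation.Binary.Construct.Add.Infimum.NonStrict _≤_ public
  using (_≤₋_)

------------------------------------------------------------------------
-- Univariate real polynomials

-- Coefficients, constant term first.
Polynomial : Set
Polynomial = List ℝ

⟦_⟧ : Polynomial → ℝ → ℝ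
⟦ p ⟧ x = foldr (λ c v → c + x * v) 0ℝ p

------------------------------------------------------------------------
-- Rank of a finite real matrix

open import Algebra.Properties.CommutativeMonoid.Sum
  (CommutativeRing.+-commutativeMonoid +-*-commutativeRing) public
  using (sum)

LinearlyIndependent : ∀ {I : Set} {k} → (Fin k → I → ℝ) → Set
LinearlyIndependent {k = k} v =
  ∀ (c : Fin k → ℝ) → (∀ i → sum (λ j → c j * v j i) ≈ 0ℝ) → ∀ j → c j ≈ 0ℝ

-- There are k linearly independent columns.  A repeated column makes a
-- family dependent, so injectivity of the selection is automatic.
IndependentColumns : ∀ {I J : Set} → (I → J → ℝ) → ℕ → Set
IndependentColumns {J = J} M k =
  Σ (Fin k → J) λ col → LinearlyIndependent (λ j i → M i (col j))

-- Linear independence over ℝ is not decidable by construction, so the rank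
-- is given as a (single-valued) relation.
HasRank : ∀ {I J : Set} → (I → J → ℝ) → ℕ → Set
HasRank M r = IndependentColumns M r × (∀ k → IndependentColumns M k → k ℕ.≤ r)

------------------------------------------------------------------------
-- Boolean functions

-- A point of {0,1}ⁿ is a Vec Bool n; since Subset n is also Vec Bool n, a
-- block B is its own characteristic vector e_B, and bitwise AND is _∩_.
Cube : ℕ → Set
Cube n = Vec Bool n

BooleanFunction : ℕ → Set
BooleanFunction n = Cube n → Bool

infixl 6 _⊕_
_⊕_ : ∀ {n} → Cube n → Cube n → Cube n
_⊕_ = zipWith _xor_

cube : ∀ n → List (Cube n)
cube zero    = [] ∷ []
cube (suc n) = map (false ∷_) (cube n) ++ map (true ∷_) (cube n)

sublists : ∀ {A : Set} → List A → List (List A)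
sublists []       = [] ∷ []
sublists (x ∷ xs) = sublists xs ++ map (x ∷_) (sublists xs)

module _ {n : ℕ} (f : BooleanFunction n) where

  Sensitive : Cube n → Subset n → Set
  Sensitive x B = ¬ f (x ⊕ B) ≡ f x

  sensitive? : ∀ x B → Dec (Sensitive x B)
  sensitive? x B = ¬? (f (x ⊕ B) Bool.≟ f x)

  s-at : Cube n → ℕ
  s-at x = length (filter (λ i → sensitive? x ⁅ i ⁆) (allFin n))

  s : ℕ
  s = max 0 (map s-at (cube n))

Disjoint : ∀ {n} → Subset n → Subset n → Set
Disjoint B C = Empty (B ∩ C)

disjoint? : ∀ {n} (B C : Subset n) → Dec (Disjoint B C)
disjoint? B C = ¬? (nonempty? (B ∩ C))

module _ {n : ℕ} (f : BooleanFunction n) where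

  -- All families of pairwise disjoint sensitive blocks of f on x.
  families : Cube n → List (List (Subset n))
  families x = filter (allPairs? disjoint?) (sublists (filter (sensitive? f x) (cube n)))

  bs-at : Cube n → ℕ
  bs-at x = max 0 (map length (families x))

  bs : ℕ
  bs = max 0 (map bs-at (cube n))

  andMatrix : Cube n → Cube n → ℝ
  andMatrix x y = if f (x ∩ y) then 1ℝ else 0ℝ

{-# OPTIONS --safe #-}

-- The rank of f (x ∧ y) is the number mon f of nonzero coefficients of the
-- multilinear polynomial of f: writing f = f₀ + x₁ ∂f, subtracting rows turns
-- the matrix of f into the block matrix ( M(f₀) M(f₀) ; 0 M(∂f) ).
--
-- (1) ⇒ (2): Every point has a certificate of size at most s(f) bs(f).
-- Querying 1-certificates until the 0-certificates are used up is a decision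
-- tree of depth (s(f) bs(f))², whence mon f ≤ 3 ^ (s(f) bs(f))².
--
-- (2) ⇒ (1): A shift of x does not change s(f).  If f has a monomial of
-- degree e, then some shift of f has at least (3/2)ᵉ monomials, by induction on
-- the variables; so (2) bounds the degree of f by O(q(s(f))).  The degree bounds
-- bs(f): for disjoint sensitive blocks B₁, …, Bₖ of f at 0, let 𝔼(p) be the
-- expectation of f at a random union of these blocks, each being taken with
-- probability p.  This polynomial has degree at most deg f, takes values in
-- [0,1] on [0,1], and has derivative ±k at 0.  With m = deg f, applying the
-- 2m-th finite difference to the even polynomial (𝔼(p) − 𝔼(0)) / p at
-- p = x² / m² gives k ≤ (2m + 1) m².

module Submission where

open import Defs
open import Data.Nat.Base as ℕ using (ℕ)
open import Data.Product.Base using (∃)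
open import Function.Bundles using (_⇔_)
open import Relation.Nullary.Construct.Add.Infimum using ([_])

open import Algebra.Bundles using (CommutativeMonoid; CommutativeRing)
import Algebra.Properties.CommutativeMonoid.Sum as Sum
import Algebra.Properties.Semiring.Sum as SemiringSum
open import Data.Bool.Base using (Bool; true; false; not; if_then_else_; _xor_; _∧_; _∨_)
import Data.Bool.Properties as Bool
open import Data.Fin.Base as Fin using (Fin; zero; suc; _↑ˡ_; _↑ʳ_; punchIn; splitAt; join)
import Data.Fin.Properties as Fin
open import Data.Fin.Subset using (Subset; _∈_; _⊆_; ∣_∣; ⁅_⁆; _∩_; _∪_; _─_; ⊥)
open import Data.Fin.Subset.Properties using (_∈?_; x∈p∩q⁺; x∈p∩q⁻; ∪-identityʳ)
import Data.Integer.Base as ℤ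
import Data.Integer.Properties as ℤ
open import Data.List.Base using (List; []; _∷_; map; filter; length; allFin; concatMap)
open import Data.List.Extrema.Nat using (max; xs≤max; argmax-sel; max≤v⁺)
import Data.List.Membership.DecPropositional as DecMembership
open import Data.List.Membership.Propositional using () renaming (_∈_ to _∈ₗ_)
open import Data.List.Membership.Propositional.Properties using (∈-map⁺; ∈-map⁻; ∈-++⁺ˡ; ∈-++⁺ʳ; ∈-++⁻; ∈-filter⁺; ∈-filter⁻; ∈-allFin; ∈-concatMap⁺)
open import Data.List.Properties using (length-++; filter-notAll)
open import Data.List.Relation.Unary.All as All using (All; []; _∷_)
open import Data.List.Relation.Unary.AllPairs using (AllPairs; []; _∷_; allPairs?)
open import Data.List.Relation.Unary.Any as Any using (Any; here; there)
open import Data.Nat.Base using (zero; suc; pred; z≤n; s≤s; _!; _∸_)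
import Data.Nat.Combinatorics as ℕ
open import Data.Nat.DivMod using (m/n*n≡m)
open import Data.Nat.Induction using (<-wellFounded)
open import Data.Nat.Logarithm using (⌊log₂_⌋; ⌊log₂⌋-mono-≤; ⌊log₂[2^n]⌋≡n)
import Data.Nat.Properties as ℕ
open import Data.Nat.Solver using () renaming (module +-*-Solver to ℕ-Solver)
open import Data.Product.Base using (Σ; _×_; _,_; proj₁; proj₂)
open import Data.Rational.Base as ℚ using (ℚ; 0ℚ; 1ℚ; ½; mkℚ; toℚᵘ)
import Data.Rational.Properties as ℚ
open import Data.Rational.Solver using () renaming (module +-*-Solver to ℚ-Solver)
import Data.Rational.Unnormalised.Base as ℚᵘ
import Data.Rational.Unnormalised.Properties as ℚᵘ
open import Data.Sum.Base using (_⊎_; inj₁; inj₂)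
open import Data.Unit.Base using (⊤; tt)
open import Data.Vec.Base as Vec using (Vec; []; _∷_; _[_]≔_; lookup; tabulate)
open import Data.Vec.Functional using (Vector; insertAt; _++_)
open import Data.Vec.Functional.Properties using (insertAt-lookup; insertAt-punchIn; lookup-++ˡ; lookup-++ʳ)
open import Data.Vec.Properties using (lookup∘update; lookup∘update′; lookup∘tabulate; []=⇒lookup; lookup-zipWith; zipWith-assoc; zipWith-comm; zipWith-identityˡ)
open import Function.Base using (_∘_; id)
open import Function.Bundles using (mk⇔)
open import Induction.WellFounded using (Acc; acc)
open import Level using (0ℓ)
open import Relation.Binary.Construct.Add.Infimum.NonStrict _≤_ using (⊥₋≤_; [_])
open import Relation.Binary.PropositionalEquality
import Relation.Binary.Reasoning.Setoid as ≈-Reasoning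
open import Relation.Nullary using (¬_; Dec; yes; no; ¬?; does; contradiction)
open import Relation.Nullary.Decidable using (decidable-stable; _×-dec_; _→-dec_)
open import Relation.Unary using (Pred; Decidable)

-- Multilinear polynomials on the cube

-- Equality of Cauchy reals is undecidable, so neither elimination nor a count of nonzero
-- coefficients can be carried out in `ℝ`. As `f` has values 0 and 1, both are done in `ℚ`; reals
-- enter only through the definition of rank, the logarithm and the two polynomials, and the latter
-- are traded for bounds c (k + 1)^e with natural c and e.
--
-- Few monomials do not mean low degree: x₁ ⋯ xₙ is a single monomial. Its shift by the all-ones
-- vector has 2ⁿ of them, and (2) bounds every shift equally well; hence the detour through shifts.
--
-- The step from degree to block sensitivity is an elementary substitute for Markov's inequality.
-- Control of 𝔼 exists only on [0,1], of which p = 0 is an endpoint; putting p = x² / m² moves it to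
-- the middle of the nodes -m, ..., m, where the binomial weight is largest, at least 4^m / (2m +
-- 1). Dividing by p costs at most m² at the other nodes, since p ≥ 1 / m² there. These two losses
-- make up the bound (2m + 1) m².

RationalFunction : ℕ → Set
RationalFunction n = Cube n → ℚ

∂ : ∀ {n} → RationalFunction (suc n) → RationalFunction n
∂ g x = g (true ∷ x) ℚ.- g (false ∷ x)

-- The number of nonzero coefficients of the multilinear polynomial of g: the
-- monomials without the first variable come from g (false ∷ _), those with it
-- from ∂ g.
monomials : ∀ {n} → RationalFunction n → ℕ
monomials {zero}  g = if does (g [] ℚ.≟ 0ℚ) then 0 else 1
monomials {suc n} g = monomials (g ∘ (false ∷_)) ℕ.+ monomials (∂ g)

monomials-cong : ∀ {n} {g h : RationalFunction n} → g ≗ h → monomials g ≡ monomials h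
monomials-cong {zero}  eq = cong (λ q → if does (q ℚ.≟ 0ℚ) then 0 else 1) (eq [])
monomials-cong {suc n} eq = cong₂ ℕ._+_
  (monomials-cong (λ x → eq (false ∷ x)))
  (monomials-cong (λ x → cong₂ ℚ._-_ (eq (true ∷ x)) (eq (false ∷ x))))

monomials-0 : ∀ {n} {g : RationalFunction n} → (∀ x → g x ≡ 0ℚ) → monomials g ≡ 0
monomials-0 {zero} {g} eq with g [] ℚ.≟ 0ℚ
... | yes _ = refl
... | no ≢0 = contradiction (eq []) ≢0
monomials-0 {suc n} eq = cong₂ ℕ._+_
  (monomials-0 (λ x → eq (false ∷ x)))
  (monomials-0 (λ x → cong₂ ℚ._-_ (eq (true ∷ x)) (eq (false ∷ x))))

monomials-const : ∀ {n} {g : RationalFunction n} c → (∀ x → g x ≡ c) → monomials g ℕ.≤ 1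
monomials-const {zero} {g} c eq with g [] ℚ.≟ 0ℚ
... | yes _ = z≤n
... | no  _ = ℕ.≤-refl
monomials-const {suc n} {g} c eq = subst (ℕ._≤ 1)
  (sym (trans (cong (monomials (g ∘ (false ∷_)) ℕ.+_) (monomials-0 (λ x →
    trans (cong₂ ℚ._-_ (eq (true ∷ x)) (eq (false ∷ x))) (ℚ.+-inverseʳ c))))
  (ℕ.+-identityʳ _)))
  (monomials-const c (λ x → eq (false ∷ x)))

monomials-+ : ∀ {n} (g h : RationalFunction n) →
              monomials (λ x → g x ℚ.+ h x) ℕ.≤ monomials g ℕ.+ monomials h
monomials-+ {zero} g h with g [] ℚ.≟ 0ℚ | h [] ℚ.≟ 0ℚ | (g [] ℚ.+ h []) ℚ.≟ 0ℚ
... | _      | _      | yes _ = z≤n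
... | no _   | _      | no _  = s≤s z≤n
... | yes _  | no _   | no _  = ℕ.≤-refl
... | yes g0 | yes h0 | no ≢0 = contradiction (cong₂ ℚ._+_ g0 h0) ≢0
monomials-+ {suc n} g h = begin
  monomials (λ x → g₀ x ℚ.+ h₀ x) ℕ.+ monomials (∂ (λ x → g x ℚ.+ h x))
    ≡⟨ cong (monomials (λ x → g₀ x ℚ.+ h₀ x) ℕ.+_)
         (monomials-cong (λ x → eq (g (true ∷ x)) (h (true ∷ x)) (g₀ x) (h₀ x))) ⟩
  monomials (λ x → g₀ x ℚ.+ h₀ x) ℕ.+ monomials (λ x → ∂ g x ℚ.+ ∂ h x)
    ≤⟨ ℕ.+-mono-≤ (monomials-+ g₀ h₀) (monomials-+ (∂ g) (∂ h)) ⟩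
  (monomials g₀ ℕ.+ monomials h₀) ℕ.+ (monomials (∂ g) ℕ.+ monomials (∂ h))
    ≡⟨ interchange (monomials g₀) (monomials h₀) (monomials (∂ g)) (monomials (∂ h)) ⟩
  (monomials g₀ ℕ.+ monomials (∂ g)) ℕ.+ (monomials h₀ ℕ.+ monomials (∂ h)) ∎
  where
  open ℕ.≤-Reasoning
  g₀ = g ∘ (false ∷_)
  h₀ = h ∘ (false ∷_)
  eq : ∀ a b c d → (a ℚ.+ b) ℚ.- (c ℚ.+ d) ≡ (a ℚ.- c) ℚ.+ (b ℚ.- d)
  eq = solve 4 (λ a b c d → (a :+ b) :- (c :+ d) := (a :- c) :+ (b :- d)) refl
    where open ℚ-Solver
  interchange : ∀ a b c d → (a ℕ.+ b) ℕ.+ (c ℕ.+ d) ≡ (a ℕ.+ c) ℕ.+ (b ℕ.+ d)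
  interchange = solve 4 (λ a b c d → (a :+ b) :+ (c :+ d) := (a :+ c) :+ (b :+ d)) refl
    where open ℕ-Solver

monomials-neg : ∀ {n} (g : RationalFunction n) → monomials (λ x → ℚ.- g x) ≡ monomials g
monomials-neg {zero} g with g [] ℚ.≟ 0ℚ | (ℚ.- g []) ℚ.≟ 0ℚ
... | yes _  | yes _  = refl
... | no _   | no _   = refl
... | yes g0 | no ≢0  = contradiction (cong ℚ.-_ g0) ≢0
... | no ≢0  | yes g0 = contradiction (ℚ.neg-injective g0) ≢0
monomials-neg {suc n} g = cong₂ ℕ._+_ (monomials-neg (g ∘ (false ∷_)))
  (trans (monomials-cong (λ x → sym (ℚ.neg-distrib-+ (g (true ∷ x)) (ℚ.- g (false ∷ x)))))
         (monomials-neg (∂ g)))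

monomials-∂ : ∀ {n} (g : RationalFunction (suc n)) →
  monomials (∂ g) ℕ.≤ monomials (g ∘ (true ∷_)) ℕ.+ monomials (g ∘ (false ∷_))
monomials-∂ g = ℕ.≤-trans (monomials-+ (g ∘ (true ∷_)) (λ x → ℚ.- g (false ∷ x)))
  (ℕ.≤-reflexive (cong (monomials (g ∘ (true ∷_)) ℕ.+_) (monomials-neg (g ∘ (false ∷_)))))

-- From g = g₀ + xᵢ (g₁ − g₀), where g_b is the restriction of g to xᵢ = b.
monomials-restrict : ∀ {n} (g : RationalFunction n) i →
  monomials g ℕ.≤ 2 ℕ.* monomials (λ x → g (x [ i ]≔ false))
                  ℕ.+ monomials (λ x → g (x [ i ]≔ true))
monomials-restrict {suc n} g zero = begin
  m₀ ℕ.+ monomials (∂ g) ≤⟨ ℕ.+-monoʳ-≤ m₀ (monomials-∂ g) ⟩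
  m₀ ℕ.+ (m₁ ℕ.+ m₀)     ≡⟨ eq m₀ m₁ ⟩
  2 ℕ.* m₀ ℕ.+ m₁        ≤⟨ ℕ.+-mono-≤ (ℕ.*-monoʳ-≤ 2 (ℕ.m≤m+n m₀ _)) (ℕ.m≤m+n m₁ _) ⟩
  2 ℕ.* monomials (λ x → g (x [ zero ]≔ false)) ℕ.+ monomials (λ x → g (x [ zero ]≔ true)) ∎
  where
  open ℕ.≤-Reasoning
  m₀ = monomials (g ∘ (false ∷_))
  m₁ = monomials (g ∘ (true ∷_))
  eq : ∀ a b → a ℕ.+ (b ℕ.+ a) ≡ 2 ℕ.* a ℕ.+ b
  eq = solve 2 (λ a b → a :+ (b :+ a) := con 2 :* a :+ b) refl
    where open ℕ-Solver
monomials-restrict {suc n} g (suc i) = ℕ.≤-trans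
  (ℕ.+-mono-≤ (monomials-restrict (g ∘ (false ∷_)) i) (monomials-restrict (∂ g) i))
  (ℕ.≤-reflexive (eq (monomials (λ x → g (false ∷ (x [ i ]≔ false)))) _ (monomials (λ x → ∂ g (x [ i ]≔ false))) _))
  where
  eq : ∀ a b c d → (2 ℕ.* a ℕ.+ b) ℕ.+ (2 ℕ.* c ℕ.+ d) ≡ 2 ℕ.* (a ℕ.+ c) ℕ.+ (b ℕ.+ d)
  eq = solve 4 (λ a b c d → (con 2 :* a :+ b) :+ (con 2 :* c :+ d) := con 2 :* (a :+ c) :+ (b :+ d)) refl
    where open ℕ-Solver

-- The bound is strict, so that 0 admits just the zero function; `pred` is right even there, as
-- `∂ g` then vanishes too.
DegreeBelow : ∀ {n} → ℕ → RationalFunction n → Set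
DegreeBelow {zero}  zero    g = g [] ≡ 0ℚ
DegreeBelow {zero}  (suc e) g = ⊤
DegreeBelow {suc n} e       g = DegreeBelow e (g ∘ (false ∷_)) × DegreeBelow (pred e) (∂ g)

_shifted_ : ∀ {n} {A : Set} → (Cube n → A) → Cube n → (Cube n → A)
(g shifted z) x = g (x ⊕ z)

-- Shifting the first variable replaces the pair (g₀, ∂ g) by (g₁, − ∂ g). Since
-- ∂ g = g₁ − g₀ has at most as many monomials as g₀ and g₁ together, one of the
-- two choices gives at least half of these in addition to those of ∂ g.
shift-first : ∀ {n} (g : RationalFunction (suc n)) z → ∃ λ b →
  3 ℕ.* monomials (∂ g shifted z) ℕ.≤ 2 ℕ.* monomials (g shifted (b ∷ z))
shift-first {n} g z = choose (ℕ.≤-total m₁ m₀)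
  where
  m  = monomials (∂ g shifted z)
  m₀ = monomials ((g ∘ (false ∷_)) shifted z)
  m₁ = monomials ((g ∘ (true ∷_)) shifted z)
  m≤m₁+m₀ : m ℕ.≤ m₁ ℕ.+ m₀
  m≤m₁+m₀ = monomials-∂ (g shifted (false ∷ z))
  3m≤2[k+m] : ∀ k → m ℕ.≤ k ℕ.+ k → 3 ℕ.* m ℕ.≤ 2 ℕ.* (k ℕ.+ m)
  3m≤2[k+m] k m≤2k = begin
    3 ℕ.* m                    ≡⟨ e₁ m ⟩
    m ℕ.+ (m ℕ.+ m)            ≤⟨ ℕ.+-monoˡ-≤ (m ℕ.+ m) m≤2k ⟩
    (k ℕ.+ k) ℕ.+ (m ℕ.+ m)    ≡⟨ e₂ k m ⟩
    2 ℕ.* (k ℕ.+ m)            ∎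
    where
    open ℕ.≤-Reasoning
    open ℕ-Solver
    e₁ : ∀ m → 3 ℕ.* m ≡ m ℕ.+ (m ℕ.+ m)
    e₁ = solve 1 (λ m → con 3 :* m := m :+ (m :+ m)) refl
    e₂ : ∀ k m → (k ℕ.+ k) ℕ.+ (m ℕ.+ m) ≡ 2 ℕ.* (k ℕ.+ m)
    e₂ = solve 2 (λ k m → (k :+ k) :+ (m :+ m) := con 2 :* (k :+ m)) refl
  -∂ : ∀ a b → a ℚ.- b ≡ ℚ.- (b ℚ.- a)
  -∂ = solve 2 (λ a b → a :- b := :- (b :- a)) refl
    where open ℚ-Solver
  choose : m₁ ℕ.≤ m₀ ⊎ m₀ ℕ.≤ m₁ → ∃ λ b → 3 ℕ.* m ℕ.≤ 2 ℕ.* monomials (g shifted (b ∷ z))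
  choose (inj₁ m₁≤m₀) = false , 3m≤2[k+m] m₀ (ℕ.≤-trans m≤m₁+m₀ (ℕ.+-monoˡ-≤ m₀ m₁≤m₀))
  choose (inj₂ m₀≤m₁) = true , subst (λ k → 3 ℕ.* m ℕ.≤ 2 ℕ.* (m₁ ℕ.+ k))
    (sym (trans (monomials-cong (λ x → -∂ (g (false ∷ (x ⊕ z))) (g (true ∷ (x ⊕ z)))))
      (monomials-neg (∂ g shifted z))))
    (3m≤2[k+m] m₁ (ℕ.≤-trans m≤m₁+m₀ (ℕ.+-monoʳ-≤ m₁ m₀≤m₁)))

-- If the restriction to x₁ = 0 has a monomial of degree at least e, a shift leaving x₁ alone keeps
-- its many monomials. Otherwise the monomial contains x₁ and leaves one of degree at least e - 1 in
-- `∂ g`; `shift-first` supplies the missing factor 3/2. The power of 2 clears the denominator of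
-- (3/2)^e.
low-degree-or-many-monomials : ∀ {n} e (g : RationalFunction n) →
  DegreeBelow e g ⊎ ∃ λ z → 3 ℕ.^ e ℕ.≤ 2 ℕ.^ e ℕ.* monomials (g shifted z)
low-degree-or-many-monomials {zero} (suc e) g = inj₁ tt
low-degree-or-many-monomials {zero} zero g with g [] ℚ.≟ 0ℚ in eq
... | yes g0 = inj₁ g0
... | no  ≢0 = inj₂ ([] , ℕ.≤-reflexive (cong (λ d → 1 ℕ.* (if does d then 0 else 1)) (sym eq)))
low-degree-or-many-monomials {suc n} e g
  with low-degree-or-many-monomials e (g ∘ (false ∷_)) | low-degree-or-many-monomials (pred e) (∂ g)
... | inj₁ d | inj₁ d′ = inj₁ (d , d′)
... | inj₂ (z , le) | _ = inj₂ (false ∷ z , ℕ.≤-trans le (ℕ.*-monoʳ-≤ (2 ℕ.^ e) (ℕ.m≤m+n _ _)))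
... | inj₁ _ | inj₂ (z , le) = let b , le′ = shift-first g z in inj₂ (b ∷ z , combine e le le′)
  where
  combine : ∀ e {k l} → 3 ℕ.^ pred e ℕ.≤ 2 ℕ.^ pred e ℕ.* k → 3 ℕ.* k ℕ.≤ 2 ℕ.* l →
            3 ℕ.^ e ℕ.≤ 2 ℕ.^ e ℕ.* l
  -- At e = 0 `pred` stays at 0, and only the positivity of the count is passed on.
  combine zero {zero} ()
  combine zero {suc k} {suc l} _ _ = s≤s z≤n
  combine zero {suc k} {zero} _ ()
  combine (suc e) {k} {l} p q = begin
    3 ℕ.* 3 ℕ.^ e            ≤⟨ ℕ.*-monoʳ-≤ 3 p ⟩
    3 ℕ.* (2 ℕ.^ e ℕ.* k)    ≡⟨ eq 3 (2 ℕ.^ e) k ⟩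
    2 ℕ.^ e ℕ.* (3 ℕ.* k)    ≤⟨ ℕ.*-monoʳ-≤ (2 ℕ.^ e) q ⟩
    2 ℕ.^ e ℕ.* (2 ℕ.* l)    ≡⟨ eq′ (2 ℕ.^ e) l ⟩
    2 ℕ.* 2 ℕ.^ e ℕ.* l      ∎
    where
    open ℕ.≤-Reasoning
    open ℕ-Solver
    eq : ∀ a b c → a ℕ.* (b ℕ.* c) ≡ b ℕ.* (a ℕ.* c)
    eq = solve 3 (λ a b c → a :* (b :* c) := b :* (a :* c)) refl
    eq′ : ∀ b c → b ℕ.* (2 ℕ.* c) ≡ 2 ℕ.* b ℕ.* c
    eq′ = solve 2 (λ b c → b :* (con 2 :* c) := con 2 :* b :* c) refl

-- The rank of g (x ∧ y)

module R = CommutativeRing +-*-commutativeRing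
module ℝΣ = Sum R.+-commutativeMonoid
module ℚΣ = SemiringSum (CommutativeRing.semiring ℚ.+-*-commutativeRing)

module _ (M : CommutativeMonoid 0ℓ 0ℓ) where
  private
    module M = CommutativeMonoid M
    module MΣ = Sum M

  sum-splitAt : ∀ m {k} (t : Vector M.Carrier (m ℕ.+ k)) →
    MΣ.sum t M.≈ MΣ.sum (λ i → t (i ↑ˡ k)) M.∙ MΣ.sum (λ j → t (m ↑ʳ j))
  sum-splitAt zero    t = M.sym (M.identityˡ _)
  sum-splitAt (suc m) t = M.trans (M.∙-congˡ (sum-splitAt m (t ∘ suc))) (M.sym (M.assoc _ _ _))

*-≢0 : ∀ {p q} → p ≢ 0ℚ → q ≢ 0ℚ → p ℚ.* q ≢ 0ℚ
*-≢0 {p} {q} p≢0 q≢0 pq≡0 = q≢0 (begin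
  q                       ≡⟨ ℚ.*-identityˡ q ⟨
  1ℚ ℚ.* q                ≡⟨ cong (ℚ._* q) (ℚ.*-inverseˡ p) ⟨
  (ℚ.1/ p) ℚ.* p ℚ.* q    ≡⟨ ℚ.*-assoc (ℚ.1/ p) p q ⟩
  (ℚ.1/ p) ℚ.* (p ℚ.* q)  ≡⟨ cong ((ℚ.1/ p) ℚ.*_) pq≡0 ⟩
  (ℚ.1/ p) ℚ.* 0ℚ         ≡⟨ ℚ.*-zeroʳ (ℚ.1/ p) ⟩
  0ℚ                      ∎)
  where
  open ≡-Reasoning
  instance
    p≠0 : ℚ.NonZero p
    p≠0 = ℚ.≢-nonZero p≢0

-- Gaussian elimination: a zero first row is dropped, and otherwise the column of a nonzero entry is
-- eliminated. Cross-multiplication with the pivot avoids division.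
nontrivial-solution : ∀ {m n} (A : Fin m → Fin n → ℚ) → m ℕ.< n →
  ∃ λ (c : Fin n → ℚ) → (∃ λ j → c j ≢ 0ℚ) × (∀ i → ℚΣ.sum (λ j → c j ℚ.* A i j) ≡ 0ℚ)
nontrivial-solution {zero}  {suc n} A _ = (λ _ → 1ℚ) , (zero , λ ()) , λ ()
nontrivial-solution {suc m} {suc n} A (s≤s m<n) with Fin.any? (λ j → ¬? (A zero j ℚ.≟ 0ℚ))
... | no all0 =
  let c , c≢0 , sol = nontrivial-solution (A ∘ suc) (ℕ.m<n⇒m<1+n m<n)
  in c , c≢0 , λ
    { zero → trans (ℚΣ.sum-cong-≗ (λ j → trans
        (cong (c j ℚ.*_) (decidable-stable (A zero j ℚ.≟ 0ℚ) (λ ≢0 → all0 (j , ≢0))))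
        (ℚ.*-zeroʳ (c j)))) (ℚΣ.sum-replicate-zero (suc n))
    ; (suc i) → sol i }
... | yes (j₀ , a≢0) =
  let c′ , (j , c′j≢0) , sol = nontrivial-solution A′ m<n
      -- With the other entries scaled by the pivot `a`, the first equation dictates the entry at
      -- `j₀`.
      c = insertAt (λ j → a ℚ.* c′ j) j₀ (ℚ.- ℚΣ.sum (λ j → c′ j ℚ.* row₀ j))
  in c
   , (punchIn j₀ j , λ cj≡0 → *-≢0 a≢0 c′j≢0 (trans (sym (insertAt-punchIn _ j₀ _ j)) cj≡0))
   , λ { zero → trans (expand c′ zero) (row₀-sol c′)
       ; (suc i) → trans (expand c′ (suc i)) (row-sol c′ i (sol i)) }
  where
  a : ℚ
  a = A zero j₀
  row₀ : Fin n → ℚ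
  row₀ j = A zero (punchIn j₀ j)
  A′ : Fin m → Fin n → ℚ
  A′ i j = a ℚ.* A (suc i) (punchIn j₀ j) ℚ.- A (suc i) j₀ ℚ.* row₀ j
  module _ (c′ : Fin n → ℚ) where
    S : ℚ
    S = ℚΣ.sum (λ j → c′ j ℚ.* row₀ j)
    c : Fin (suc n) → ℚ
    c = insertAt (λ j → a ℚ.* c′ j) j₀ (ℚ.- S)
    expand : ∀ i → ℚΣ.sum (λ j → c j ℚ.* A i j) ≡
      (ℚ.- S) ℚ.* A i j₀ ℚ.+ ℚΣ.sum (λ j → a ℚ.* c′ j ℚ.* A i (punchIn j₀ j))
    expand i = trans (ℚΣ.sum-remove {i = j₀} (λ j → c j ℚ.* A i j)) (cong₂ ℚ._+_
      (cong (ℚ._* A i j₀) (insertAt-lookup _ j₀ _))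
      (ℚΣ.sum-cong-≗ (λ j → cong (ℚ._* A i (punchIn j₀ j)) (insertAt-punchIn _ j₀ _ j))))
    row₀-sol : (ℚ.- S) ℚ.* a ℚ.+ ℚΣ.sum (λ j → a ℚ.* c′ j ℚ.* row₀ j) ≡ 0ℚ
    row₀-sol = trans (cong ((ℚ.- S) ℚ.* a ℚ.+_) (trans
        (ℚΣ.sum-cong-≗ (λ j → ℚ.*-assoc a (c′ j) (row₀ j)))
        (sym (ℚΣ.*-distribˡ-sum a (λ j → c′ j ℚ.* row₀ j)))))
      (eq S a)
      where
      eq : ∀ s a → (ℚ.- s) ℚ.* a ℚ.+ a ℚ.* s ≡ 0ℚ
      eq = solve 2 (λ s a → (:- s) :* a :+ a :* s := con 0ℚ) refl
        where open ℚ-Solver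
    row-sol : ∀ i → ℚΣ.sum (λ j → c′ j ℚ.* A′ i j) ≡ 0ℚ →
      (ℚ.- S) ℚ.* A (suc i) j₀ ℚ.+ ℚΣ.sum (λ j → a ℚ.* c′ j ℚ.* A (suc i) (punchIn j₀ j)) ≡ 0ℚ
    row-sol i sol = begin
      (ℚ.- S) ℚ.* b ℚ.+ ℚΣ.sum (λ j → a ℚ.* c′ j ℚ.* B j)
        ≡⟨ cong ((ℚ.- S) ℚ.* b ℚ.+_) (ℚΣ.sum-cong-≗ (λ j → eq₁ a (c′ j) (B j) b (row₀ j))) ⟩
      (ℚ.- S) ℚ.* b ℚ.+ ℚΣ.sum (λ j → c′ j ℚ.* A′ i j ℚ.+ b ℚ.* (c′ j ℚ.* row₀ j))
        ≡⟨ cong ((ℚ.- S) ℚ.* b ℚ.+_) (ℚΣ.∑-distrib-+ (λ j → c′ j ℚ.* A′ i j) (λ j → b ℚ.* (c′ j ℚ.* row₀ j))) ⟩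
      (ℚ.- S) ℚ.* b ℚ.+ (ℚΣ.sum (λ j → c′ j ℚ.* A′ i j) ℚ.+ ℚΣ.sum (λ j → b ℚ.* (c′ j ℚ.* row₀ j)))
        ≡⟨ cong ((ℚ.- S) ℚ.* b ℚ.+_) (cong₂ ℚ._+_ sol (sym (ℚΣ.*-distribˡ-sum b (λ j → c′ j ℚ.* row₀ j)))) ⟩
      (ℚ.- S) ℚ.* b ℚ.+ (0ℚ ℚ.+ b ℚ.* S)
        ≡⟨ eq₂ S b ⟩
      0ℚ ∎
      where
      open ≡-Reasoning
      open ℚ-Solver
      b : ℚ
      b = A (suc i) j₀
      B : Fin n → ℚ
      B j = A (suc i) (punchIn j₀ j)
      eq₁ : ∀ a c B b r → a ℚ.* c ℚ.* B ≡ c ℚ.* (a ℚ.* B ℚ.- b ℚ.* r) ℚ.+ b ℚ.* (c ℚ.* r)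
      eq₁ = solve 5 (λ a c B b r → a :* c :* B := c :* (a :* B :- b :* r) :+ b :* (c :* r)) refl
      eq₂ : ∀ s b → (ℚ.- s) ℚ.* b ℚ.+ (0ℚ ℚ.+ b ℚ.* s) ≡ 0ℚ
      eq₂ = solve 2 (λ s b → (:- s) :* b :+ (con 0ℚ :+ b :* s) := con 0ℚ) refl

-- With g = g₀ + x₁ ∂ g one has g (x ∧ y) = g₀ (x′ ∧ y′) + x₁ y₁ ∂ g (x′ ∧ y′).
factor : ∀ {n} (g : RationalFunction n) →
  Σ (Cube n → Fin (monomials g) → ℚ) λ U → Σ (Cube n → Fin (monomials g) → ℚ) λ V →
  ∀ x y → g (x ∩ y) ≡ ℚΣ.sum (λ k → V y k ℚ.* U x k)
factor {zero} g with g [] ℚ.≟ 0ℚ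
... | yes g0 = (λ _ ()) , (λ _ ()) , λ { [] [] → g0 }
... | no  _  = (λ _ _ → g []) , (λ _ _ → 1ℚ) , λ { [] [] →
  sym (trans (ℚ.+-identityʳ (1ℚ ℚ.* g [])) (ℚ.*-identityˡ (g []))) }
factor {suc n} g =
  let U₀ , V₀ , eq₀ = factor (g ∘ (false ∷_))
      U₁ , V₁ , eq₁ = factor (∂ g)
      U = λ { (b ∷ x) → U₀ x ++ (λ k → ι b ℚ.* U₁ x k) }
      V = λ { (b ∷ y) → V₀ y ++ (λ k → ι b ℚ.* V₁ y k) }
  in U , V , λ { (a ∷ x) (b ∷ y) → sym (begin
    ℚΣ.sum (λ k → V (b ∷ y) k ℚ.* U (a ∷ x) k)
      ≡⟨ sum-splitAt ℚ.+-0-commutativeMonoid m₀ _ ⟩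
    ℚΣ.sum (λ k → V (b ∷ y) (k ↑ˡ m₁) ℚ.* U (a ∷ x) (k ↑ˡ m₁)) ℚ.+
    ℚΣ.sum (λ k → V (b ∷ y) (m₀ ↑ʳ k) ℚ.* U (a ∷ x) (m₀ ↑ʳ k))
      ≡⟨ cong₂ ℚ._+_
           (ℚΣ.sum-cong-≗ (λ k → cong₂ ℚ._*_ (lookup-++ˡ (V₀ y) _ k) (lookup-++ˡ (U₀ x) _ k)))
           (ℚΣ.sum-cong-≗ (λ k → trans
             (cong₂ ℚ._*_ (lookup-++ʳ (V₀ y) _ k) (lookup-++ʳ (U₀ x) _ k))
             (regroup (ι b) (V₁ y k) (ι a) (U₁ x k)))) ⟩
    ℚΣ.sum (λ k → V₀ y k ℚ.* U₀ x k) ℚ.+ ℚΣ.sum (λ k → ι a ℚ.* ι b ℚ.* (V₁ y k ℚ.* U₁ x k))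
      ≡⟨ cong₂ ℚ._+_ (sym (eq₀ x y)) (trans
           (sym (ℚΣ.*-distribˡ-sum (ι a ℚ.* ι b) (λ k → V₁ y k ℚ.* U₁ x k)))
           (cong (ι a ℚ.* ι b ℚ.*_) (sym (eq₁ x y)))) ⟩
    g (false ∷ (x ∩ y)) ℚ.+ ι a ℚ.* ι b ℚ.* ∂ g (x ∩ y)
      ≡⟨ combine a b (x ∩ y) ⟩
    g ((a ∷ x) ∩ (b ∷ y)) ∎) }
  where
  open ≡-Reasoning
  m₀ = monomials (g ∘ (false ∷_))
  m₁ = monomials (∂ g)
  ι : Bool → ℚ
  ι b = if b then 1ℚ else 0ℚ
  regroup : ∀ a b c d → a ℚ.* b ℚ.* (c ℚ.* d) ≡ c ℚ.* a ℚ.* (b ℚ.* d)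
  regroup = solve 4 (λ a b c d → a :* b :* (c :* d) := c :* a :* (b :* d)) refl
    where open ℚ-Solver
  0-term : ∀ p q → p ℚ.+ 0ℚ ℚ.* q ≡ p
  0-term = solve 2 (λ p q → p :+ con 0ℚ :* q := p) refl
    where open ℚ-Solver
  1-term : ∀ p q → p ℚ.+ 1ℚ ℚ.* (q ℚ.- p) ≡ q
  1-term = solve 2 (λ p q → p :+ con 1ℚ :* (q :- p) := q) refl
    where open ℚ-Solver
  combine : ∀ a b z → g (false ∷ z) ℚ.+ ι a ℚ.* ι b ℚ.* ∂ g z ≡ g (a ∧ b ∷ z)
  combine false false z = 0-term (g (false ∷ z)) (∂ g z)
  combine false true  z = 0-term (g (false ∷ z)) (∂ g z)
  combine true  false z = 0-term (g (false ∷ z)) (∂ g z)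
  combine true  true  z = 1-term (g (false ∷ z)) (g (true ∷ z))

-- For q ≠ 0 the choice ε = ½ |q| would give |q| ≤ ½ |q|.
fromℚ-injective-0 : ∀ {q} → fromℚ q ≈ 0ℝ → q ≡ 0ℚ
fromℚ-injective-0 {q} q≈0 = decidable-stable (q ℚ.≟ 0ℚ) λ q≢0 →
  let ∣q∣>0 = ℚ.≰⇒> (λ ∣q∣≤0 → q≢0 (ℚ.∣p∣≡0⇒p≡0 q (ℚ.≤-antisym ∣q∣≤0 (ℚ.0≤∣p∣ q))))
      N , le = run≈ q≈0 (½ ℚ.* ℚ.∣ q ∣) (half-pos ∣q∣>0)
      ½∣q∣<∣q∣ = subst (½ ℚ.* ℚ.∣ q ∣ ℚ.<_) (half ℚ.∣ q ∣)
        (subst (ℚ._< ½ ℚ.* ℚ.∣ q ∣ ℚ.+ ½ ℚ.* ℚ.∣ q ∣) (ℚ.+-identityʳ _)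
          (ℚ.+-monoʳ-< (½ ℚ.* ℚ.∣ q ∣) (half-pos ∣q∣>0)))
  in ℚ.<-irrefl refl (ℚ.<-≤-trans ½∣q∣<∣q∣ (subst (ℚ._≤ ½ ℚ.* ℚ.∣ q ∣) (cong ℚ.∣_∣ (ℚ.+-identityʳ q)) (le N ℕ.≤-refl)))

sum-fromℚ : ∀ {n} (t : Fin n → ℚ) → sum (λ j → fromℚ (t j)) ≈ fromℚ (ℚΣ.sum t)
sum-fromℚ {zero}  t = R.refl
sum-fromℚ {suc n} t = R.trans (R.+-congˡ (sum-fromℚ (t ∘ suc))) (pointwise⇒≈ λ _ → refl)

meet-matrix : ∀ {n} → RationalFunction n → Cube n → Cube n → ℝ
meet-matrix g x y = fromℚ (g (x ∩ y))

-- `factor` expresses all columns through `monomials g` vectors. The coefficient vectors of more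
-- columns than that are dependent over `ℚ`, and the dependence carries over to the columns.
independent-columns-≤ : ∀ {n} (g : RationalFunction n) k →
  IndependentColumns (meet-matrix g) k → k ℕ.≤ monomials g
independent-columns-≤ g k (col , indep) = ℕ.≮⇒≥ λ m<k →
  let U , V , g≡ = factor g
      c , (j , cj≢0) , sol = nontrivial-solution (λ i j → V (col j) i) m<k
  in cj≢0 (fromℚ-injective-0 (indep (fromℚ ∘ c)
       (λ x → R.trans (R.trans (ℝΣ.sum-cong-≋ (λ j → *-fromℚ (c j) (g (x ∩ col j))))
                               (sum-fromℚ (λ j → c j ℚ.* g (x ∩ col j))))
                      (R.reflexive (cong fromℚ (dependent U V g≡ c sol x)))) j))
  where
  *-fromℚ : ∀ p q → fromℚ p * fromℚ q ≈ fromℚ (p ℚ.* q)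
  *-fromℚ p q = pointwise⇒≈ λ _ → refl
  dependent : ∀ (U V : Cube _ → Fin (monomials g) → ℚ) → (∀ x y → g (x ∩ y) ≡ ℚΣ.sum (λ i → V y i ℚ.* U x i)) →
    ∀ (c : Fin k → ℚ) → (∀ i → ℚΣ.sum (λ j → c j ℚ.* V (col j) i) ≡ 0ℚ) →
    ∀ x → ℚΣ.sum (λ j → c j ℚ.* g (x ∩ col j)) ≡ 0ℚ
  dependent U V g≡ c sol x = begin
    ℚΣ.sum (λ j → c j ℚ.* g (x ∩ col j))
      ≡⟨ ℚΣ.sum-cong-≗ (λ j → trans (cong (c j ℚ.*_) (g≡ x (col j))) (ℚΣ.*-distribˡ-sum (c j) (λ i → V (col j) i ℚ.* U x i))) ⟩
    ℚΣ.sum (λ j → ℚΣ.sum (λ i → c j ℚ.* (V (col j) i ℚ.* U x i)))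
      ≡⟨ ℚΣ.∑-comm (λ j i → c j ℚ.* (V (col j) i ℚ.* U x i)) ⟩
    ℚΣ.sum (λ i → ℚΣ.sum (λ j → c j ℚ.* (V (col j) i ℚ.* U x i)))
      ≡⟨ ℚΣ.sum-cong-≗ (λ i → trans
           (ℚΣ.sum-cong-≗ (λ j → sym (ℚ.*-assoc (c j) (V (col j) i) (U x i))))
           (trans (sym (ℚΣ.*-distribʳ-sum (U x i) (λ j → c j ℚ.* V (col j) i)))
             (trans (cong (ℚ._* U x i) (sol i)) (ℚ.*-zeroˡ (U x i))))) ⟩
    ℚΣ.sum (λ (_ : Fin (monomials g)) → 0ℚ)
      ≡⟨ ℚΣ.sum-replicate-zero (monomials g) ⟩
    0ℚ ∎
    where open ≡-Reasoning

*-cancelʳ-0 : ∀ {c q} → q ≢ 0ℚ → c * fromℚ q ≈ 0ℝ → c ≈ 0ℝ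
*-cancelʳ-0 {c} {q} q≢0 cq≈0 = begin
  c                                ≈⟨ R.*-identityʳ c ⟨
  c * 1ℝ                           ≈⟨ R.*-congˡ {c} (R.reflexive (cong fromℚ (ℚ.*-inverseʳ q))) ⟨
  c * fromℚ (q ℚ.* (ℚ.1/ q))       ≈⟨ pointwise⇒≈ (λ n → sym (ℚ.*-assoc (seq c n) q (ℚ.1/ q))) ⟩
  c * fromℚ q * fromℚ (ℚ.1/ q)     ≈⟨ R.*-congʳ {fromℚ (ℚ.1/ q)} cq≈0 ⟩
  0ℝ * fromℚ (ℚ.1/ q)              ≈⟨ R.zeroˡ _ ⟩
  0ℝ                               ∎
  where
  open ≈-Reasoning R.setoid
  instance
    q≠0 : ℚ.NonZero q
    q≠0 = ℚ.≢-nonZero q≢0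

-- The columns of the two halves receive first bit 0 and 1. Rows (0, x) and (1, x) agree on the
-- first kind, so their difference is a relation among columns of `∂ g` alone. Once its coefficients
-- vanish, row (0, x) is a relation for the restriction to x₁ = 0.
independent-columns : ∀ {n} (g : RationalFunction n) →
  IndependentColumns (meet-matrix g) (monomials g)
independent-columns {zero} g with g [] ℚ.≟ 0ℚ
... | yes _  = (λ ()) , λ _ _ ()
... | no  ≢0 = (λ _ → []) , λ { c c≈0 zero → *-cancelʳ-0 ≢0 (R.trans (R.sym (R.+-identityʳ _)) (c≈0 [])) }
independent-columns {suc n} g
  with independent-columns (g ∘ (false ∷_)) | independent-columns (∂ g)
... | col₀ , indep₀ | col₁ , indep₁ = col , indep
  where
  m₀ = monomials (g ∘ (false ∷_))
  m₁ = monomials (∂ g)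
  col : Fin (m₀ ℕ.+ m₁) → Cube (suc n)
  col = ((false ∷_) ∘ col₀) ++ ((true ∷_) ∘ col₁)
  indep : LinearlyIndependent (λ j x → meet-matrix g x (col j))
  indep c c≈0 j = subst (λ j → c j ≈ 0ℝ) (Fin.join-splitAt m₀ m₁ j) (split (splitAt m₀ j))
    where
    open ≈-Reasoning R.setoid
    S : Cube n → ℝ
    S x = sum (λ j → c (j ↑ˡ m₁) * fromℚ (g (false ∷ (x ∩ col₀ j))))
    T : Bool → Cube n → ℝ
    T a x = sum (λ j → c (m₀ ↑ʳ j) * fromℚ (g (a ∷ (x ∩ col₁ j))))
    D : Cube n → ℝ
    D x = sum (λ j → c (m₀ ↑ʳ j) * fromℚ (∂ g (x ∩ col₁ j)))
    rows : ∀ a x → S x + T a x ≈ 0ℝ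
    rows a x = begin
      S x + T a x
        ≈⟨ R.+-cong
             (ℝΣ.sum-cong-≋ (λ j → R.reflexive (cong (λ y → c (j ↑ˡ m₁) * fromℚ (g y))
               (trans (cong (_∷ (x ∩ col₀ j)) (sym (Bool.∧-zeroʳ a)))
                      (cong ((a ∷ x) ∩_) (sym (lookup-++ˡ ((false ∷_) ∘ col₀) _ j)))))))
             (ℝΣ.sum-cong-≋ (λ j → R.reflexive (cong (λ y → c (m₀ ↑ʳ j) * fromℚ (g y))
               (trans (cong (_∷ (x ∩ col₁ j)) (sym (Bool.∧-identityʳ a)))
                      (cong ((a ∷ x) ∩_) (sym (lookup-++ʳ ((false ∷_) ∘ col₀) _ j))))))) ⟩
      sum (λ j → c (j ↑ˡ m₁) * meet-matrix g (a ∷ x) (col (j ↑ˡ m₁))) +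
      sum (λ j → c (m₀ ↑ʳ j) * meet-matrix g (a ∷ x) (col (m₀ ↑ʳ j)))
        ≈⟨ sum-splitAt R.+-commutativeMonoid m₀ (λ j → c j * meet-matrix g (a ∷ x) (col j)) ⟨
      sum (λ j → c j * meet-matrix g (a ∷ x) (col j))
        ≈⟨ c≈0 (a ∷ x) ⟩
      0ℝ ∎
    D+T : ∀ x → D x + T false x ≈ T true x
    D+T x = R.trans (R.sym (ℝΣ.∑-distrib-+
        (λ j → c (m₀ ↑ʳ j) * fromℚ (∂ g (x ∩ col₁ j)))
        (λ j → c (m₀ ↑ʳ j) * fromℚ (g (false ∷ (x ∩ col₁ j))))))
      (ℝΣ.sum-cong-≋ (λ j → pointwise⇒≈ (λ n → eq (seq (c (m₀ ↑ʳ j)) n) _ (g (false ∷ (x ∩ col₁ j))))))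
      where
      eq : ∀ c a b → c ℚ.* (a ℚ.- b) ℚ.+ c ℚ.* b ≡ c ℚ.* a
      eq = solve 3 (λ c a b → c :* (a :- b) :+ c :* b := c :* a) refl
        where open ℚ-Solver
    D≈0 : ∀ x → D x ≈ 0ℝ
    D≈0 x = begin
      D x                        ≈⟨ R.+-identityʳ _ ⟨
      D x + 0ℝ                   ≈⟨ R.+-congˡ (rows false x) ⟨
      D x + (S x + T false x)    ≈⟨ R.+-congˡ (R.+-comm _ _) ⟩
      D x + (T false x + S x)    ≈⟨ R.+-assoc _ _ _ ⟨
      D x + T false x + S x      ≈⟨ R.+-congʳ (D+T x) ⟩
      T true x + S x             ≈⟨ R.+-comm _ _ ⟩
      S x + T true x             ≈⟨ rows true x ⟩
      0ℝ                         ∎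
    right : ∀ j → c (m₀ ↑ʳ j) ≈ 0ℝ
    right = indep₁ _ D≈0
    T≈0 : ∀ x → T false x ≈ 0ℝ
    T≈0 x = R.trans
      (ℝΣ.sum-cong-≋ (λ j → R.trans (R.*-congʳ {fromℚ (g (false ∷ (x ∩ col₁ j)))} (right j)) (R.zeroˡ _)))
      (ℝΣ.sum-replicate-zero m₁)
    left : ∀ j → c (j ↑ˡ m₁) ≈ 0ℝ
    left = indep₀ _ λ x → R.trans (R.sym (R.+-identityʳ _))
      (R.trans (R.+-congˡ (R.sym (T≈0 x))) (rows false x))
    split : ∀ i → c (join m₀ m₁ i) ≈ 0ℝ
    split (inj₁ i) = left i
    split (inj₂ i) = right i

-- Certificates

∈-cube : ∀ {n} (x : Cube n) → x ∈ₗ cube n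
∈-cube []          = here refl
∈-cube (false ∷ x) = ∈-++⁺ˡ (∈-map⁺ (false ∷_) (∈-cube x))
∈-cube (true ∷ x)  = ∈-++⁺ʳ (map (false ∷_) (cube _)) (∈-map⁺ (true ∷_) (∈-cube x))

find : ∀ {n} (f : BooleanFunction n) b → (∃ λ x → f x ≡ b) ⊎ (∀ x → f x ≡ not b)
find {n} f b with Any.any? (λ x → f x Bool.≟ b) (cube n)
... | yes p  = inj₁ (Any.satisfied p)
... | no  ¬p = inj₂ λ x → Bool.¬-not (λ fx≡b → ¬p (Any.map (λ eq → subst (λ y → f y ≡ b) eq fx≡b) (∈-cube x)))

0/1 : ∀ {n} → BooleanFunction n → RationalFunction n
0/1 f x = if f x then 1ℚ else 0ℚ

monomials-constant : ∀ {n} (f : BooleanFunction n) b → (∀ x → f x ≡ b) → monomials (0/1 f) ℕ.≤ 1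
monomials-constant f b const = monomials-const (if b then 1ℚ else 0ℚ)
  (λ x → cong (λ b → if b then 1ℚ else 0ℚ) (const x))

Agree : ∀ {n} → List (Fin n) → Cube n → Cube n → Set
Agree L x y = ∀ {i} → i ∈ₗ L → lookup x i ≡ lookup y i

Certificate : ∀ {n} → BooleanFunction n → Cube n → List (Fin n) → Set
Certificate f x L = ∀ y → Agree L x y → f y ≡ f x

Certificates≤ : ∀ {n} → ℕ → Bool → BooleanFunction n → Set
Certificates≤ k b f = ∀ x → f x ≡ b → ∃ λ L → length L ℕ.≤ k × Certificate f x L

-- A restriction remains a function on the whole cube, which keeps n fixed while variables are
-- queried. If an index is repeated, its first value counts.
override : ∀ {n} (L : List (Fin n)) → Vec Bool (length L) → Cube n → Cube n
override []      []      x = x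
override (i ∷ L) (b ∷ β) x = override L β x [ i ]≔ b

override-agree : ∀ {n} (L : List (Fin n)) β x y {j} →
  j ∈ₗ L ⊎ lookup x j ≡ lookup y j → lookup (override L β x) j ≡ lookup (override L β y) j
override-agree []      []      x y (inj₂ eq) = eq
override-agree (i ∷ L) (b ∷ β) x y {j} p with j Fin.≟ i
... | yes refl = trans (lookup∘update i (override L β x) b) (sym (lookup∘update i (override L β y) b))
... | no  j≢i  = begin
  lookup (override L β x [ i ]≔ b) j ≡⟨ lookup∘update′ j≢i (override L β x) b ⟩
  lookup (override L β x) j          ≡⟨ override-agree L β x y (tail p) ⟩
  lookup (override L β y) j          ≡⟨ lookup∘update′ j≢i (override L β y) b ⟨
  lookup (override L β y [ i ]≔ b) j ∎
  where
  open ≡-Reasoning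
  tail : j ∈ₗ i ∷ L ⊎ lookup x j ≡ lookup y j → j ∈ₗ L ⊎ lookup x j ≡ lookup y j
  tail (inj₁ (here j≡i))  = contradiction j≡i j≢i
  tail (inj₁ (there j∈L)) = inj₁ j∈L
  tail (inj₂ eq)          = inj₂ eq

-- Each query costs a factor 3: the branch `false` counts twice, the branch `true` once.
monomials-override : ∀ {n} (g : RationalFunction n) L m →
  (∀ β → monomials (g ∘ override L β) ℕ.≤ m) → monomials g ℕ.≤ 3 ℕ.^ length L ℕ.* m
monomials-override g []      m bound = ℕ.≤-trans (bound []) (ℕ.≤-reflexive (sym (ℕ.+-identityʳ m)))
monomials-override g (i ∷ L) m bound = begin
  monomials g                                        ≤⟨ monomials-restrict g i ⟩
  2 ℕ.* monomials (λ x → g (x [ i ]≔ false)) ℕ.+ monomials (λ x → g (x [ i ]≔ true))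
    ≤⟨ ℕ.+-mono-≤ (ℕ.*-monoʳ-≤ 2 (rest false)) (rest true) ⟩
  2 ℕ.* M ℕ.+ M                                      ≡⟨ ℕ.+-comm (2 ℕ.* M) M ⟩
  3 ℕ.* M                                            ≡⟨ ℕ.*-assoc 3 (3 ℕ.^ length L) m ⟨
  3 ℕ.^ suc (length L) ℕ.* m                         ∎
  where
  open ℕ.≤-Reasoning
  M = 3 ℕ.^ length L ℕ.* m
  rest : ∀ b → monomials (λ x → g (x [ i ]≔ b)) ℕ.≤ M
  rest b = monomials-override (λ x → g (x [ i ]≔ b)) L m (λ β → bound (b ∷ β))

-- Query a 1-certificate S of f.  Since S meets every 0-certificate of f, each
-- of the resulting restrictions of f has smaller 0-certificates.
monomials-certificates : ∀ {n} k₀ k₁ (f : BooleanFunction n) →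
  Certificates≤ k₀ false f → Certificates≤ k₁ true f → monomials (0/1 f) ℕ.≤ 3 ℕ.^ (k₀ ℕ.* k₁)
monomials-certificates zero k₁ f cert₀ cert₁ with find f false
... | inj₂ const = monomials-constant f true const
... | inj₁ (x , fx≡0) with cert₀ x fx≡0
...   | [] , _ , cert = monomials-constant f (f x) (λ y → cert y λ ())
monomials-certificates {n} (suc k₀) k₁ f cert₀ cert₁ with find f true
... | inj₂ const = ℕ.≤-trans (monomials-constant f false const) (ℕ.m^n>0 3 (suc k₀ ℕ.* k₁))
... | inj₁ (x₁ , fx₁≡1) with cert₁ x₁ fx₁≡1
...   | S , ∣S∣≤k₁ , S-cert = begin
  monomials (0/1 f)                            ≤⟨ monomials-override (0/1 f) S (3 ℕ.^ (k₀ ℕ.* k₁)) (λ β →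
                                                    monomials-certificates k₀ k₁ (f ∘ override S β) (cert₀′ β) (cert₁′ β)) ⟩
  3 ℕ.^ length S ℕ.* 3 ℕ.^ (k₀ ℕ.* k₁)         ≤⟨ ℕ.*-monoˡ-≤ (3 ℕ.^ (k₀ ℕ.* k₁)) (ℕ.^-monoʳ-≤ 3 ∣S∣≤k₁) ⟩
  3 ℕ.^ k₁ ℕ.* 3 ℕ.^ (k₀ ℕ.* k₁)               ≡⟨ ℕ.^-distribˡ-+-* 3 k₁ (k₀ ℕ.* k₁) ⟨
  3 ℕ.^ (suc k₀ ℕ.* k₁)                        ∎
  where
  open ℕ.≤-Reasoning
  open DecMembership (Fin._≟_ {n}) using () renaming (_∈?_ to _∈ₗ?_)
  ∉S? : Decidable (λ i → ¬ i ∈ₗ S)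
  ∉S? i = ¬? (i ∈ₗ? S)
  cert₁′ : ∀ β → Certificates≤ k₁ true (f ∘ override S β)
  cert₁′ β x fx≡1 with cert₁ (override S β x) fx≡1
  ... | L , le , cert = L , le , λ y agree → cert (override S β y)
    (λ i∈L → override-agree S β x y (inj₂ (agree i∈L)))
  cert₀′ : ∀ β → Certificates≤ k₀ false (f ∘ override S β)
  cert₀′ β x fx≡0 with cert₀ (override S β x) fx≡0
  -- Queried indices can be left out of the certificate, because overridden points all agree there.
  ... | L , le , cert = filter ∉S? L ,
      ℕ.≤-pred (ℕ.≤-trans (filter-notAll ∉S? L meet) le) ,
      λ y agree → cert (override S β y) (λ {i} i∈L → override-agree S β x y (cases y agree i∈L (i ∈ₗ? S)))
    where
    cases : ∀ y → Agree (filter ∉S? L) x y → ∀ {i} → i ∈ₗ L → Dec (i ∈ₗ S) → i ∈ₗ S ⊎ lookup x i ≡ lookup y i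
    cases y agree i∈L (yes i∈S) = inj₁ i∈S
    cases y agree i∈L (no  i∉S) = inj₂ (agree (∈-filter⁺ ∉S? i∈L i∉S))
    -- If L and S had no index in common, `z` would satisfy the 1-certificate S and the
    -- 0-certificate L at once.
    z : Cube n
    z = tabulate (λ i → if does (i ∈ₗ? S) then lookup x₁ i else lookup (override S β x) i)
    z-S : Agree S x₁ z
    z-S {i} i∈S with lookup∘tabulate (λ i → if does (i ∈ₗ? S) then lookup x₁ i else lookup (override S β x) i) i
    ... | eq with i ∈ₗ? S
    ...   | yes _   = sym eq
    ...   | no  i∉S = contradiction i∈S i∉S
    z-L : (∀ {i} → i ∈ₗ L → ¬ i ∈ₗ S) → Agree L (override S β x) z
    z-L disjoint {i} i∈L with lookup∘tabulate (λ i → if does (i ∈ₗ? S) then lookup x₁ i else lookup (override S β x) i) i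
    ... | eq with i ∈ₗ? S
    ...   | yes i∈S = contradiction i∈S (disjoint i∈L)
    ...   | no  _   = sym eq
    meet : Any (λ i → ¬ ¬ i ∈ₗ S) L
    meet with Any.any? (λ i → ¬? (∉S? i)) L
    ... | yes p  = p
    ... | no  ¬p = contradiction
      (trans (sym fx₁≡1) (trans (sym (S-cert z z-S)) (trans (cert z (z-L disjoint)) fx≡0))) λ ()
      where
      disjoint : ∀ {i} → i ∈ₗ L → ¬ i ∈ₗ S
      disjoint i∈L i∈S = ¬p (Any.map (λ { refl i∉S → i∉S i∈S }) i∈L)

-- Small certificates from minimal sensitive blocks

⊕-assoc : ∀ {n} (x y z : Cube n) → (x ⊕ y) ⊕ z ≡ x ⊕ (y ⊕ z)
⊕-assoc = zipWith-assoc Bool.xor-assoc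

⊕-comm : ∀ {n} (x y : Cube n) → x ⊕ y ≡ y ⊕ x
⊕-comm = zipWith-comm Bool.xor-comm

⊕-cancel : ∀ {n} (x y : Cube n) → x ⊕ (x ⊕ y) ≡ y
⊕-cancel []      []      = refl
⊕-cancel (a ∷ x) (b ∷ y) = cong₂ _∷_
  (trans (sym (Bool.xor-assoc a a b)) (cong (_xor b) (Bool.xor-same a))) (⊕-cancel x y)

∈⇒≤max : ∀ {m ms} → m ∈ₗ ms → m ℕ.≤ max 0 ms
∈⇒≤max {ms = ms} = All.lookup (xs≤max 0 ms)

length-filter-mono : ∀ {A : Set} {P Q : Pred A 0ℓ} (P? : Decidable P) (Q? : Decidable Q) →
  (∀ {x} → P x → Q x) → ∀ xs → length (filter P? xs) ℕ.≤ length (filter Q? xs)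
length-filter-mono P? Q? P⇒Q []       = z≤n
length-filter-mono P? Q? P⇒Q (x ∷ xs) with P? x | Q? x
... | yes _  | yes _  = s≤s (length-filter-mono P? Q? P⇒Q xs)
... | yes px | no ¬qx = contradiction (P⇒Q px) ¬qx
... | no  _  | yes _  = ℕ.m≤n⇒m≤1+n (length-filter-mono P? Q? P⇒Q xs)
... | no  _  | no  _  = length-filter-mono P? Q? P⇒Q xs

elements : ∀ {n} → Subset n → List (Fin n)
elements B = filter (_∈? B) (allFin _)

-- For i in B, `B ⊕ ⁅ i ⁆` is B without i. Written in this way, deleting i from B is, by `⊕-assoc`,
-- the same as flipping bit i at `x ⊕ B`.
drop-element-⊆ : ∀ {n} {B : Subset n} {i} → i ∈ B → B ⊕ ⁅ i ⁆ ⊆ B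
drop-element-⊆ {B = true ∷ B}  {zero}  _           {zero}  ()
drop-element-⊆ {B = true ∷ B}  {zero}  _           {suc j} (Vec.there j∈) =
  Vec.there (subst (j ∈_) (trans (⊕-comm B _) (zipWith-identityˡ Bool.xor-identityˡ B)) j∈)
drop-element-⊆ {B = b ∷ B}     {suc i} (Vec.there i∈) {zero}  j∈ with b | j∈
... | true | _ = Vec.here
drop-element-⊆ {B = b ∷ B}     {suc i} (Vec.there i∈) {suc j} (Vec.there j∈) = Vec.there (drop-element-⊆ i∈ j∈)

drop-element-∣∣ : ∀ {n} {B : Subset n} {i} → i ∈ B → ∣ B ⊕ ⁅ i ⁆ ∣ ℕ.< ∣ B ∣
drop-element-∣∣ {B = true ∷ B}  {zero}  _ = s≤s (ℕ.≤-reflexive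
  (cong ∣_∣ (trans (⊕-comm B _) (zipWith-identityˡ Bool.xor-identityˡ B))))
drop-element-∣∣ {B = true ∷ B}  {suc i} (Vec.there i∈) = s≤s (drop-element-∣∣ i∈)
drop-element-∣∣ {B = false ∷ B} {suc i} (Vec.there i∈) = drop-element-∣∣ i∈

sublists-filter : ∀ {A : Set} {P : Pred A 0ℓ} (P? : Decidable P) {xs} ys →
  xs ∈ₗ sublists (filter P? ys) → xs ∈ₗ sublists ys
sublists-filter P? [] xs∈ = xs∈
sublists-filter P? (y ∷ ys) xs∈ with P? y
... | no _ = ∈-++⁺ˡ (sublists-filter P? ys xs∈)
... | yes _ with ∈-++⁻ (sublists (filter P? ys)) xs∈
...   | inj₁ p = ∈-++⁺ˡ (sublists-filter P? ys p)
...   | inj₂ p with ∈-map⁻ (y ∷_) p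
...     | zs , zs∈ , refl = ∈-++⁺ʳ (sublists ys) (∈-map⁺ (y ∷_) (sublists-filter P? ys zs∈))

sublists-⊆ : ∀ {A : Set} {xs} (ys : List A) {z} → xs ∈ₗ sublists ys → z ∈ₗ xs → z ∈ₗ ys
sublists-⊆ [] (here refl) ()
sublists-⊆ (y ∷ ys) xs∈ z∈ with ∈-++⁻ (sublists ys) xs∈
... | inj₁ p = there (sublists-⊆ ys p z∈)
... | inj₂ p with ∈-map⁻ (y ∷_) p
...   | zs , zs∈ , refl with z∈
...     | here eq   = here eq
...     | there z∈′ = there (sublists-⊆ ys zs∈ z∈′)

-- The chosen blocks keep their order, because `families` enumerates its candidates by `sublists`.
greedy : ∀ {n} → List (Subset n) → List (Subset n)
greedy [] = []
greedy (B ∷ Bs) with All.all? (disjoint? B) (greedy Bs)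
... | yes _ = B ∷ greedy Bs
... | no  _ = greedy Bs

greedy-disjoint : ∀ {n} (Bs : List (Subset n)) → AllPairs Disjoint (greedy Bs)
greedy-disjoint [] = []
greedy-disjoint (B ∷ Bs) with All.all? (disjoint? B) (greedy Bs)
... | yes p = p ∷ greedy-disjoint Bs
... | no  _ = greedy-disjoint Bs

greedy∈sublists : ∀ {n} (Bs : List (Subset n)) → greedy Bs ∈ₗ sublists Bs
greedy∈sublists [] = here refl
greedy∈sublists (B ∷ Bs) with All.all? (disjoint? B) (greedy Bs)
... | yes p = ∈-++⁺ʳ (sublists Bs) (∈-map⁺ (B ∷_) (greedy∈sublists Bs))
... | no  _ = ∈-++⁺ˡ (greedy∈sublists Bs)

-- A rejected block meets one already chosen; a chosen block meets itself, at i.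
greedy-maximal : ∀ {n} (Bs : List (Subset n)) {B i} → B ∈ₗ Bs → i ∈ B →
  ¬ All (Disjoint B) (greedy Bs)
greedy-maximal (B ∷ Bs) B∈ i∈ disjoint with All.all? (disjoint? B) (greedy Bs) | B∈ | disjoint
... | yes _ | here refl | d ∷ _ = d (_ , x∈p∩q⁺ (i∈ , i∈))
... | yes _ | there p   | _ ∷ d = greedy-maximal Bs p i∈ d
... | no ¬d | here refl | d     = ¬d d
... | no _  | there p   | d     = greedy-maximal Bs p i∈ d

length-concatMap : ∀ {A C : Set} (h : A → List C) k xs → All (λ x → length (h x) ℕ.≤ k) xs →
  length (concatMap h xs) ℕ.≤ length xs ℕ.* k
length-concatMap h k []       []       = z≤n
length-concatMap h k (x ∷ xs) (p ∷ ps) = ℕ.≤-trans (ℕ.≤-reflexive (length-++ (h x)))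
  (ℕ.+-mono-≤ p (length-concatMap h k xs ps))

module _ {n} (f : BooleanFunction n) where

  s-at≤s : ∀ x → s-at f x ℕ.≤ s f
  s-at≤s x = ∈⇒≤max (∈-map⁺ (s-at f) (∈-cube x))

  bs-at≤bs : ∀ x → bs-at f x ℕ.≤ bs f
  bs-at≤bs x = ∈⇒≤max (∈-map⁺ (bs-at f) (∈-cube x))

  Minimal : Cube n → Subset n → Set
  Minimal x B = Sensitive f x B × (∀ i → i ∈ B → f (x ⊕ (B ⊕ ⁅ i ⁆)) ≡ f x)

  minimal? : ∀ x → Decidable (Minimal x)
  minimal? x B = sensitive? f x B ×-dec
    Fin.all? (λ i → (i ∈? B) →-dec (f (x ⊕ (B ⊕ ⁅ i ⁆)) Bool.≟ f x))

  minimal-block : ∀ x B → Sensitive f x B → ∃ λ C → C ⊆ B × Minimal x C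
  minimal-block x B = go B (<-wellFounded ∣ B ∣)
    where
    go : ∀ B → Acc ℕ._<_ ∣ B ∣ → Sensitive f x B → ∃ λ C → C ⊆ B × Minimal x C
    go B (acc rec) sens with Fin.any? (λ i → (i ∈? B) ×-dec sensitive? f x (B ⊕ ⁅ i ⁆))
    ... | no none = B , (λ i∈ → i∈) , sens , λ i i∈ →
      decidable-stable (_ Bool.≟ _) (λ ≢ → none (i , i∈ , ≢))
    ... | yes (i , i∈ , sens′) =
      let C , C⊆ , min = go (B ⊕ ⁅ i ⁆) (rec (drop-element-∣∣ i∈)) sens′
      in C , (λ j∈ → drop-element-⊆ i∈ (C⊆ j∈)) , min

  sensitive-nonempty : ∀ {x B} → Sensitive f x B → ∃ λ i → i ∈ B
  sensitive-nonempty {x} {B} sens with Fin.any? (_∈? B)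
  ... | yes p  = p
  ... | no  ¬p = contradiction (cong f (x⊕∅ x B (λ i i∈ → ¬p (i , i∈)))) sens
    where
    x⊕∅ : ∀ {n} (x : Cube n) B → (∀ i → ¬ i ∈ B) → x ⊕ B ≡ x
    x⊕∅ []      []          _ = refl
    x⊕∅ (a ∷ x) (false ∷ B) e = cong₂ _∷_ (Bool.xor-identityʳ a) (x⊕∅ x B (λ i i∈ → e (suc i) (Vec.there i∈)))
    x⊕∅ (a ∷ x) (true ∷ B)  e = contradiction Vec.here (e zero)

  -- Every element of a minimal sensitive block B of x is sensitive at x ⊕ B.
  minimal-small : ∀ {x B} → Minimal x B → length (elements B) ℕ.≤ s f
  minimal-small {x} {B} (sens , min) = ℕ.≤-trans
    (length-filter-mono (_∈? B) (λ i → sensitive? f (x ⊕ B) ⁅ i ⁆)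
      (λ {i} i∈ eq → sens (trans (sym eq) (trans (cong f (⊕-assoc x B ⁅ i ⁆)) (min i i∈))))
      (allFin n))
    (s-at≤s (x ⊕ B))

  -- Take the union of a maximal family of disjoint minimal sensitive blocks: a
  -- point y that agrees with x there but has f y ≢ f x yields a further block.
  small-certificate : ∀ x → ∃ λ L → length L ℕ.≤ bs f ℕ.* s f × Certificate f x L
  small-certificate x = concatMap elements G
    , ℕ.≤-trans (length-concatMap elements (s f) G (All.tabulate (minimal-small ∘ G-minimal)))
        (ℕ.*-monoˡ-≤ (s f) ∣G∣≤bs)
    , certificate
    where
    sensitives minimals G : List (Subset n)
    sensitives = filter (sensitive? f x) (cube n)
    minimals = filter (minimal? x) sensitives
    G = greedy minimals
    G-minimal : ∀ {B} → B ∈ₗ G → Minimal x B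
    G-minimal B∈ = proj₂ (∈-filter⁻ (minimal? x) {xs = sensitives} (sublists-⊆ minimals (greedy∈sublists minimals) B∈))
    ∣G∣≤bs : length G ℕ.≤ bs f
    ∣G∣≤bs = ℕ.≤-trans (∈⇒≤max (∈-map⁺ length (∈-filter⁺ (allPairs? disjoint?)
        (sublists-filter (minimal? x) sensitives (greedy∈sublists minimals)) (greedy-disjoint minimals))))
      (bs-at≤bs x)
    certificate : Certificate f x (concatMap elements G)
    certificate y agree = decidable-stable (f y Bool.≟ f x) λ fy≢fx →
      -- `x ⊕ y` is the set where x and y differ. A minimal block inside it would have to meet the
      -- maximal family, but x and y agree on that family.
      let C , C⊆ , min = minimal-block x (x ⊕ y) (subst (λ z → ¬ f z ≡ f x) (sym (⊕-cancel x y)) fy≢fx)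
          C∈ = ∈-filter⁺ (minimal? x) (∈-filter⁺ (sensitive? f x) (∈-cube C) (proj₁ min)) min
          i , i∈ = sensitive-nonempty (proj₁ min)
      in greedy-maximal minimals C∈ i∈ (All.tabulate λ {D} D∈ (j , j∈) →
           let j∈C , j∈D = x∈p∩q⁻ C D j∈
           in differ j (C⊆ j∈C) (agree (∈-concatMap⁺ elements
                (Any.map (λ { refl → ∈-filter⁺ (_∈? D) (∈-allFin j) j∈D }) D∈))))
      where
      differ : ∀ j → j ∈ x ⊕ y → ¬ lookup x j ≡ lookup y j
      differ j j∈ eq with trans (sym ([]=⇒lookup j∈)) (trans (lookup-zipWith _xor_ j x y)
        (trans (cong (_xor lookup y j) eq) (Bool.xor-same (lookup y j))))
      ... | ()

  monomials≤3^[bs*s]² : monomials (0/1 f) ℕ.≤ 3 ℕ.^ ((bs f ℕ.* s f) ℕ.* (bs f ℕ.* s f))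
  monomials≤3^[bs*s]² = monomials-certificates (bs f ℕ.* s f) (bs f ℕ.* s f) f
    (λ x _ → small-certificate x) (λ x _ → small-certificate x)

-- The degree and random unions of disjoint blocks

degree-0 : ∀ {n} e {g : RationalFunction n} → (∀ x → g x ≡ 0ℚ) → DegreeBelow e g
degree-0 {zero}  zero    g≡0 = g≡0 []
degree-0 {zero}  (suc e) g≡0 = tt
degree-0 {suc n} e       g≡0 = degree-0 e (λ x → g≡0 (false ∷ x)) ,
  degree-0 (pred e) (λ x → cong₂ ℚ._-_ (g≡0 (true ∷ x)) (g≡0 (false ∷ x)))

degree-cong : ∀ {n} e {g h : RationalFunction n} → g ≗ h → DegreeBelow e g → DegreeBelow e h
degree-cong {zero}  zero    eq d = trans (sym (eq [])) d
degree-cong {zero}  (suc e) eq d = tt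
degree-cong {suc n} e       eq (d , d′) = degree-cong e (λ x → eq (false ∷ x)) d ,
  degree-cong (pred e) (λ x → cong₂ ℚ._-_ (eq (true ∷ x)) (eq (false ∷ x))) d′

degree-+ : ∀ {n} e {g h : RationalFunction n} →
  DegreeBelow e g → DegreeBelow e h → DegreeBelow e (λ x → g x ℚ.+ h x)
degree-+ {zero}  zero    d d′ = cong₂ ℚ._+_ d d′
degree-+ {zero}  (suc e) d d′ = tt
degree-+ {suc n} e {g} {h} (d₀ , d₁) (d₀′ , d₁′) = degree-+ e d₀ d₀′ ,
  degree-cong (pred e) (λ x → eq (g (true ∷ x)) (g (false ∷ x)) (h (true ∷ x)) (h (false ∷ x)))
    (degree-+ (pred e) d₁ d₁′)
  where
  eq : ∀ a b c d → (a ℚ.- b) ℚ.+ (c ℚ.- d) ≡ (a ℚ.+ c) ℚ.- (b ℚ.+ d)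
  eq = solve 4 (λ a b c d → (a :- b) :+ (c :- d) := (a :+ c) :- (b :+ d)) refl
    where open ℚ-Solver

degree-weaken : ∀ {n} e {g : RationalFunction n} → DegreeBelow (pred e) g → DegreeBelow e g
degree-weaken         zero    d = d
degree-weaken {zero}  (suc e) d = tt
degree-weaken {suc n} (suc e) (d , d′) = degree-weaken (suc e) d , degree-weaken e d′

-- f₁ = f₀ + ∂ f
degree-true : ∀ {n} e {g : RationalFunction (suc n)} → DegreeBelow e g → DegreeBelow e (g ∘ (true ∷_))
degree-true e {g} (d , d′) = degree-cong e (λ x → eq (g (false ∷ x)) (g (true ∷ x)))
  (degree-+ e d (degree-weaken e d′))
  where
  eq : ∀ a b → a ℚ.+ (b ℚ.- a) ≡ b
  eq = solve 2 (λ a b → a :+ (b :- a) := b) refl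
    where open ℚ-Solver

-- Setting a variable of B to 1 replaces g by g₀ + `∂ g`, and the result no longer depends on that
-- variable.
degree-∪ : ∀ {n} e {g : RationalFunction n} B → DegreeBelow e g → DegreeBelow e (λ x → g (B ∪ x))
degree-∪ {zero} zero [] d = d
degree-∪ {zero} (suc e) [] d = tt
degree-∪ {suc n} e {g} (false ∷ B) (d , d′) = degree-∪ e B d , degree-∪ (pred e) B d′
degree-∪ {suc n} e {g} (true ∷ B)  d = degree-∪ e {g ∘ (true ∷_)} B (degree-true e {g} d) ,
  degree-0 (pred e) (λ x → ℚ.+-inverseʳ (g (true ∷ (B ∪ x))))

Δ : ∀ {n} → Subset n → RationalFunction n → RationalFunction n
Δ B g x = g (B ∪ x) ℚ.- g (x ─ B)

-- Switching the variables of B from 0 to 1 one after another turns `Δ B g` into a telescoping sum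
-- of ordinary derivatives, each of which loses a degree. Variables outside B commute with `Δ B`.
degree-Δ : ∀ {n} e {g : RationalFunction n} B → DegreeBelow e g → DegreeBelow (pred e) (Δ B g)
degree-Δ {zero} e {g} [] d = degree-0 (pred e) λ { [] → ℚ.+-inverseʳ (g []) }
degree-Δ {suc n} e {g} (false ∷ B) (d , d′) = degree-Δ e B d ,
  degree-cong (pred (pred e))
    (λ x → eq (g (true ∷ (B ∪ x))) (g (false ∷ (B ∪ x))) (g (true ∷ (x ─ B))) (g (false ∷ (x ─ B))))
    (degree-Δ (pred e) B d′)
  where
  eq : ∀ a b c d → (a ℚ.- b) ℚ.- (c ℚ.- d) ≡ (a ℚ.- c) ℚ.- (b ℚ.- d)
  eq = solve 4 (λ a b c d → (a :- b) :- (c :- d) := (a :- c) :- (b :- d)) refl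
    where open ℚ-Solver
degree-Δ {suc n} e {g} (true ∷ B) (d , d′) =
  degree-cong (pred e)
    (λ x → eq (g (false ∷ (B ∪ x))) (g (false ∷ (x ─ B))) (g (true ∷ (B ∪ x))))
    (degree-+ (pred e) (degree-Δ e B d) (degree-∪ (pred e) B d′)) ,
  degree-0 (pred (pred e)) (λ x → ℚ.+-inverseʳ (g (true ∷ (B ∪ x)) ℚ.- g (false ∷ (x ─ B))))
  where
  eq : ∀ a b c → (a ℚ.- b) ℚ.+ (c ℚ.- a) ≡ c ℚ.- b
  eq = solve 3 (λ a b c → (a :- b) :+ (c :- a) := c :- b) refl
    where open ℚ-Solver

-- Univariate polynomial functions over the rationals

PolynomialBelow : ℕ → (ℚ → ℚ) → Set
PolynomialBelow zero    h = ∀ x → h x ≡ 0ℚ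
PolynomialBelow (suc e) h = ∃ λ c → ∃ λ h′ → PolynomialBelow e h′ × (∀ x → h x ≡ c ℚ.+ x ℚ.* h′ x)

poly-cong : ∀ e {g h : ℚ → ℚ} → g ≗ h → PolynomialBelow e g → PolynomialBelow e h
poly-cong zero    eq p x = trans (sym (eq x)) (p x)
poly-cong (suc e) eq (c , g′ , p , g≡) = c , g′ , p , λ x → trans (sym (eq x)) (g≡ x)

poly-0 : ∀ e → PolynomialBelow e (λ _ → 0ℚ)
poly-0 zero    x = refl
poly-0 (suc e) = 0ℚ , (λ _ → 0ℚ) , poly-0 e , λ x → sym (trans (ℚ.+-identityˡ _) (ℚ.*-zeroʳ x))

poly-const : ∀ e c → PolynomialBelow (suc e) (λ _ → c)
poly-const e c = c , (λ _ → 0ℚ) , poly-0 e , λ x → sym (trans (cong (c ℚ.+_) (ℚ.*-zeroʳ x)) (ℚ.+-identityʳ c))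

poly-weaken : ∀ e {h} → PolynomialBelow e h → PolynomialBelow (suc e) h
poly-weaken zero    p = poly-cong 1 (λ x → sym (p x)) (poly-0 1)
poly-weaken (suc e) (c , h′ , p , h≡) = c , h′ , poly-weaken e p , h≡

poly-+ : ∀ e {g h} → PolynomialBelow e g → PolynomialBelow e h → PolynomialBelow e (λ x → g x ℚ.+ h x)
poly-+ zero    p q x = cong₂ ℚ._+_ (p x) (q x)
poly-+ (suc e) (c , g′ , p , g≡) (d , h′ , q , h≡) = c ℚ.+ d , _ , poly-+ e p q ,
  λ x → trans (cong₂ ℚ._+_ (g≡ x) (h≡ x)) (eq c d x (g′ x) (h′ x))
  where
  eq : ∀ c d x a b → (c ℚ.+ x ℚ.* a) ℚ.+ (d ℚ.+ x ℚ.* b) ≡ (c ℚ.+ d) ℚ.+ x ℚ.* (a ℚ.+ b)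
  eq = solve 5 (λ c d x a b → (c :+ x :* a) :+ (d :+ x :* b) := (c :+ d) :+ x :* (a :+ b)) refl
    where open ℚ-Solver

poly-scale : ∀ e q {h} → PolynomialBelow e h → PolynomialBelow e (λ x → q ℚ.* h x)
poly-scale zero    q p x = trans (cong (q ℚ.*_) (p x)) (ℚ.*-zeroʳ q)
poly-scale (suc e) q (c , h′ , p , h≡) = q ℚ.* c , _ , poly-scale e q p ,
  λ x → trans (cong (q ℚ.*_) (h≡ x)) (eq q c x (h′ x))
  where
  eq : ∀ q c x a → q ℚ.* (c ℚ.+ x ℚ.* a) ≡ q ℚ.* c ℚ.+ x ℚ.* (q ℚ.* a)
  eq = solve 4 (λ q c x a → q :* (c :+ x :* a) := q :* c :+ x :* (q :* a)) refl
    where open ℚ-Solver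

poly-x* : ∀ e {h} → PolynomialBelow (pred e) h → PolynomialBelow e (λ x → x ℚ.* h x)
poly-x* zero    p x = trans (cong (x ℚ.*_) (p x)) (ℚ.*-zeroʳ x)
poly-x* (suc e) {h} p = 0ℚ , h , p , λ x → sym (ℚ.+-identityˡ _)

poly-shift : ∀ e {h} → PolynomialBelow e h → PolynomialBelow e (λ x → h (x ℚ.+ 1ℚ))
poly-shift zero    p x = p (x ℚ.+ 1ℚ)
poly-shift (suc e) {h} (c , h′ , p , h≡) = poly-cong (suc e)
  (λ x → sym (trans (h≡ (x ℚ.+ 1ℚ)) (eq c x (h′ (x ℚ.+ 1ℚ)))))
  (poly-+ (suc e) (c , _ , poly-shift e p , λ x → refl) (poly-weaken e (poly-shift e p)))
  where
  eq : ∀ c x a → c ℚ.+ (x ℚ.+ 1ℚ) ℚ.* a ≡ (c ℚ.+ x ℚ.* a) ℚ.+ a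
  eq = solve 3 (λ c x a → c :+ (x :+ con 1ℚ) :* a := (c :+ x :* a) :+ a) refl
    where open ℚ-Solver

-- The constant term cancels, and the rest follows from the product rule for differences. The order,
-- h x minus h (x + 1), yields the signs of `alternate`.
poly-difference : ∀ e {h} → PolynomialBelow (suc e) h → PolynomialBelow e (λ x → h x ℚ.- h (x ℚ.+ 1ℚ))
poly-difference zero {h} (c , h′ , p , h≡) x = trans
  (cong₂ ℚ._-_ (const x) (const (x ℚ.+ 1ℚ))) (ℚ.+-inverseʳ c)
  where
  const : ∀ x → h x ≡ c
  const x = trans (h≡ x) (trans (cong (c ℚ.+_) (trans (cong (x ℚ.*_) (p x)) (ℚ.*-zeroʳ x))) (ℚ.+-identityʳ c))
poly-difference (suc e) {h} (c , h′ , p , h≡) = poly-cong (suc e)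
  (λ x → sym (trans (cong₂ ℚ._-_ (h≡ x) (h≡ (x ℚ.+ 1ℚ))) (eq c x (h′ x) (h′ (x ℚ.+ 1ℚ)))))
  (poly-+ (suc e) (poly-x* (suc e) (poly-difference e p)) (poly-scale (suc e) (ℚ.- 1ℚ) (poly-shift (suc e) p)))
  where
  eq : ∀ c x a b → (c ℚ.+ x ℚ.* a) ℚ.- (c ℚ.+ (x ℚ.+ 1ℚ) ℚ.* b) ≡ x ℚ.* (a ℚ.- b) ℚ.+ (ℚ.- 1ℚ) ℚ.* b
  eq = solve 4 (λ c x a b → (c :+ x :* a) :- (c :+ (x :+ con 1ℚ) :* b) := x :* (a :- b) :+ (:- con 1ℚ) :* b) refl
    where open ℚ-Solver

poly-square : ∀ e q {h} → PolynomialBelow e h → PolynomialBelow (2 ℕ.* e) (λ x → h (q ℚ.* (x ℚ.* x)))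
poly-square zero    q p x = p (q ℚ.* (x ℚ.* x))
poly-square (suc e) q {h} (c , h′ , p , h≡) = subst (λ k → PolynomialBelow k (λ x → h (q ℚ.* (x ℚ.* x))))
  (sym (ℕ.*-suc 2 e))
  (c , _ , poly-x* (suc (2 ℕ.* e)) (poly-scale (2 ℕ.* e) q (poly-square e q p)) ,
   λ x → trans (h≡ (q ℚ.* (x ℚ.* x))) (eq c q x (h′ (q ℚ.* (x ℚ.* x)))))
  where
  eq : ∀ c q x a → c ℚ.+ q ℚ.* (x ℚ.* x) ℚ.* a ≡ c ℚ.+ x ℚ.* (x ℚ.* (q ℚ.* a))
  eq = solve 4 (λ c q x a → c :+ q :* (x :* x) :* a := c :+ x :* (x :* (q :* a))) refl
    where open ℚ-Solver

-- Expectations over random unions of blocks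

-- The expectation of g at the union of a random subfamily of Bs that contains
-- each block independently with probability p.
𝔼 : ∀ {n} → List (Subset n) → RationalFunction n → ℚ → ℚ
𝔼 []       g p = g ⊥
𝔼 (B ∷ Bs) g p = (1ℚ ℚ.- p) ℚ.* 𝔼 Bs g p ℚ.+ p ℚ.* 𝔼 Bs (λ x → g (B ∪ x)) p

𝔼-cong : ∀ {n} Bs {g h : RationalFunction n} → g ≗ h → ∀ p → 𝔼 Bs g p ≡ 𝔼 Bs h p
𝔼-cong []       eq p = eq ⊥
𝔼-cong (B ∷ Bs) eq p = cong₂ ℚ._+_ (cong ((1ℚ ℚ.- p) ℚ.*_) (𝔼-cong Bs eq p))
  (cong (p ℚ.*_) (𝔼-cong Bs (λ x → eq (B ∪ x)) p))

𝔼-− : ∀ {n} Bs (g h : RationalFunction n) p → 𝔼 Bs (λ x → g x ℚ.- h x) p ≡ 𝔼 Bs g p ℚ.- 𝔼 Bs h p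
𝔼-− []       g h p = refl
𝔼-− (B ∷ Bs) g h p = trans
  (cong₂ (λ a b → (1ℚ ℚ.- p) ℚ.* a ℚ.+ p ℚ.* b) (𝔼-− Bs g h p) (𝔼-− Bs (λ x → g (B ∪ x)) (λ x → h (B ∪ x)) p))
  (eq (1ℚ ℚ.- p) p (𝔼 Bs g p) _ _ _)
  where
  eq : ∀ q p a b c d → q ℚ.* (a ℚ.- b) ℚ.+ p ℚ.* (c ℚ.- d) ≡ (q ℚ.* a ℚ.+ p ℚ.* c) ℚ.- (q ℚ.* b ℚ.+ p ℚ.* d)
  eq = solve 6 (λ q p a b c d → q :* (a :- b) :+ p :* (c :- d) := (q :* a :+ p :* c) :- (q :* b :+ p :* d)) refl
    where open ℚ-Solver

disjoint-∪-─ : ∀ {n} (B C : Subset n) → Disjoint B C → ∀ x → (C ∪ x) ─ B ≡ C ∪ (x ─ B)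
disjoint-∪-─ []      []      _ []      = refl
disjoint-∪-─ (false ∷ B) (c ∷ C) d (a ∷ x) =
  cong ((c ∨ a) ∷_) (disjoint-∪-─ B C (λ { (i , i∈) → d (Fin.suc i , Vec.there i∈) }) x)
disjoint-∪-─ (true ∷ B) (false ∷ C) d (a ∷ x) =
  cong (false ∷_) (disjoint-∪-─ B C (λ { (i , i∈) → d (Fin.suc i , Vec.there i∈) }) x)
disjoint-∪-─ (true ∷ B) (true ∷ C) d x with () ← d (Fin.zero , Vec.here)

⊥─ : ∀ {n} (B : Subset n) → ⊥ ─ B ≡ ⊥
⊥─ []          = refl
⊥─ (true ∷ B)  = cong (false ∷_) (⊥─ B)
⊥─ (false ∷ B) = cong (false ∷_) (⊥─ B)

-- A union of blocks disjoint from B contains nothing of B that could be removed.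
𝔼-─ : ∀ {n} Bs (g : RationalFunction n) B → All (Disjoint B) Bs → ∀ p →
  𝔼 Bs (λ x → g (x ─ B)) p ≡ 𝔼 Bs g p
𝔼-─ []       g B []       p = cong g (⊥─ B)
𝔼-─ (C ∷ Bs) g B (d ∷ ds) p = cong₂ (λ a b → (1ℚ ℚ.- p) ℚ.* a ℚ.+ p ℚ.* b)
  (𝔼-─ Bs g B ds p)
  (trans (𝔼-cong Bs (λ x → cong g (disjoint-∪-─ B C d x)) p) (𝔼-─ Bs (λ x → g (C ∪ x)) B ds p))

-- In this form each new factor p comes with a `Δ`, hence with the loss of one degree of g. The
-- defining recursion by itself would only bound the degree in p by the number of blocks.
𝔼-Δ : ∀ {n} B Bs (g : RationalFunction n) → All (Disjoint B) Bs → ∀ p →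
  𝔼 (B ∷ Bs) g p ≡ 𝔼 Bs g p ℚ.+ p ℚ.* 𝔼 Bs (Δ B g) p
𝔼-Δ B Bs g ds p = trans (eq p (𝔼 Bs g p) _)
  (cong (λ a → 𝔼 Bs g p ℚ.+ p ℚ.* a) (sym (trans (𝔼-− Bs (λ x → g (B ∪ x)) (λ x → g (x ─ B)) p)
    (cong (λ a → 𝔼 Bs (λ x → g (B ∪ x)) p ℚ.- a) (𝔼-─ Bs g B ds p)))))
  where
  eq : ∀ p a b → (1ℚ ℚ.- p) ℚ.* a ℚ.+ p ℚ.* b ≡ a ℚ.+ p ℚ.* (b ℚ.- a)
  eq = solve 3 (λ p a b → (con 1ℚ :- p) :* a :+ p :* b := a :+ p :* (b :- a)) refl
    where open ℚ-Solver

poly-𝔼 : ∀ {n} e Bs {g : RationalFunction n} → DegreeBelow e g → AllPairs Disjoint Bs → PolynomialBelow e (𝔼 Bs g)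
poly-𝔼 {zero}  zero    []       d _ p = d
poly-𝔼 {suc n} zero    []       {g} d _ p = poly-𝔼 zero [] {g ∘ (false ∷_)} (proj₁ d) [] p
poly-𝔼         (suc e) []       {g} d _ = poly-const e (g ⊥)
poly-𝔼         e       (B ∷ Bs) {g} d (ds ∷ dss) = poly-cong e (λ p → sym (𝔼-Δ B Bs g ds p))
  (poly-+ e (poly-𝔼 e Bs d dss) (poly-x* e (poly-𝔼 (pred e) Bs (degree-Δ e B d) dss)))

-- The quotient of 𝔼(p) - 𝔼(0) by p, written without division so that it makes sense at p = 0, where
-- it is the derivative.
slope : ∀ {n} → List (Subset n) → RationalFunction n → ℚ → ℚ
slope []       g p = 0ℚ
slope (B ∷ Bs) g p = slope Bs g p ℚ.+ 𝔼 Bs (Δ B g) p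

𝔼-slope : ∀ {n} Bs (g : RationalFunction n) → AllPairs Disjoint Bs → ∀ p → 𝔼 Bs g p ≡ g ⊥ ℚ.+ p ℚ.* slope Bs g p
𝔼-slope []       g _          p = sym (trans (cong (g ⊥ ℚ.+_) (ℚ.*-zeroʳ p)) (ℚ.+-identityʳ (g ⊥)))
𝔼-slope (B ∷ Bs) g (ds ∷ dss) p = trans (𝔼-Δ B Bs g ds p) (trans
  (cong (ℚ._+ p ℚ.* 𝔼 Bs (Δ B g) p) (𝔼-slope Bs g dss p))
  (eq (g ⊥) p (slope Bs g p) (𝔼 Bs (Δ B g) p)))
  where
  eq : ∀ c p a b → (c ℚ.+ p ℚ.* a) ℚ.+ p ℚ.* b ≡ c ℚ.+ p ℚ.* (a ℚ.+ b)
  eq = solve 4 (λ c p a b → (c :+ p :* a) :+ p :* b := c :+ p :* (a :+ b)) refl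
    where open ℚ-Solver

poly-slope : ∀ {n} e Bs {g : RationalFunction n} → DegreeBelow e g → AllPairs Disjoint Bs →
  PolynomialBelow (pred e) (slope Bs g)
poly-slope e []       d _          = poly-0 (pred e)
poly-slope e (B ∷ Bs) d (ds ∷ dss) = poly-+ (pred e) (poly-slope e Bs d dss) (poly-𝔼 (pred e) Bs (degree-Δ e B d) dss)

𝔼-at-0 : ∀ {n} Bs (g : RationalFunction n) → 𝔼 Bs g 0ℚ ≡ g ⊥
𝔼-at-0 []       g = refl
𝔼-at-0 (B ∷ Bs) g = trans (eq (𝔼 Bs g 0ℚ) (𝔼 Bs (λ x → g (B ∪ x)) 0ℚ)) (𝔼-at-0 Bs g)
  where
  eq : ∀ a b → (1ℚ ℚ.- 0ℚ) ℚ.* a ℚ.+ 0ℚ ℚ.* b ≡ a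
  eq = solve 2 (λ a b → (con 1ℚ :- con 0ℚ) :* a :+ con 0ℚ :* b := a) refl
    where open ℚ-Solver

slope-at-0 : ∀ {n} B Bs (g : RationalFunction n) → slope (B ∷ Bs) g 0ℚ ≡ slope Bs g 0ℚ ℚ.+ (g B ℚ.- g ⊥)
slope-at-0 B Bs g = cong (slope Bs g 0ℚ ℚ.+_) (trans (𝔼-at-0 Bs (Δ B g))
  (cong₂ (λ a b → g a ℚ.- g b) (∪-identityʳ B) (⊥─ B)))

𝔼-bounds : ∀ {n} Bs (g : RationalFunction n) {p} → (∀ x → 0ℚ ℚ.≤ g x × g x ℚ.≤ 1ℚ) →
  0ℚ ℚ.≤ p → p ℚ.≤ 1ℚ → 0ℚ ℚ.≤ 𝔼 Bs g p × 𝔼 Bs g p ℚ.≤ 1ℚ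
𝔼-bounds []       g     bounds _ _ = bounds ⊥
𝔼-bounds (B ∷ Bs) g {p} bounds 0≤p p≤1 =
  let l , u = 𝔼-bounds Bs g bounds 0≤p p≤1
      l′ , u′ = 𝔼-bounds Bs (λ x → g (B ∪ x)) (λ x → bounds (B ∪ x)) 0≤p p≤1
  in subst (ℚ._≤ 𝔼 (B ∷ Bs) g p) (eq₀ p) (combine l l′)
   , subst (𝔼 (B ∷ Bs) g p ℚ.≤_) (eq₁ p) (combine u u′)
  where
  open ℚ-Solver
  eq₀ : ∀ p → (1ℚ ℚ.- p) ℚ.* 0ℚ ℚ.+ p ℚ.* 0ℚ ≡ 0ℚ
  eq₀ = solve 1 (λ p → (con 1ℚ :- p) :* con 0ℚ :+ p :* con 0ℚ := con 0ℚ) refl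
  eq₁ : ∀ p → (1ℚ ℚ.- p) ℚ.* 1ℚ ℚ.+ p ℚ.* 1ℚ ≡ 1ℚ
  eq₁ = solve 1 (λ p → (con 1ℚ :- p) :* con 1ℚ :+ p :* con 1ℚ := con 1ℚ) refl
  0≤1-p : 0ℚ ℚ.≤ 1ℚ ℚ.- p
  0≤1-p = subst (ℚ._≤ 1ℚ ℚ.- p) (ℚ.+-inverseʳ p) (ℚ.+-monoˡ-≤ (ℚ.- p) p≤1)
  combine : ∀ {a b c d} → a ℚ.≤ b → c ℚ.≤ d →
    (1ℚ ℚ.- p) ℚ.* a ℚ.+ p ℚ.* c ℚ.≤ (1ℚ ℚ.- p) ℚ.* b ℚ.+ p ℚ.* d
  combine a≤b c≤d = ℚ.+-mono-≤
    (ℚ.*-monoˡ-≤-nonNeg (1ℚ ℚ.- p) {{ℚ.nonNegative 0≤1-p}} a≤b)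
    (ℚ.*-monoˡ-≤-nonNeg p {{ℚ.nonNegative 0≤p}} c≤d)

-- Block sensitivity and degree

ι : ℕ → ℚ
ι k = ℤ.+ k ℚ./ 1

toℚᵘ-ι : ∀ k → toℚᵘ (ι k) ℚᵘ.≃ ℚᵘ.mkℚᵘ (ℤ.+ k) 0
toℚᵘ-ι k = ℚ.toℚᵘ-fromℚᵘ (ℚᵘ.mkℚᵘ (ℤ.+ k) 0)

ι-+ : ∀ a b → ι (a ℕ.+ b) ≡ ι a ℚ.+ ι b
ι-+ a b = ℚ.toℚᵘ-injective (begin
  toℚᵘ (ι (a ℕ.+ b))                               ≈⟨ toℚᵘ-ι (a ℕ.+ b) ⟩
  ℚᵘ.mkℚᵘ (ℤ.+ (a ℕ.+ b)) 0                        ≈⟨ ℚᵘ.*≡* (cong (ℤ._* ℤ.+ 1)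
    (sym (cong₂ ℤ._+_ (ℤ.*-identityʳ (ℤ.+ a)) (ℤ.*-identityʳ (ℤ.+ b))))) ⟩
  ℚᵘ.mkℚᵘ (ℤ.+ a) 0 ℚᵘ.+ ℚᵘ.mkℚᵘ (ℤ.+ b) 0         ≈⟨ ℚᵘ.+-cong (toℚᵘ-ι a) (toℚᵘ-ι b) ⟨
  toℚᵘ (ι a) ℚᵘ.+ toℚᵘ (ι b)                       ≈⟨ ℚ.toℚᵘ-homo-+ (ι a) (ι b) ⟨
  toℚᵘ (ι a ℚ.+ ι b)                               ∎)
  where open ℚᵘ.≃-Reasoning

ι-* : ∀ a b → ι (a ℕ.* b) ≡ ι a ℚ.* ι b
ι-* a b = ℚ.toℚᵘ-injective (begin
  toℚᵘ (ι (a ℕ.* b))                               ≈⟨ toℚᵘ-ι (a ℕ.* b) ⟩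
  ℚᵘ.mkℚᵘ (ℤ.+ (a ℕ.* b)) 0                        ≈⟨ ℚᵘ.*≡* (cong (ℤ._* ℤ.+ 1) (ℤ.pos-* a b)) ⟩
  ℚᵘ.mkℚᵘ (ℤ.+ a) 0 ℚᵘ.* ℚᵘ.mkℚᵘ (ℤ.+ b) 0         ≈⟨ ℚᵘ.*-cong (toℚᵘ-ι a) (toℚᵘ-ι b) ⟨
  toℚᵘ (ι a) ℚᵘ.* toℚᵘ (ι b)                       ≈⟨ ℚ.toℚᵘ-homo-* (ι a) (ι b) ⟨
  toℚᵘ (ι a ℚ.* ι b)                               ∎)
  where open ℚᵘ.≃-Reasoning

ι-mono-≤ : ∀ {a b} → a ℕ.≤ b → ι a ℚ.≤ ι b
ι-mono-≤ {a} {b} a≤b = ℚ.toℚᵘ-cancel-≤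
  (ℚᵘ.≤-respˡ-≃ (ℚᵘ.≃-sym (toℚᵘ-ι a)) (ℚᵘ.≤-respʳ-≃ (ℚᵘ.≃-sym (toℚᵘ-ι b))
    (ℚᵘ.*≤* (ℤ.*-monoʳ-≤-nonNeg (ℤ.+ 1) (ℤ.+≤+ a≤b)))))

ι-cancel-≤ : ∀ {a b} → ι a ℚ.≤ ι b → a ℕ.≤ b
ι-cancel-≤ {a} {b} ιa≤ιb
  with ℚᵘ.*≤* le ← ℚᵘ.≤-respˡ-≃ (toℚᵘ-ι a) (ℚᵘ.≤-respʳ-≃ (toℚᵘ-ι b) (ℚ.toℚᵘ-mono-≤ ιa≤ιb))
  = ℤ.drop‿+≤+ (subst₂ ℤ._≤_ (ℤ.*-identityʳ (ℤ.+ a)) (ℤ.*-identityʳ (ℤ.+ b)) le)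

0≤ι : ∀ k → 0ℚ ℚ.≤ ι k
0≤ι k = ι-mono-≤ (z≤n {k})

∣ι∣ : ∀ k → ℚ.∣ ι k ∣ ≡ ι k
∣ι∣ k = ℚ.0≤p⇒∣p∣≡p (0≤ι k)

0<ι : ∀ {k} → 1 ℕ.≤ k → 0ℚ ℚ.< ι k
0<ι 1≤k = ℚ.<-≤-trans (ℚ.positive⁻¹ 1ℚ) (ι-mono-≤ 1≤k)

-- Binomial sums and finite differences

-- ∑ᵢ (r choose i) t i
binomialSum : ℕ → (ℕ → ℚ) → ℚ
binomialSum zero    t = t 0
binomialSum (suc r) t = binomialSum r (λ i → t i ℚ.+ t (suc i))

binomialSum-cong : ∀ r {t u : ℕ → ℚ} → t ≗ u → binomialSum r t ≡ binomialSum r u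
binomialSum-cong zero    eq = eq 0
binomialSum-cong (suc r) eq = binomialSum-cong r (λ i → cong₂ ℚ._+_ (eq i) (eq (suc i)))

binomialSum-linear : ∀ r a t u →
  binomialSum r (λ i → t i ℚ.+ a ℚ.* u i) ≡ binomialSum r t ℚ.+ a ℚ.* binomialSum r u
binomialSum-linear zero    a t u = refl
binomialSum-linear (suc r) a t u = trans
  (binomialSum-cong r (λ i → eq a (t i) (u i) (t (suc i)) (u (suc i))))
  (binomialSum-linear r a (λ i → t i ℚ.+ t (suc i)) (λ i → u i ℚ.+ u (suc i)))
  where
  eq : ∀ a t u t′ u′ → (t ℚ.+ a ℚ.* u) ℚ.+ (t′ ℚ.+ a ℚ.* u′) ≡ (t ℚ.+ t′) ℚ.+ a ℚ.* (u ℚ.+ u′)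
  eq = solve 5 (λ a t u t′ u′ → (t :+ a :* u) :+ (t′ :+ a :* u′) := (t :+ t′) :+ a :* (u :+ u′)) refl
    where open ℚ-Solver

δ : ℕ → ℕ → ℚ
δ zero    zero    = 1ℚ
δ zero    (suc i) = 0ℚ
δ (suc k) zero    = 0ℚ
δ (suc k) (suc i) = δ k i

δ-same : ∀ k → δ k k ≡ 1ℚ
δ-same zero    = refl
δ-same (suc k) = δ-same k

δ-other : ∀ {k i} → i ≢ k → δ k i ≡ 0ℚ
δ-other {zero}  {zero}  i≢k = contradiction refl i≢k
δ-other {zero}  {suc i} i≢k = refl
δ-other {suc k} {zero}  i≢k = refl
δ-other {suc k} {suc i} i≢k = δ-other (i≢k ∘ cong suc)

-- The recursion of `binomialSum` is Pascal's rule; the Kronecker delta reads off one weight.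
binomialSum-δ : ∀ r k → binomialSum r (δ k) ≡ ι (r ℕ.C k)
binomialSum-δ zero    zero    = refl
binomialSum-δ zero    (suc k) = cong ι (sym (ℕ.k>n⇒nCk≡0 {0} {suc k} (s≤s z≤n)))
binomialSum-δ (suc r) zero    = trans (binomialSum-cong r (λ i → ℚ.+-identityʳ (δ 0 i))) (binomialSum-δ r 0)
binomialSum-δ (suc r) (suc k) = begin
  binomialSum r (λ i → δ (suc k) i ℚ.+ δ k i)
    ≡⟨ binomialSum-cong r (λ i → trans (ℚ.+-comm (δ (suc k) i) (δ k i))
         (cong (δ k i ℚ.+_) (sym (ℚ.*-identityˡ (δ (suc k) i))))) ⟩
  binomialSum r (λ i → δ k i ℚ.+ 1ℚ ℚ.* δ (suc k) i)
    ≡⟨ binomialSum-linear r 1ℚ (δ k) (δ (suc k)) ⟩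
  binomialSum r (δ k) ℚ.+ 1ℚ ℚ.* binomialSum r (δ (suc k))
    ≡⟨ cong₂ ℚ._+_ (binomialSum-δ r k) (trans (ℚ.*-identityˡ _) (binomialSum-δ r (suc k))) ⟩
  ι (r ℕ.C k) ℚ.+ ι (r ℕ.C suc k)
    ≡⟨ ι-+ (r ℕ.C k) (r ℕ.C suc k) ⟨
  ι (r ℕ.C k ℕ.+ r ℕ.C suc k)
    ≡⟨ cong ι (ℕ.nCk+nC[k+1]≡[n+1]C[k+1] r k) ⟩
  ι (suc r ℕ.C suc k) ∎
  where open ≡-Reasoning

binomialSum-bound : ∀ r {t K} → (∀ i → i ℕ.≤ r → ℚ.∣ t i ∣ ℚ.≤ K) →
  ℚ.∣ binomialSum r t ∣ ℚ.≤ ι (2 ℕ.^ r) ℚ.* K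
binomialSum-bound zero    {t} {K} bound = subst (ℚ.∣ t 0 ∣ ℚ.≤_) (sym (ℚ.*-identityˡ K)) (bound 0 z≤n)
binomialSum-bound (suc r) {t} {K} bound = subst (ℚ.∣ binomialSum (suc r) t ∣ ℚ.≤_)
  (trans (eq (ι (2 ℕ.^ r)) K) (cong (ℚ._* K) (sym (ι-* 2 (2 ℕ.^ r)))))
  (binomialSum-bound r (λ i i≤r → ℚ.≤-trans (ℚ.∣p+q∣≤∣p∣+∣q∣ (t i) (t (suc i)))
    (ℚ.+-mono-≤ (bound i (ℕ.m≤n⇒m≤1+n i≤r)) (bound (suc i) (s≤s i≤r)))))
  where
  eq : ∀ a k → a ℚ.* (k ℚ.+ k) ≡ ι 2 ℚ.* a ℚ.* k
  eq = solve 2 (λ a k → a :* (k :+ k) := con (ι 2) :* a :* k) refl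
    where open ℚ-Solver

-- As the whole sum is 0, removing the term at m leaves minus that weighted term; the remaining
-- terms are at most K, and the weights add up to 2^r.
binomialSum-isolate : ∀ r m {t K} → 0ℚ ℚ.≤ K → binomialSum r t ≡ 0ℚ →
  (∀ i → i ℕ.≤ r → i ≢ m → ℚ.∣ t i ∣ ℚ.≤ K) → ι (r ℕ.C m) ℚ.* ℚ.∣ t m ∣ ℚ.≤ ι (2 ℕ.^ r) ℚ.* K
binomialSum-isolate r m {t} {K} 0≤K t≡0 bound = subst (ℚ._≤ ι (2 ℕ.^ r) ℚ.* K) abs (binomialSum-bound r u-bound)
  where
  u : ℕ → ℚ
  u i = t i ℚ.+ (ℚ.- t m) ℚ.* δ m i
  abs : ℚ.∣ binomialSum r u ∣ ≡ ι (r ℕ.C m) ℚ.* ℚ.∣ t m ∣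
  abs = begin
    ℚ.∣ binomialSum r u ∣
      ≡⟨ cong ℚ.∣_∣ (binomialSum-linear r (ℚ.- t m) t (δ m)) ⟩
    ℚ.∣ binomialSum r t ℚ.+ (ℚ.- t m) ℚ.* binomialSum r (δ m) ∣
      ≡⟨ cong ℚ.∣_∣ (trans (cong₂ (λ a b → a ℚ.+ (ℚ.- t m) ℚ.* b) t≡0 (binomialSum-δ r m)) (ℚ.+-identityˡ _)) ⟩
    ℚ.∣ (ℚ.- t m) ℚ.* ι (r ℕ.C m) ∣
      ≡⟨ ℚ.∣p*q∣≡∣p∣*∣q∣ (ℚ.- t m) (ι (r ℕ.C m)) ⟩
    ℚ.∣ ℚ.- t m ∣ ℚ.* ℚ.∣ ι (r ℕ.C m) ∣
      ≡⟨ cong₂ ℚ._*_ (ℚ.∣-p∣≡∣p∣ (t m)) (∣ι∣ (r ℕ.C m)) ⟩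
    ℚ.∣ t m ∣ ℚ.* ι (r ℕ.C m)
      ≡⟨ ℚ.*-comm ℚ.∣ t m ∣ (ι (r ℕ.C m)) ⟩
    ι (r ℕ.C m) ℚ.* ℚ.∣ t m ∣ ∎
    where open ≡-Reasoning
  u-bound : ∀ i → i ℕ.≤ r → ℚ.∣ u i ∣ ℚ.≤ K
  u-bound i i≤r with i ℕ.≟ m
  ... | yes refl = subst (ℚ._≤ K) (sym (cong ℚ.∣_∣ (trans (cong (λ d → t m ℚ.+ (ℚ.- t m) ℚ.* d) (δ-same m)) (eq (t m))))) 0≤K
    where
    eq : ∀ a → a ℚ.+ (ℚ.- a) ℚ.* 1ℚ ≡ 0ℚ
    eq = solve 1 (λ a → a :+ (:- a) :* con 1ℚ := con 0ℚ) refl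
      where open ℚ-Solver
  ... | no i≢m = subst (ℚ._≤ K) (sym (cong ℚ.∣_∣ (trans (cong (λ d → t i ℚ.+ (ℚ.- t m) ℚ.* d) (δ-other i≢m))
      (trans (cong (t i ℚ.+_) (ℚ.*-zeroʳ (ℚ.- t m))) (ℚ.+-identityʳ (t i)))))) (bound i i≤r i≢m)

-- The estimate 4^m ≤ (2m + 1) C(2m, m), multiplied by (m!)². From m to m + 1 the left side gains
-- the factor (2m + 2)², the right side (2m + 3)(2m + 2).
4^m*m!² : ∀ m → 2 ℕ.^ (2 ℕ.* m) ℕ.* (m ! ℕ.* m !) ℕ.≤ suc (2 ℕ.* m) ℕ.* (2 ℕ.* m) !
4^m*m!² zero    = ℕ.≤-refl
4^m*m!² (suc m) = subst (λ k → 2 ℕ.^ k ℕ.* (suc m ! ℕ.* suc m !) ℕ.≤ suc k ℕ.* k !) (sym (ℕ.*-suc 2 m)) (begin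
  2 ℕ.* (2 ℕ.* X) ℕ.* (suc m ℕ.* F ℕ.* (suc m ℕ.* F))
    ≡⟨ eq₁ X F m ⟩
  4 ℕ.* (suc m ℕ.* suc m) ℕ.* (X ℕ.* (F ℕ.* F))
    ≤⟨ ℕ.*-mono-≤ le (4^m*m!² m) ⟩
  (3 ℕ.+ 2 ℕ.* m) ℕ.* (2 ℕ.+ 2 ℕ.* m) ℕ.* (suc (2 ℕ.* m) ℕ.* G)
    ≡⟨ eq₂ (3 ℕ.+ 2 ℕ.* m) (2 ℕ.+ 2 ℕ.* m) (suc (2 ℕ.* m)) G ⟩
  (3 ℕ.+ 2 ℕ.* m) ℕ.* ((2 ℕ.+ 2 ℕ.* m) ℕ.* (suc (2 ℕ.* m) ℕ.* G)) ∎)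
  where
  open ℕ.≤-Reasoning
  open ℕ-Solver
  X = 2 ℕ.^ (2 ℕ.* m)
  F = m !
  G = (2 ℕ.* m) !
  eq₁ : ∀ X F m → 2 ℕ.* (2 ℕ.* X) ℕ.* (suc m ℕ.* F ℕ.* (suc m ℕ.* F)) ≡ 4 ℕ.* (suc m ℕ.* suc m) ℕ.* (X ℕ.* (F ℕ.* F))
  eq₁ = solve 3 (λ X F m → con 2 :* (con 2 :* X) :* ((con 1 :+ m) :* F :* ((con 1 :+ m) :* F))
    := con 4 :* ((con 1 :+ m) :* (con 1 :+ m)) :* (X :* (F :* F))) refl
  eq₂ : ∀ a b c g → a ℕ.* b ℕ.* (c ℕ.* g) ≡ a ℕ.* (b ℕ.* (c ℕ.* g))
  eq₂ = solve 4 (λ a b c g → a :* b :* (c :* g) := a :* (b :* (c :* g))) refl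
  le : 4 ℕ.* (suc m ℕ.* suc m) ℕ.≤ (3 ℕ.+ 2 ℕ.* m) ℕ.* (2 ℕ.+ 2 ℕ.* m)
  le = begin
    4 ℕ.* (suc m ℕ.* suc m)                  ≡⟨ eq₃ m ⟩
    (2 ℕ.+ 2 ℕ.* m) ℕ.* (2 ℕ.+ 2 ℕ.* m)      ≤⟨ ℕ.*-monoˡ-≤ (2 ℕ.+ 2 ℕ.* m) (ℕ.n≤1+n (2 ℕ.+ 2 ℕ.* m)) ⟩
    (3 ℕ.+ 2 ℕ.* m) ℕ.* (2 ℕ.+ 2 ℕ.* m)      ∎
    where
    eq₃ : ∀ m → 4 ℕ.* (suc m ℕ.* suc m) ≡ (2 ℕ.+ 2 ℕ.* m) ℕ.* (2 ℕ.+ 2 ℕ.* m)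
    eq₃ = solve 1 (λ m → con 4 :* ((con 1 :+ m) :* (con 1 :+ m)) := (con 2 :+ con 2 :* m) :* (con 2 :+ con 2 :* m)) refl

central-binomial : ∀ m → 2 ℕ.^ (2 ℕ.* m) ℕ.≤ suc (2 ℕ.* m) ℕ.* ((2 ℕ.* m) ℕ.C m)
central-binomial m = ℕ.*-cancelʳ-≤ _ _ (m ! ℕ.* m !) (begin
  2 ℕ.^ (2 ℕ.* m) ℕ.* (m ! ℕ.* m !)                     ≤⟨ 4^m*m!² m ⟩
  suc (2 ℕ.* m) ℕ.* (2 ℕ.* m) !                         ≡⟨ cong (suc (2 ℕ.* m) ℕ.*_) factorials ⟨
  suc (2 ℕ.* m) ℕ.* (((2 ℕ.* m) ℕ.C m) ℕ.* (m ! ℕ.* m !))   ≡⟨ ℕ.*-assoc (suc (2 ℕ.* m)) ((2 ℕ.* m) ℕ.C m) (m ! ℕ.* m !) ⟨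
  suc (2 ℕ.* m) ℕ.* ((2 ℕ.* m) ℕ.C m) ℕ.* (m ! ℕ.* m !)   ∎)
  where
  open ℕ.≤-Reasoning
  instance
    m!²≢0 : ℕ.NonZero (m ! ℕ.* m !)
    m!²≢0 = m ℕ.!* m !≢0
    denominator≢0 : ℕ.NonZero (m ! ℕ.* (2 ℕ.* m ∸ m) !)
    denominator≢0 = m ℕ.!* (2 ℕ.* m ∸ m) !≢0
  m≤2m : m ℕ.≤ 2 ℕ.* m
  m≤2m = ℕ.m≤m+n m (m ℕ.+ 0)
  2m∸m≡m : 2 ℕ.* m ∸ m ≡ m
  2m∸m≡m = trans (ℕ.m+n∸m≡n m (m ℕ.+ 0)) (ℕ.+-identityʳ m)
  factorials : ((2 ℕ.* m) ℕ.C m) ℕ.* (m ! ℕ.* m !) ≡ (2 ℕ.* m) !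
  factorials = subst (λ k → ((2 ℕ.* m) ℕ.C m) ℕ.* (m ! ℕ.* k !) ≡ (2 ℕ.* m) !) 2m∸m≡m
    (trans (cong (ℕ._* (m ! ℕ.* (2 ℕ.* m ∸ m) !)) (ℕ.nCk≡n!/k![n-k]! m≤2m)) (m/n*n≡m (ℕ.k![n∸k]!∣n! m≤2m)))

-- i ↦ (−1)ⁱ h (x + i)
alternate : (ℚ → ℚ) → ℚ → ℕ → ℚ
alternate h x zero    = h x
alternate h x (suc i) = ℚ.- alternate h (x ℚ.+ 1ℚ) i

alternate-difference : ∀ h x i →
  alternate h x i ℚ.+ alternate h x (suc i) ≡ alternate (λ y → h y ℚ.- h (y ℚ.+ 1ℚ)) x i
alternate-difference h x zero    = refl
alternate-difference h x (suc i) = trans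
  (sym (ℚ.neg-distrib-+ (alternate h (x ℚ.+ 1ℚ) i) (alternate h (x ℚ.+ 1ℚ) (suc i))))
  (cong ℚ.-_ (alternate-difference h (x ℚ.+ 1ℚ) i))

-- Each step of `binomialSum` adds neighbouring terms, which for alternating signs is a difference
-- of h; r differences annihilate degrees below r.
finite-difference : ∀ r {h} x → PolynomialBelow r h → binomialSum r (alternate h x) ≡ 0ℚ
finite-difference zero    x p = p x
finite-difference (suc r) {h} x p = trans (binomialSum-cong r (alternate-difference h x))
  (finite-difference r x (poly-difference r p))

∣alternate∣ : ∀ h x i → ℚ.∣ alternate h x i ∣ ≡ ℚ.∣ h (x ℚ.+ ι i) ∣
∣alternate∣ h x zero    = cong (λ y → ℚ.∣ h y ∣) (sym (ℚ.+-identityʳ x))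
∣alternate∣ h x (suc i) = trans (ℚ.∣-p∣≡∣p∣ (alternate h (x ℚ.+ 1ℚ) i))
  (trans (∣alternate∣ h (x ℚ.+ 1ℚ) i)
    (cong (λ y → ℚ.∣ h y ∣) (trans (ℚ.+-assoc x 1ℚ (ι i)) (cong (x ℚ.+_) (sym (ι-+ 1 i))))))

∣p-q∣≤1 : ∀ {a b} → 0ℚ ℚ.≤ a → a ℚ.≤ 1ℚ → 0ℚ ℚ.≤ b → b ℚ.≤ 1ℚ → ℚ.∣ a ℚ.- b ∣ ℚ.≤ 1ℚ
∣p-q∣≤1 {a} {b} 0≤a a≤1 0≤b b≤1 = Log.∣-∣-≤ 1 ℕ.≤-refl {a} {b}
  (ℚ.≤-trans a≤1 (subst (ℚ._≤ b ℚ.+ 1ℚ) (ℚ.+-identityˡ 1ℚ) (ℚ.+-monoˡ-≤ 1ℚ 0≤b)))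
  (ℚ.≤-trans b≤1 (subst (ℚ._≤ a ℚ.+ 1ℚ) (ℚ.+-identityˡ 1ℚ) (ℚ.+-monoˡ-≤ 1ℚ 0≤a)))

0/1-bounds : ∀ {n} (f : BooleanFunction n) x → 0ℚ ℚ.≤ 0/1 f x × 0/1 f x ℚ.≤ 1ℚ
0/1-bounds f x with f x
... | true  = ι-mono-≤ {0} {1} z≤n , ℚ.≤-refl
... | false = ℚ.≤-refl , ι-mono-≤ {0} {1} z≤n

module _ {n} (f : BooleanFunction n) (Bs : List (Subset n)) (disjoint : AllPairs Disjoint Bs) where

  -- Here q = 1 / N and p = u / N. The product of p and the slope is 𝔼(p) - 𝔼(0), at most 1 in
  -- absolute value, and p ≥ 1 / N because u ≥ 1.
  slope-bound : ∀ {q N} → 0ℚ ℚ.< q → q ℚ.* ι N ≡ 1ℚ → ∀ u → 1 ℕ.≤ u → u ℕ.≤ N →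
    ℚ.∣ slope Bs (0/1 f) (q ℚ.* ι u) ∣ ℚ.≤ ι N
  slope-bound {q} {N} q>0 qN≡1 u 1≤u u≤N = begin
    ℚ.∣ S ∣                  ≡⟨ ℚ.*-identityˡ ℚ.∣ S ∣ ⟨
    1ℚ ℚ.* ℚ.∣ S ∣           ≡⟨ cong (ℚ._* ℚ.∣ S ∣) (trans (ℚ.*-comm (ι N) q) qN≡1) ⟨
    ι N ℚ.* q ℚ.* ℚ.∣ S ∣    ≡⟨ ℚ.*-assoc (ι N) q ℚ.∣ S ∣ ⟩
    ι N ℚ.* (q ℚ.* ℚ.∣ S ∣)  ≤⟨ ℚ.*-monoˡ-≤-nonNeg (ι N) {{ℚ.nonNegative (0≤ι N)}} q∣S∣≤1 ⟩
    ι N ℚ.* 1ℚ               ≡⟨ ℚ.*-identityʳ (ι N) ⟩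
    ι N                      ∎
    where
    open ℚ.≤-Reasoning
    p S c : ℚ
    p = q ℚ.* ι u
    S = slope Bs (0/1 f) p
    c = 0/1 f ⊥
    instance
      q≥0 : ℚ.NonNegative q
      q≥0 = ℚ.nonNegative (ℚ.<⇒≤ q>0)
    q≤p : q ℚ.≤ p
    q≤p = subst (ℚ._≤ p) (ℚ.*-identityʳ q) (ℚ.*-monoˡ-≤-nonNeg q (ι-mono-≤ 1≤u))
    p≤1 : p ℚ.≤ 1ℚ
    p≤1 = subst (p ℚ.≤_) qN≡1 (ℚ.*-monoˡ-≤-nonNeg q (ι-mono-≤ u≤N))
    0≤p : 0ℚ ℚ.≤ p
    0≤p = ℚ.≤-trans (ℚ.<⇒≤ q>0) q≤p
    pS : 𝔼 Bs (0/1 f) p ℚ.- c ≡ p ℚ.* S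
    pS = trans (cong (ℚ._- c) (𝔼-slope Bs (0/1 f) disjoint p)) (eq c (p ℚ.* S))
      where
      eq : ∀ c a → (c ℚ.+ a) ℚ.- c ≡ a
      eq = solve 2 (λ c a → (c :+ a) :- c := a) refl
        where open ℚ-Solver
    q∣S∣≤1 : q ℚ.* ℚ.∣ S ∣ ℚ.≤ 1ℚ
    q∣S∣≤1 = begin
      q ℚ.* ℚ.∣ S ∣                  ≤⟨ ℚ.*-monoʳ-≤-nonNeg ℚ.∣ S ∣ {{ℚ.∣-∣-nonNeg S}} q≤p ⟩
      p ℚ.* ℚ.∣ S ∣                  ≡⟨ cong (ℚ._* ℚ.∣ S ∣) (ℚ.0≤p⇒∣p∣≡p 0≤p) ⟨
      ℚ.∣ p ∣ ℚ.* ℚ.∣ S ∣            ≡⟨ ℚ.∣p*q∣≡∣p∣*∣q∣ p S ⟨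
      ℚ.∣ p ℚ.* S ∣                  ≡⟨ cong ℚ.∣_∣ pS ⟨
      ℚ.∣ 𝔼 Bs (0/1 f) p ℚ.- c ∣     ≤⟨ (let l , u = 𝔼-bounds Bs (0/1 f) (0/1-bounds f) 0≤p p≤1
                                             l′ , u′ = 0/1-bounds f ⊥ in ∣p-q∣≤1 l u l′ u′) ⟩
      1ℚ                             ∎

⊥⊕ : ∀ {n} (x : Cube n) → ⊥ ⊕ x ≡ x
⊥⊕ []      = refl
⊥⊕ (b ∷ x) = cong (b ∷_) (⊥⊕ x)

-- All sensitive blocks move f away from the same value `f ⊥`, so their contributions have one sign
-- and cannot cancel.
∣slope-at-0∣ : ∀ {n} (f : BooleanFunction n) Bs → All (Sensitive f ⊥) Bs →
  ℚ.∣ slope Bs (0/1 f) 0ℚ ∣ ≡ ι (length Bs)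
∣slope-at-0∣ f Bs sensitive = trans (cong ℚ.∣_∣ (go Bs sensitive))
  (trans (ℚ.∣p*q∣≡∣p∣*∣q∣ (ι (length Bs)) jump) (trans (cong₂ ℚ._*_ (∣ι∣ (length Bs)) ∣jump∣) (ℚ.*-identityʳ _)))
  where
  jump : ℚ
  jump = if f ⊥ then ℚ.- 1ℚ else 1ℚ
  ∣jump∣ : ℚ.∣ jump ∣ ≡ 1ℚ
  ∣jump∣ with f ⊥
  ... | true  = refl
  ... | false = refl
  difference : ∀ {B} → Sensitive f ⊥ B → 0/1 f B ℚ.- 0/1 f ⊥ ≡ jump
  difference {B} sens with f B | f ⊥ | subst (λ C → ¬ f C ≡ f ⊥) (⊥⊕ B) sens
  ... | true  | true  | ≢ = contradiction refl ≢
  ... | true  | false | _ = refl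
  ... | false | true  | _ = refl
  ... | false | false | ≢ = contradiction refl ≢
  go : ∀ Bs → All (Sensitive f ⊥) Bs → slope Bs (0/1 f) 0ℚ ≡ ι (length Bs) ℚ.* jump
  go []       []       = sym (ℚ.*-zeroˡ jump)
  go (B ∷ Bs) (p ∷ ps) = begin
    slope (B ∷ Bs) (0/1 f) 0ℚ                     ≡⟨ slope-at-0 B Bs (0/1 f) ⟩
    slope Bs (0/1 f) 0ℚ ℚ.+ (0/1 f B ℚ.- 0/1 f ⊥) ≡⟨ cong₂ ℚ._+_ (go Bs ps) (difference p) ⟩
    ι (length Bs) ℚ.* jump ℚ.+ jump               ≡⟨ eq (ι (length Bs)) jump ⟩
    (1ℚ ℚ.+ ι (length Bs)) ℚ.* jump               ≡⟨ cong (ℚ._* jump) (ι-+ 1 (length Bs)) ⟨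
    ι (length (B ∷ Bs)) ℚ.* jump                  ∎
    where
    open ≡-Reasoning
    eq : ∀ a b → a ℚ.* b ℚ.+ b ≡ (1ℚ ℚ.+ a) ℚ.* b
    eq = solve 2 (λ a b → a :* b :+ b := (con 1ℚ :+ a) :* b) refl
      where open ℚ-Solver

-- The i-th node of the difference is i - m; only its square enters the even polynomial, and off the
-- centre this is d² with d² between 1 and m², as `slope-bound` requires.
squared-distance : ∀ m i → i ℕ.≤ 2 ℕ.* m → i ≢ m → ∃ λ d → 1 ℕ.≤ d × d ℕ.≤ m ×
  (ℚ.- ι m ℚ.+ ι i) ℚ.* (ℚ.- ι m ℚ.+ ι i) ≡ ι (d ℕ.* d)
squared-distance m i i≤2m i≢m with ℕ.≤-total i m
... | inj₁ i≤m = m ∸ i , ℕ.m<n⇒0<n∸m (ℕ.≤∧≢⇒< i≤m i≢m) , ℕ.m∸n≤m m i , (begin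
  (ℚ.- ι m ℚ.+ ι i) ℚ.* (ℚ.- ι m ℚ.+ ι i)
    ≡⟨ cong (λ k → (ℚ.- k ℚ.+ ι i) ℚ.* (ℚ.- k ℚ.+ ι i)) (trans (cong ι (sym (ℕ.m+[n∸m]≡n i≤m))) (ι-+ i (m ∸ i))) ⟩
  (ℚ.- (ι i ℚ.+ ι (m ∸ i)) ℚ.+ ι i) ℚ.* (ℚ.- (ι i ℚ.+ ι (m ∸ i)) ℚ.+ ι i)
    ≡⟨ eq (ι i) (ι (m ∸ i)) ⟩
  ι (m ∸ i) ℚ.* ι (m ∸ i) ≡⟨ ι-* (m ∸ i) (m ∸ i) ⟨
  ι ((m ∸ i) ℕ.* (m ∸ i)) ∎)
  where
  open ≡-Reasoning
  eq : ∀ i d → (ℚ.- (i ℚ.+ d) ℚ.+ i) ℚ.* (ℚ.- (i ℚ.+ d) ℚ.+ i) ≡ d ℚ.* d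
  eq = solve 2 (λ i d → (:- (i :+ d) :+ i) :* (:- (i :+ d) :+ i) := d :* d) refl
    where open ℚ-Solver
... | inj₂ m≤i = i ∸ m , ℕ.m<n⇒0<n∸m (ℕ.≤∧≢⇒< m≤i (i≢m ∘ sym)) ,
  subst (i ∸ m ℕ.≤_) (trans (ℕ.m+n∸m≡n m (m ℕ.+ 0)) (ℕ.+-identityʳ m)) (ℕ.∸-monoˡ-≤ m i≤2m) , (begin
  (ℚ.- ι m ℚ.+ ι i) ℚ.* (ℚ.- ι m ℚ.+ ι i)
    ≡⟨ cong (λ k → (ℚ.- ι m ℚ.+ k) ℚ.* (ℚ.- ι m ℚ.+ k)) (trans (cong ι (sym (ℕ.m+[n∸m]≡n m≤i))) (ι-+ m (i ∸ m))) ⟩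
  (ℚ.- ι m ℚ.+ (ι m ℚ.+ ι (i ∸ m))) ℚ.* (ℚ.- ι m ℚ.+ (ι m ℚ.+ ι (i ∸ m)))
    ≡⟨ eq (ι m) (ι (i ∸ m)) ⟩
  ι (i ∸ m) ℚ.* ι (i ∸ m) ≡⟨ ι-* (i ∸ m) (i ∸ m) ⟨
  ι ((i ∸ m) ℕ.* (i ∸ m)) ∎)
  where
  open ≡-Reasoning
  eq : ∀ m d → (ℚ.- m ℚ.+ (m ℚ.+ d)) ℚ.* (ℚ.- m ℚ.+ (m ℚ.+ d)) ≡ d ℚ.* d
  eq = solve 2 (λ m d → (:- m :+ (m :+ d)) :* (:- m :+ (m :+ d)) := d :* d) refl
    where open ℚ-Solver

-- The slope has degree < m, so the 2m-th finite difference of the even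
-- polynomial slope (x² / m²) around x = 0 vanishes.  The values of this
-- polynomial at ±1, …, ±m are at most m² in absolute value, and its value at 0,
-- which is ±(length Bs), has the largest binomial coefficient.
disjoint-sensitive-blocks : ∀ {n} m (f : BooleanFunction n) → 1 ℕ.≤ m → DegreeBelow (suc m) (0/1 f) →
  ∀ Bs → AllPairs Disjoint Bs → All (Sensitive f ⊥) Bs →
  length Bs ℕ.≤ suc (2 ℕ.* m) ℕ.* (m ℕ.* m)
disjoint-sensitive-blocks m f 1≤m degree Bs disjoint sensitive =
  -- q = 1 / m², the scale that keeps q x² in [0,1] at all nodes.
  let _ , q>0 , qN≡1 = divide {ι (m ℕ.* m)} {1ℚ} (0<ι (ℕ.*-mono-≤ 1≤m 1≤m)) (ℚ.positive⁻¹ 1ℚ)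
  in bound q>0 qN≡1
  where
  open ℚ.≤-Reasoning
  C₀ = (2 ℕ.* m) ℕ.C m
  eq : ∀ a b c → a ℕ.* b ℕ.* c ≡ b ℕ.* (a ℕ.* c)
  eq = solve 3 (λ a b c → a :* b :* c := b :* (a :* c)) refl
    where open ℕ-Solver
  C₀>0 : 0ℚ ℚ.< ι C₀
  C₀>0 = 0<ι (ℕ.n≢0⇒n>0 λ C₀≡0 → ℕ.<⇒≱ (ℕ.m^n>0 2 (2 ℕ.* m))
    (ℕ.≤-trans (central-binomial m) (ℕ.≤-reflexive (trans (cong (suc (2 ℕ.* m) ℕ.*_) C₀≡0) (ℕ.*-zeroʳ (suc (2 ℕ.* m)))))))
  module _ {q} (q>0 : 0ℚ ℚ.< q) (qN≡1 : q ℚ.* ι (m ℕ.* m) ≡ 1ℚ) where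
    h : ℚ → ℚ
    h x = slope Bs (0/1 f) (q ℚ.* (x ℚ.* x))
    t : ℕ → ℚ
    t = alternate h (ℚ.- ι m)
    t-m : ℚ.∣ t m ∣ ≡ ι (length Bs)
    t-m = trans (∣alternate∣ h (ℚ.- ι m) m) (trans
      (cong (λ p → ℚ.∣ slope Bs (0/1 f) p ∣)
        (trans (cong (λ x → q ℚ.* (x ℚ.* x)) (ℚ.+-inverseˡ (ι m))) (ℚ.*-zeroʳ q)))
      (∣slope-at-0∣ f Bs sensitive))
    t-other : ∀ i → i ℕ.≤ 2 ℕ.* m → i ≢ m → ℚ.∣ t i ∣ ℚ.≤ ι (m ℕ.* m)
    t-other i i≤2m i≢m = let d , 1≤d , d≤m , d²≡ = squared-distance m i i≤2m i≢m in
      subst (ℚ._≤ ι (m ℕ.* m))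
        (sym (trans (∣alternate∣ h (ℚ.- ι m) i) (cong (λ u → ℚ.∣ slope Bs (0/1 f) (q ℚ.* u) ∣) d²≡)))
        (slope-bound f Bs disjoint q>0 qN≡1 (d ℕ.* d) (ℕ.*-mono-≤ 1≤d 1≤d) (ℕ.*-mono-≤ d≤m d≤m))
    bound : length Bs ℕ.≤ suc (2 ℕ.* m) ℕ.* (m ℕ.* m)
    bound = ι-cancel-≤ (ℚ.*-cancelˡ-≤-pos (ι C₀) {{ℚ.positive C₀>0}} (begin
      ι C₀ ℚ.* ι (length Bs)                                ≡⟨ cong (ι C₀ ℚ.*_) t-m ⟨
      ι C₀ ℚ.* ℚ.∣ t m ∣                                    ≤⟨ binomialSum-isolate (2 ℕ.* m) m (0≤ι (m ℕ.* m))
        (finite-difference (2 ℕ.* m) (ℚ.- ι m) (poly-square m q (poly-slope (suc m) Bs degree disjoint))) t-other ⟩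
      ι (2 ℕ.^ (2 ℕ.* m)) ℚ.* ι (m ℕ.* m)                   ≡⟨ ι-* (2 ℕ.^ (2 ℕ.* m)) (m ℕ.* m) ⟨
      -- Bounding 4^m by 2m + 1 central binomial coefficients lets the coefficient `C₀` cancel.
      ι (2 ℕ.^ (2 ℕ.* m) ℕ.* (m ℕ.* m))                     ≤⟨ ι-mono-≤ (ℕ.*-monoˡ-≤ (m ℕ.* m) (central-binomial m)) ⟩
      ι (suc (2 ℕ.* m) ℕ.* C₀ ℕ.* (m ℕ.* m))                ≡⟨ cong ι (eq (suc (2 ℕ.* m)) C₀ (m ℕ.* m)) ⟩
      ι (C₀ ℕ.* (suc (2 ℕ.* m) ℕ.* (m ℕ.* m)))              ≡⟨ ι-* C₀ (suc (2 ℕ.* m) ℕ.* (m ℕ.* m)) ⟩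
      ι C₀ ℚ.* ι (suc (2 ℕ.* m) ℕ.* (m ℕ.* m))              ∎))

-- Real bounds and natural bounds

max-attained : ∀ ms → max 0 ms ≡ 0 ⊎ max 0 ms ∈ₗ ms
max-attained = argmax-sel id 0

-- Where a maximum is only its default value 0, the empty family is the witness.
block-family : ∀ {n} (f : BooleanFunction n) → ∃ λ x → ∃ λ Bs →
  AllPairs Disjoint Bs × All (Sensitive f x) Bs × length Bs ≡ bs f
block-family {n} f with max-attained (map (bs-at f) (cube n))
... | inj₁ bs≡0 = ⊥ , [] , [] , [] , sym bs≡0
... | inj₂ bs∈ with ∈-map⁻ (bs-at f) bs∈
...   | x , _ , bs≡ with max-attained (map length (families f x))
...     | inj₁ bs-at≡0 = x , [] , [] , [] , sym (trans bs≡ bs-at≡0)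
...     | inj₂ bs-at∈ with ∈-map⁻ length bs-at∈
...       | Bs , Bs∈ , eq =
  let Bs∈′ , disjoint = ∈-filter⁻ (allPairs? disjoint?) {xs = sublists (filter (sensitive? f x) (cube n))} Bs∈
  in x , Bs , disjoint
   , All.tabulate (λ B∈ → proj₂ (∈-filter⁻ (sensitive? f x) {xs = cube n} (sublists-⊆ _ Bs∈′ B∈)))
   , sym (trans bs≡ eq)

shifted-point : ∀ {n} (x y z : Cube n) → (x ⊕ y) ⊕ z ≡ (x ⊕ z) ⊕ y
shifted-point x y z = trans (⊕-assoc x y z) (trans (cong (x ⊕_) (⊕-comm y z)) (sym (⊕-assoc x z y)))

s-shifted : ∀ {n} (f : BooleanFunction n) z → s (f shifted z) ℕ.≤ s f
s-shifted {n} f z = max≤v⁺ {xs = map (s-at (f shifted z)) (cube n)} z≤n (All.tabulate λ k∈ →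
  let x , _ , k≡ = ∈-map⁻ (s-at (f shifted z)) k∈ in
  ℕ.≤-trans (ℕ.≤-reflexive k≡) (ℕ.≤-trans
    (length-filter-mono (λ i → sensitive? (f shifted z) x ⁅ i ⁆) (λ i → sensitive? f (x ⊕ z) ⁅ i ⁆)
      (λ {i} sens eq → sens (trans (cong f (shifted-point x ⁅ i ⁆ z)) eq)) (allFin n))
    (s-at≤s f (x ⊕ z))))

sensitive-shifted : ∀ {n} (f : BooleanFunction n) {x B} → Sensitive f x B → Sensitive (f shifted x) ⊥ B
sensitive-shifted f {x} {B} sens eq = sens (begin
  f (x ⊕ B)         ≡⟨ cong (λ y → f (y ⊕ B)) (⊥⊕ x) ⟨
  f ((⊥ ⊕ x) ⊕ B)   ≡⟨ cong f (shifted-point ⊥ x B) ⟩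
  f ((⊥ ⊕ B) ⊕ x)   ≡⟨ eq ⟩
  f (⊥ ⊕ x)         ≡⟨ cong f (⊥⊕ x) ⟩
  f x               ∎)
  where open ≡-Reasoning

-- The shift by z brings the point of the blocks to `⊥`; the shift by z′ produces many monomials.
-- Degree 2L + 1 would be too much: (3/2)^(2L+1) > 2^L because 3 · 9^L > 2 · 8^L. So the degree is
-- at most m = 2L, and (2m + 1) m² = (4L + 1) 4L² ≤ 20 L³.
bs-bound : ∀ {n} (f : BooleanFunction n) L → 1 ℕ.≤ L →
  (∀ z z′ → monomials (0/1 ((f shifted z) shifted z′)) ℕ.< 2 ℕ.^ L) → bs f ℕ.≤ 20 ℕ.* (L ℕ.* (L ℕ.* L))
bs-bound f L 1≤L few with block-family f
... | x , Bs , disjoint , sensitive , length≡ with low-degree-or-many-monomials (suc (2 ℕ.* L)) (0/1 (f shifted x))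
...   | inj₂ (z , many) = contradiction (begin-strict
  3 ℕ.^ suc (2 ℕ.* L)                                    ≤⟨ many ⟩
  2 ℕ.^ suc (2 ℕ.* L) ℕ.* M                              <⟨ ℕ.*-monoʳ-< (2 ℕ.^ suc (2 ℕ.* L)) {{ℕ.m^n≢0 2 (suc (2 ℕ.* L))}} (few x z) ⟩
  2 ℕ.^ suc (2 ℕ.* L) ℕ.* 2 ℕ.^ L                        ≡⟨ ℕ.^-distribˡ-+-* 2 (suc (2 ℕ.* L)) L ⟨
  2 ℕ.* 2 ℕ.^ (2 ℕ.* L ℕ.+ L)                            ≡⟨ cong (λ k → 2 ℕ.* 2 ℕ.^ k) (ℕ.+-comm (2 ℕ.* L) L) ⟩
  2 ℕ.* 2 ℕ.^ (3 ℕ.* L)                                  ≡⟨ cong (2 ℕ.*_) (ℕ.^-*-assoc 2 3 L) ⟨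
  2 ℕ.* 8 ℕ.^ L                                          ≤⟨ ℕ.*-mono-≤ (ℕ.n≤1+n 2) (ℕ.^-monoˡ-≤ L (ℕ.n≤1+n 8)) ⟩
  3 ℕ.* 9 ℕ.^ L                                          ≡⟨ cong (3 ℕ.*_) (ℕ.^-*-assoc 3 2 L) ⟩
  3 ℕ.^ suc (2 ℕ.* L)                                    ∎) (ℕ.<-irrefl refl)
  where
  open ℕ.≤-Reasoning
  M = monomials (0/1 (f shifted x) shifted z)
...   | inj₁ degree = begin
  bs f                                                   ≡⟨ length≡ ⟨
  length Bs                                              ≤⟨ disjoint-sensitive-blocks (2 ℕ.* L) (f shifted x) (ℕ.≤-trans 1≤L (ℕ.m≤m+n L _))
                                                              degree Bs disjoint (All.map (sensitive-shifted f) sensitive) ⟩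
  suc (2 ℕ.* (2 ℕ.* L)) ℕ.* (2 ℕ.* L ℕ.* (2 ℕ.* L))      ≤⟨ ℕ.*-monoˡ-≤ (2 ℕ.* L ℕ.* (2 ℕ.* L)) (ℕ.+-monoˡ-≤ (2 ℕ.* (2 ℕ.* L)) 1≤L) ⟩
  (L ℕ.+ 2 ℕ.* (2 ℕ.* L)) ℕ.* (2 ℕ.* L ℕ.* (2 ℕ.* L))    ≡⟨ eq L ⟩
  20 ℕ.* (L ℕ.* (L ℕ.* L))                               ∎
  where
  open ℕ.≤-Reasoning
  eq : ∀ L → (L ℕ.+ 2 ℕ.* (2 ℕ.* L)) ℕ.* (2 ℕ.* L ℕ.* (2 ℕ.* L)) ≡ 20 ℕ.* (L ℕ.* (L ℕ.* L))
  eq = solve 1 (λ L → (L :+ con 2 :* (con 2 :* L)) :* (con 2 :* L :* (con 2 :* L)) := con 20 :* (L :* (L :* L))) refl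
    where open ℕ-Solver

independent-columns-cong : ∀ {I J : Set} {M M′ : I → J → ℝ} {k} → (∀ i j → M i j ≈ M′ i j) →
  IndependentColumns M k → IndependentColumns M′ k
independent-columns-cong eq (col , indep) = col , λ c c≈0 → indep c λ i →
  R.trans (ℝΣ.sum-cong-≋ (λ j → R.*-congˡ {c j} (eq i (col j)))) (c≈0 i)

andMatrix-meet : ∀ {n} (f : BooleanFunction n) x y → andMatrix f x y ≈ meet-matrix (0/1 f) x y
andMatrix-meet f x y with f (x ∩ y)
... | true  = R.refl
... | false = R.refl

andMatrix-rank : ∀ {n} (f : BooleanFunction n) → HasRank (andMatrix f) (monomials (0/1 f))
andMatrix-rank f =
    independent-columns-cong (λ x y → R.sym (andMatrix-meet f x y)) (independent-columns (0/1 f))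
  , λ k ind → independent-columns-≤ (0/1 f) k (independent-columns-cong (andMatrix-meet f) ind)

-- Growth of real polynomials and logarithms at natural arguments

-- The terms themselves are compared, without ε, so that bounds add and multiply directly. Coming
-- from `_≤_` with ε = 1 costs 1, which polynomial bounds absorb.
record _≲_ (x : ℝ) (b : ℕ) : Set where
  constructor eventually
  field
    from  : ℕ
    below : ∀ n → from ℕ.≤ n → seq x n ℚ.≤ ι b

natural-above : ∀ q → ∃ λ k → q ℚ.≤ ι k
natural-above (mkℚ (ℤ.+ k) d _) = k , ℚ.toℚᵘ-cancel-≤ (ℚᵘ.≤-respʳ-≃ (ℚᵘ.≃-sym (toℚᵘ-ι k))
  (ℚᵘ.*≤* (subst₂ ℤ._≤_ (ℤ.pos-* k 1) (ℤ.pos-* k (suc d)) (ℤ.+≤+ (ℕ.*-monoʳ-≤ k (s≤s (z≤n {d})))))))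
natural-above q@(mkℚ ℤ.-[1+ _ ] _ _) = 0 , ℚ.nonPositive⁻¹ q

bounded-above : ∀ x → ∃ λ k → x ≲ k
bounded-above x =
  let K , _ , N , ∣x∣≤K = bounded x
      k , K≤k = natural-above K
  in k , eventually N λ n N≤n → ℚ.≤-trans (p≤∣p∣ (seq x n)) (ℚ.≤-trans (∣x∣≤K n N≤n) K≤k)
  where
  p≤∣p∣ : ∀ p → p ℚ.≤ ℚ.∣ p ∣
  p≤∣p∣ p with ℚ.≤-total 0ℚ p
  ... | inj₁ 0≤p = ℚ.≤-reflexive (sym (ℚ.0≤p⇒∣p∣≡p 0≤p))
  ... | inj₂ p≤0 = ℚ.≤-trans p≤0 (ℚ.0≤∣p∣ p)

-- Natural upper bounds replace the coefficients, and k + 1, which is never 0, replaces k, so that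
-- one term absorbs the lower ones. Only the index from which the bound holds may depend on k.
polynomial-growth : ∀ (p : Polynomial) → ∃ λ c → ∃ λ e → ∀ k → ⟦ p ⟧ (fromℕ k) ≲ (c ℕ.* suc k ℕ.^ e)
polynomial-growth [] = 0 , 0 , λ k → eventually 0 λ _ _ → ℚ.≤-refl
polynomial-growth (a ∷ p) =
  let b , eventually M a≤b = bounded-above a
      c , e , growth = polynomial-growth p
  in b ℕ.+ c , suc e , λ k →
    let eventually N p≤ = growth k
    in eventually (M ℕ.⊔ N) λ n n≥ → step b c e k
         (a≤b n (ℕ.m⊔n≤o⇒m≤o M N n≥)) (p≤ n (ℕ.m⊔n≤o⇒n≤o M N n≥))
  where
  step : ∀ b c e k {x y} → x ℚ.≤ ι b → y ℚ.≤ ι (c ℕ.* suc k ℕ.^ e) →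
    x ℚ.+ ι k ℚ.* y ℚ.≤ ι ((b ℕ.+ c) ℕ.* suc k ℕ.^ suc e)
  step b c e k {x} {y} x≤b y≤ = begin
    x ℚ.+ ι k ℚ.* y                    ≤⟨ ℚ.+-mono-≤ x≤b (ℚ.*-monoˡ-≤-nonNeg (ι k) {{ℚ.nonNegative (0≤ι k)}} y≤) ⟩
    ι b ℚ.+ ι k ℚ.* ι (c ℕ.* K)        ≡⟨ cong (ι b ℚ.+_) (ι-* k (c ℕ.* K)) ⟨
    ι b ℚ.+ ι (k ℕ.* (c ℕ.* K))        ≡⟨ ι-+ b (k ℕ.* (c ℕ.* K)) ⟨
    ι (b ℕ.+ k ℕ.* (c ℕ.* K))          ≤⟨ ι-mono-≤ (ℕ.+-mono-≤ b≤ (ℕ.*-monoˡ-≤ (c ℕ.* K) (ℕ.n≤1+n k))) ⟩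
    ι (b ℕ.* suc k ℕ.^ suc e ℕ.+ suc k ℕ.* (c ℕ.* K))  ≡⟨ cong ι (eq b c K k) ⟩
    ι ((b ℕ.+ c) ℕ.* suc k ℕ.^ suc e)  ∎
    where
    open ℚ.≤-Reasoning
    K = suc k ℕ.^ e
    b≤ : b ℕ.≤ b ℕ.* suc k ℕ.^ suc e
    b≤ = ℕ.m≤m*n b (suc k ℕ.^ suc e) {{ℕ.m^n≢0 (suc k) (suc e)}}
    eq : ∀ b c K k → b ℕ.* (suc k ℕ.* K) ℕ.+ suc k ℕ.* (c ℕ.* K) ≡ (b ℕ.+ c) ℕ.* (suc k ℕ.* K)
    eq = solve 4 (λ b c K k → b :* ((con 1 :+ k) :* K) :+ (con 1 :+ k) :* (c :* K) := (b :+ c) :* ((con 1 :+ k) :* K)) refl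
      where open ℕ-Solver

-- The coefficients of a + (1 + x) p (x).
times-1+x : ℕ → List ℕ → List ℕ
times-1+x a []       = a ∷ []
times-1+x a (c ∷ cs) = a ℕ.+ c ∷ times-1+x c cs

evaluate : List ℕ → ℕ → ℕ
evaluate []       k = 0
evaluate (c ∷ cs) k = c ℕ.+ k ℕ.* evaluate cs k

evaluate-times-1+x : ∀ a cs k → evaluate (times-1+x a cs) k ≡ a ℕ.+ suc k ℕ.* evaluate cs k
evaluate-times-1+x a []       k = cong (a ℕ.+_) (trans (ℕ.*-zeroʳ k) (sym (ℕ.*-zeroʳ (suc k))))
evaluate-times-1+x a (c ∷ cs) k = trans (cong (λ v → a ℕ.+ c ℕ.+ k ℕ.* v) (evaluate-times-1+x c cs k))
  (eq a c k (evaluate cs k))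
  where
  eq : ∀ a c k v → a ℕ.+ c ℕ.+ k ℕ.* (c ℕ.+ suc k ℕ.* v) ≡ a ℕ.+ suc k ℕ.* (c ℕ.+ k ℕ.* v)
  eq = solve 4 (λ a c k v → a :+ c :+ k :* (c :+ (con 1 :+ k) :* v) := a :+ (con 1 :+ k) :* (c :+ k :* v)) refl
    where open ℕ-Solver

power : ℕ → ℕ → List ℕ
power c zero    = c ∷ []
power c (suc e) = times-1+x 0 (power c e)

evaluate-power : ∀ c e k → evaluate (power c e) k ≡ c ℕ.* suc k ℕ.^ e
evaluate-power c zero    k = trans (cong (c ℕ.+_) (ℕ.*-zeroʳ k)) (trans (ℕ.+-identityʳ c) (sym (ℕ.*-identityʳ c)))
evaluate-power c (suc e) k = trans (evaluate-times-1+x 0 (power c e) k)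
  (trans (cong (suc k ℕ.*_) (evaluate-power c e k)) (eq (suc k) c (suc k ℕ.^ e)))
  where
  eq : ∀ a b c → a ℕ.* (b ℕ.* c) ≡ b ℕ.* (a ℕ.* c)
  eq = solve 3 (λ a b c → a :* (b :* c) := b :* (a :* c)) refl
    where open ℕ-Solver

seq-⟦⟧ : ∀ cs k n → seq (⟦ map fromℕ cs ⟧ (fromℕ k)) n ≡ ι (evaluate cs k)
seq-⟦⟧ []       k n = refl
seq-⟦⟧ (c ∷ cs) k n = trans (cong (λ v → ι c ℚ.+ ι k ℚ.* v) (seq-⟦⟧ cs k n))
  (sym (trans (ι-+ c (k ℕ.* evaluate cs k)) (cong (ι c ℚ.+_) (ι-* k (evaluate cs k)))))

polynomial-of-growth : ∀ c e → ∃ λ (p : Polynomial) → ∀ k n → seq (⟦ p ⟧ (fromℕ k)) n ≡ ι (c ℕ.* suc k ℕ.^ e)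
polynomial-of-growth c e = map fromℕ (power c e) , λ k n →
  trans (seq-⟦⟧ (power c e) k n) (cong ι (evaluate-power c e k))

≤-≲ : ∀ {x y b} → x ≤ y → y ≲ b → x ≲ suc b
≤-≲ {b = b} x≤y (eventually M y≤b) =
  let N , x≤y+1 = run≤ x≤y 1ℚ (ℚ.positive⁻¹ 1ℚ)
  in eventually (M ℕ.⊔ N) λ n n≥ → ℚ.≤-trans (x≤y+1 n (ℕ.m⊔n≤o⇒n≤o M N n≥))
  (ℚ.≤-trans (ℚ.+-monoˡ-≤ 1ℚ (y≤b n (ℕ.m⊔n≤o⇒m≤o M N n≥)))
    (ℚ.≤-reflexive (trans (ℚ.+-comm (ι b) 1ℚ) (sym (ι-+ 1 b)))))

≤-from-seq : ∀ {x y} → (∀ n → seq x n ℚ.≤ seq y n) → x ≤ y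
≤-from-seq {x} {y} le = mk≤ λ ε ε>0 → 0 , λ n _ → ℚ.≤-trans (le n)
  (subst (ℚ._≤ seq y n ℚ.+ ε) (ℚ.+-identityʳ (seq y n)) (ℚ.+-monoʳ-≤ (seq y n) (ℚ.<⇒≤ ε>0)))

fraction-≤ : ∀ {a n b} → a ℕ.≤ b ℕ.* suc n → ℤ.+ a ℚ./ suc n ℚ.≤ ι b
fraction-≤ {a} {n} {b} le = Log.fromℚᵘ-mono-≤ 1 ℕ.≤-refl {ℚᵘ.mkℚᵘ (ℤ.+ a) n} {ℚᵘ.mkℚᵘ (ℤ.+ b) 0}
  (ℚᵘ.*≤* (subst₂ ℤ._≤_ (sym (ℤ.*-identityʳ (ℤ.+ a))) (ℤ.pos-* b (suc n)) (ℤ.+≤+ le)))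

fraction-≤⁻¹ : ∀ {a n b} → ℤ.+ a ℚ./ suc n ℚ.≤ ι b → a ℕ.≤ b ℕ.* suc n
fraction-≤⁻¹ {a} {n} {b} le = unwrap (ℚᵘ.≤-respˡ-≃ (ℚ.toℚᵘ-fromℚᵘ (ℚᵘ.mkℚᵘ (ℤ.+ a) n))
  (ℚᵘ.≤-respʳ-≃ (toℚᵘ-ι b) (ℚ.toℚᵘ-mono-≤ le)))
  where
  unwrap : ℚᵘ.mkℚᵘ (ℤ.+ a) n ℚᵘ.≤ ℚᵘ.mkℚᵘ (ℤ.+ b) 0 → a ℕ.≤ b ℕ.* suc n
  unwrap (ℚᵘ.*≤* le) = ℤ.drop‿+≤+ (subst₂ ℤ._≤_ (ℤ.*-identityʳ (ℤ.+ a)) (sym (ℤ.pos-* b (suc n))) le)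

-- A single term of the sequence for `log₂ r` decides: `≤-≲` raises b to b + 1, whereas r ≥ 2^(b+2)
-- would make every term at least b + 2.
log₂≤⇒< : ∀ r {x b} → log₂ r ≤₋ [ x ] → x ≲ b → r ℕ.< 2 ℕ.^ suc (suc b)
log₂≤⇒< zero    {b = b} _ _ = ℕ.m^n>0 2 (suc (suc b))
log₂≤⇒< r@(suc _) {x} {b} [ log≤x ] x≲b = ℕ.≰⇒> λ 2^≤r →
  let eventually n le = ≤-≲ log≤x x≲b
      a≤ = fraction-≤⁻¹ {n = n} {b = suc b} (le n ℕ.≤-refl)
  in ℕ.<⇒≱ (begin-strict
       suc b ℕ.* suc n                                   <⟨ ℕ.m<n+m (suc b ℕ.* suc n) (s≤s z≤n) ⟩
       suc (suc b) ℕ.* suc n                             ≡⟨ ⌊log₂[2^n]⌋≡n (suc (suc b) ℕ.* suc n) ⟨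
       ⌊log₂ (2 ℕ.^ (suc (suc b) ℕ.* suc n)) ⌋           ≡⟨ cong ⌊log₂_⌋ (ℕ.^-*-assoc 2 (suc (suc b)) (suc n)) ⟨
       ⌊log₂ ((2 ℕ.^ suc (suc b)) ℕ.^ suc n) ⌋           ≤⟨ ⌊log₂⌋-mono-≤ (ℕ.^-monoˡ-≤ (suc n) 2^≤r) ⟩
       ⌊log₂ (r ℕ.^ suc n) ⌋                             ∎) a≤
  where open ℕ.≤-Reasoning

≤2^⇒log₂≤ : ∀ r {x b} → r ℕ.≤ 2 ℕ.^ b → (∀ n → seq x n ≡ ι b) → log₂ r ≤₋ [ x ]
≤2^⇒log₂≤ zero    _ _ = ⊥₋≤ _
≤2^⇒log₂≤ r@(suc _) {x} {b} r≤2^b x≡b = [ ≤-from-seq (λ n → subst (_ ℚ.≤_) (sym (x≡b n)) (fraction-≤ {b = b} (begin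
  ⌊log₂ (r ℕ.^ suc n) ⌋              ≤⟨ ⌊log₂⌋-mono-≤ (ℕ.^-monoˡ-≤ (suc n) r≤2^b) ⟩
  ⌊log₂ ((2 ℕ.^ b) ℕ.^ suc n) ⌋      ≡⟨ cong ⌊log₂_⌋ (ℕ.^-*-assoc 2 b (suc n)) ⟩
  ⌊log₂ (2 ℕ.^ (b ℕ.* suc n)) ⌋      ≡⟨ ⌊log₂[2^n]⌋≡n (b ℕ.* suc n) ⟩
  b ℕ.* suc n                        ∎))) ]
  where open ℕ.≤-Reasoning

growth-+ : ∀ c d k e → c ℕ.+ d ℕ.* suc k ℕ.^ e ℕ.≤ (c ℕ.+ d) ℕ.* suc k ℕ.^ e
growth-+ c d k e = begin
  c ℕ.+ d ℕ.* K            ≤⟨ ℕ.+-monoˡ-≤ (d ℕ.* K) (ℕ.m≤m*n c K {{ℕ.m^n≢0 (suc k) e}}) ⟩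
  c ℕ.* K ℕ.+ d ℕ.* K      ≡⟨ ℕ.*-distribʳ-+ K c d ⟨
  (c ℕ.+ d) ℕ.* K          ∎
  where
  open ℕ.≤-Reasoning
  K = suc k ℕ.^ e

rank-bound : ∀ {n} (f : BooleanFunction n) c e → bs f ℕ.≤ c ℕ.* suc (s f) ℕ.^ e →
  monomials (0/1 f) ℕ.≤ 2 ℕ.^ (2 ℕ.* (c ℕ.* c) ℕ.* suc (s f) ℕ.^ (suc e ℕ.* 2))
rank-bound f c e bs≤ = begin
  monomials (0/1 f)                          ≤⟨ monomials≤3^[bs*s]² f ⟩
  -- Passing from 3 to 4 gives a power of 2, at the price of the factor 2 in the exponent.
  3 ℕ.^ (k ℕ.* k)                            ≤⟨ ℕ.^-monoˡ-≤ (k ℕ.* k) (ℕ.n≤1+n 3) ⟩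
  4 ℕ.^ (k ℕ.* k)                            ≡⟨ ℕ.^-*-assoc 2 2 (k ℕ.* k) ⟩
  2 ℕ.^ (2 ℕ.* (k ℕ.* k))                    ≤⟨ ℕ.^-monoʳ-≤ 2 (ℕ.*-monoʳ-≤ 2 (ℕ.*-mono-≤ k≤ k≤)) ⟩
  2 ℕ.^ (2 ℕ.* (c ℕ.* E ℕ.* S ℕ.* (c ℕ.* E ℕ.* S)))
    ≡⟨ cong (2 ℕ.^_) (trans (eq c E S) (cong (2 ℕ.* (c ℕ.* c) ℕ.*_) (ℕ.^-*-assoc S (suc e) 2))) ⟩
  2 ℕ.^ (2 ℕ.* (c ℕ.* c) ℕ.* S ℕ.^ (suc e ℕ.* 2)) ∎
  where
  open ℕ.≤-Reasoning
  k = bs f ℕ.* s f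
  S = suc (s f)
  E = S ℕ.^ e
  -- The sensitivity contributes one more factor S, whence `suc e`; squaring doubles it.
  k≤ : k ℕ.≤ c ℕ.* E ℕ.* S
  k≤ = ℕ.*-mono-≤ bs≤ (ℕ.n≤1+n (s f))
  eq : ∀ c E S → 2 ℕ.* (c ℕ.* E ℕ.* S ℕ.* (c ℕ.* E ℕ.* S)) ≡ 2 ℕ.* (c ℕ.* c) ℕ.* (S ℕ.* E) ℕ.^ 2
  eq = solve 3 (λ c E S → con 2 :* (c :* E :* S :* (c :* E :* S)) := con 2 :* (c :* c) :* (S :* E) :^ 2) refl
    where open ℕ-Solver

theorem4p1p3 : (∃ λ (p : Polynomial) →
    ∀ (n : ℕ) → 1 ℕ.≤ n → (f : BooleanFunction n) →
    fromℕ (bs f) ≤ ⟦ p ⟧ (fromℕ (s f)))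
    ⇔
    (∃ λ (q : Polynomial) →
    ∀ (n : ℕ) → 1 ℕ.≤ n → (f : BooleanFunction n) →
    ∀ (r : ℕ) → HasRank (andMatrix f) r →
    log₂ r ≤₋ [ ⟦ q ⟧ (fromℕ (s f)) ])
theorem4p1p3 = mk⇔ sensitivity⇒rank rank⇒sensitivity
  where
  sensitivity⇒rank : _ → _
  sensitivity⇒rank (p , bs≤p) =
    let c , e , growth = polynomial-growth p
        -- `suc c` absorbs the 1 lost in `≤-≲`.
        C = 2 ℕ.* (suc c ℕ.* suc c)
        q , q≡ = polynomial-of-growth C (suc e ℕ.* 2)
    in q , λ n 1≤n f r rank →
      let eventually N bs≤ = ≤-≲ (bs≤p n 1≤n f) (growth (s f))
      in ≤2^⇒log₂≤ r {b = C ℕ.* suc (s f) ℕ.^ (suc e ℕ.* 2)}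
           (ℕ.≤-trans (proj₂ (andMatrix-rank f) r (proj₁ rank))
             (rank-bound f (suc c) e (ℕ.≤-trans (ι-cancel-≤ (bs≤ N ℕ.≤-refl)) (growth-+ 1 c (s f) e))))
           (q≡ (s f))
  rank⇒sensitivity : _ → _
  rank⇒sensitivity (q , log≤q) =
    let c , e , growth = polynomial-growth q
        -- The 2 absorbs the two additional powers of 2 in `log₂≤⇒<`.
        C = 2 ℕ.+ c
        p , p≡ = polynomial-of-growth (20 ℕ.* (C ℕ.* (C ℕ.* C))) (e ℕ.* 3)
    in p , λ n 1≤n f →
      let S = suc (s f)
          L = C ℕ.* S ℕ.^ e
      in ≤-from-seq λ m → subst (ι (bs f) ℚ.≤_) (sym (p≡ (s f) m)) (ι-mono-≤ (ℕ.≤-trans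
           (bs-bound f L (ℕ.*-mono-≤ {1} {C} (s≤s z≤n) (ℕ.m^n>0 S e)) (λ z z′ →
             -- Shifting does not raise the sensitivity, so one exponent L serves all z and z′.
             let g = (f shifted z) shifted z′
                 s≤ = ℕ.≤-trans (s-shifted (f shifted z) z′) (s-shifted f z)
             in ℕ.<-≤-trans
                  (log₂≤⇒< (monomials (0/1 g)) (log≤q n 1≤n g _ (andMatrix-rank g)) (growth (s g)))
                  (ℕ.^-monoʳ-≤ 2 (ℕ.≤-trans (growth-+ 2 c (s g) e)
                    (ℕ.*-monoʳ-≤ C (ℕ.^-monoˡ-≤ e (s≤s s≤)))))))
           (ℕ.≤-reflexive (trans (eq C (S ℕ.^ e)) (cong (20 ℕ.* (C ℕ.* (C ℕ.* C)) ℕ.*_) (ℕ.^-*-assoc S e 3))))))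
    where
    eq : ∀ C E → 20 ℕ.* (C ℕ.* E ℕ.* (C ℕ.* E ℕ.* (C ℕ.* E))) ≡ 20 ℕ.* (C ℕ.* (C ℕ.* C)) ℕ.* E ℕ.^ 3
    eq = solve 2 (λ C E → con 20 :* (C :* E :* (C :* E :* (C :* E))) := con 20 :* (C :* (C :* C)) :* E :^ 3) refl
      where open ℕ-Solver
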